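{- Let $\mathcal{A}$ be a finite list in a finitely generated abelian group $\Gamma$ and $G$ a torsion-wise finite abelian group. Then: (1) if $\mathcal{S}\subset\mathcal{A}$ and $\alpha\in\mathcal{A}$ satisfy $r_{\mathcal{S}\cup\{\alpha\}}=r_{\mathcal{S}}$, then $m(\mathcal{S}\cup\{\alpha\};G)$ divides $m(\mathcal{S};G)$; (2) if $r_{\mathcal{S}\cup\{\alpha\}}=r_{\mathcal{S}}+1$, then $m(\mathcal{S};G)$ divides $m(\mathcal{S}\cup\{\alpha\};G)$; (4) if $\mathcal{S}\subset\mathcal{T}\subset\mathcal{A}$ and $r_{\mathcal{S}}=r_{\mathcal{T}}$, then $\sum_{\mathcal{S}\subset\mathcal{B}\subset\mathcal{T}}(-1)^{\#\mathcal{B}-\#\mathcal{S}}m(\mathcal{B};G)\ge0$; (5) if $\mathcal{S}\subset\mathcal{T}\subset\mathcal{A}$ and $r_{\mathcal{T}}=r_{\mathcal{S}}+\#(\mathcal{T}\smallsetminus\mathcal{S})$, then $\sum_{\mathcal{S}\subset\mathcal{B}\subset\mathcal{T}}(-1)^{\#\mathcal{T}-\#\mathcal{B}}m(\mathcal{B};G)\ge0$. If moreover $G$ is divisible (multiplication by $k$ is surjective on $G$ for every positive integer $k$), then also: (3) if $\mathcal{S}\subset\mathcal{T}\subset\mathcal{A}$ and $\mathcal{T}=\mathcal{S}\sqcup\mathcal{B}\sqcup\mathcal{C}$ is such that $r_{\mathcal{R}}=r_{\mathcal{S}}+\#(\mathcal{R}\cap\mathcal{B})$ for all $\mathcal{S}\subset\mathcal{R}\subset\mathcal{T}$,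 then $m(\mathcal{S};G)\,m(\mathcal{T};G)=m(\mathcal{S}\sqcup\mathcal{B};G)\,m(\mathcal{S}\sqcup\mathcal{C};G)$.
   Context: $G$ is torsion-wise finite if $G[d]=\{x\in G\mid dx=0\}$ is finite for all $d>0$. Sublists are distinguished by index (sums run over sublists $\mathcal{B}$ with $\mathcal{S}\subset\mathcal{B}\subset\mathcal{T}$). $r_{\mathcal{S}}$ is the rank of $\langle\mathcal{S}\rangle$ and $m(\mathcal{S};G)=\#\mathrm{Hom}((\Gamma/\langle\mathcal{S}\rangle)_{\mathrm{tor}},G)$. -}

module Defs where

open import Algebra.Bundles using (AbelianGroup)
open import Algebra.Morphism.Bundles using (GroupHomomorphism)
import Algebra.Properties.AbelianGroup as AbelianGroupProperties
import Algebra.Properties.CommutativeMonoid.Mult as Mult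
open import Data.Bool.Base using (true; false)
open import Data.Fin.Base using (Fin)
open import Data.Fin.Subset using (Subset; _∈_)
open import Data.Fin.Subset.Properties using (_⊆?_)
open import Data.Integer.Base as ℤ using (ℤ; 0ℤ; +_; -[1+_])
open import Data.List.Base as List using (List; _++_; filter; foldr)
open import Data.Nat.Base as ℕ using (ℕ; zero; suc; NonZero)
open import Data.Nat.Properties using (m*n≢0; *-comm)
open import Data.Product.Base using (Σ; ∃; ∃-syntax; _×_; _,_; proj₁)
open import Data.Vec.Base using ([]; _∷_)
open import Data.Vec.Functional using (Vector)
open import Function.Base using (_∘_)
open import Function.Bundles using (Inverse)
open import Level using (Level; _⊔_)
open import Relation.Binary.Bundles using (Setoid)
open import Relation.Binary.PropositionalEquality as ≡ using (_≡_)
open import Relation.Nullary.Decidable using (_×-dec_)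
open import Relation.Unary using (Pred)
import Relation.Binary.Reasoning.Setoid as SetoidReasoning

private
  variable
    a b : Level
    n : ℕ

HasCardinality : Setoid a b → ℕ → Set (a ⊔ b)
HasCardinality X k = Inverse X (≡.setoid (Fin k))

IsFinite : Setoid a b → Set (a ⊔ b)
IsFinite X = ∃[ k ] HasCardinality X k

module _ {c ℓ} (Γ : AbelianGroup c ℓ) where
  open AbelianGroup Γ
  open import Algebra.Definitions.RawMonoid rawMonoid using (sum) renaming (_×_ to _×ₙ_)
  open AbelianGroupProperties Γ using (ε⁻¹≈ε; ⁻¹-∙-comm; ⁻¹-involutive)
  open Mult commutativeMonoid using (×-congʳ; ×-assocˡ; ×-distrib-+)

  infixr 8 _·_

  _·_ : ℤ → Carrier → Carrier
  (+ k)    · x = k ×ₙ x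
  -[1+ k ] · x = (suc k ×ₙ x) ⁻¹

  data Generated {I : Set} (v : I → Carrier) : Pred Carrier (c ⊔ ℓ) where
    gen  : ∀ i → Generated v (v i)
    unit : Generated v ε
    mul  : ∀ {x y} → Generated v x → Generated v y → Generated v (x ∙ y)
    inv  : ∀ {x} → Generated v x → Generated v (x ⁻¹)
    resp : ∀ {x y} → x ≈ y → Generated v x → Generated v y

  IsFinitelyGenerated : Set (c ⊔ ℓ)
  IsFinitelyGenerated = ∃[ k ] Σ (Vector Carrier k) λ g → ∀ x → Generated g x

  -- The sublist of A whose set of indices is S.
  _↾_ : Vector Carrier n → (S : Subset n) → ∃ (_∈ S) → Carrier
  A ↾ S = A ∘ proj₁

  LinearlyIndependent : Vector Carrier n → Set ℓ
  LinearlyIndependent v =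
    ∀ (z : Vector ℤ _) → sum (λ i → z i · v i) ≈ ε → ∀ i → z i ≡ 0ℤ

  -- r is the rank of the subgroup H, i.e. the largest number of ℤ-linearly
  -- independent elements of H.
  IsRank : ∀ {p} → Pred Carrier p → ℕ → Set (c ⊔ ℓ ⊔ p)
  IsRank H r =
      (Σ (Vector Carrier r) λ v → (∀ i → H (v i)) × LinearlyIndependent v)
    × (∀ {k} (v : Vector Carrier k) → (∀ i → H (v i)) → LinearlyIndependent v → k ℕ.≤ r)

  -- The quotient keeps the carrier and coarsens the equality.
  quotient : {I : Set} → (I → Carrier) → AbelianGroup c (c ⊔ ℓ)
  quotient v = record
    { Carrier = Carrier
    ; _≈_ = λ x y → Generated v (x ∙ y ⁻¹)
    ; _∙_ = _∙_
    ; ε = ε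
    ; _⁻¹ = _⁻¹
    ; isAbelianGroup = record
      { isGroup = record
        { isMonoid = record
          { isSemigroup = record
            { isMagma = record
              { isEquivalence = record
                { refl = lift refl
                ; sym = λ {x} {y} p → resp (swap x y) (inv p)
                ; trans = λ {x} {y} {z} p q → resp (cancel x y z) (mul p q)
                }
              ; ∙-cong = λ {x} {y} {u} {w} p q → resp (exchange x y u w) (mul p q)
              }
            ; assoc = λ x y z → lift (assoc x y z)
            }
          ; identity = (λ x → lift (identityˡ x)) , (λ x → lift (identityʳ x))
          }
        ; inverse = (λ x → lift (inverseˡ x)) , (λ x → lift (inverseʳ x))
        ; ⁻¹-cong = λ {x} {y} p → resp (sym (⁻¹-∙-comm x (y ⁻¹))) (inv p)
        }
      ; comm = λ x y → lift (comm x y)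
      }
    }
    where
    open SetoidReasoning setoid

    lift : ∀ {x y} → x ≈ y → Generated v (x ∙ y ⁻¹)
    lift {x} {y} x≈y = resp (trans (sym (inverseʳ y)) (∙-congʳ (sym x≈y))) unit

    swap : ∀ x y → (x ∙ y ⁻¹) ⁻¹ ≈ y ∙ x ⁻¹
    swap x y = begin
      (x ∙ y ⁻¹) ⁻¹     ≈⟨ ⁻¹-∙-comm x (y ⁻¹) ⟨
      x ⁻¹ ∙ y ⁻¹ ⁻¹    ≈⟨ ∙-congˡ (⁻¹-involutive y) ⟩
      x ⁻¹ ∙ y          ≈⟨ comm (x ⁻¹) y ⟩
      y ∙ x ⁻¹          ∎

    cancel : ∀ x y z → (x ∙ y ⁻¹) ∙ (y ∙ z ⁻¹) ≈ x ∙ z ⁻¹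
    cancel x y z = begin
      (x ∙ y ⁻¹) ∙ (y ∙ z ⁻¹)  ≈⟨ assoc x (y ⁻¹) (y ∙ z ⁻¹) ⟩
      x ∙ (y ⁻¹ ∙ (y ∙ z ⁻¹))  ≈⟨ ∙-congˡ (assoc (y ⁻¹) y (z ⁻¹)) ⟨
      x ∙ ((y ⁻¹ ∙ y) ∙ z ⁻¹)  ≈⟨ ∙-congˡ (∙-congʳ (inverseˡ y)) ⟩
      x ∙ (ε ∙ z ⁻¹)           ≈⟨ ∙-congˡ (identityˡ (z ⁻¹)) ⟩
      x ∙ z ⁻¹                 ∎

    open import Algebra.Properties.CommutativeSemigroup commutativeSemigroup
      using (interchange)

    exchange : ∀ x y u w → (x ∙ y ⁻¹) ∙ (u ∙ w ⁻¹) ≈ (x ∙ u) ∙ (y ∙ w) ⁻¹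
    exchange x y u w =
      trans (interchange x (y ⁻¹) u (w ⁻¹)) (∙-congˡ (⁻¹-∙-comm y w))

  IsTorsion : Pred Carrier ℓ
  IsTorsion x = ∃[ k ] NonZero k × k ×ₙ x ≈ ε

  torsion : AbelianGroup (c ⊔ ℓ) ℓ
  torsion = record
    { Carrier = ∃ IsTorsion
    ; _≈_ = λ x y → proj₁ x ≈ proj₁ y
    ; _∙_ = λ (x , p) (y , q) → x ∙ y , tor-∙ p q
    ; ε = ε , 1 , _ , identityʳ ε
    ; _⁻¹ = λ (x , p) → x ⁻¹ , tor-⁻¹ p
    ; isAbelianGroup = record
      { isGroup = record
        { isMonoid = record
          { isSemigroup = record
            { isMagma = record
              { isEquivalence = record { refl = refl ; sym = sym ; trans = trans }
              ; ∙-cong = ∙-cong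
              }
            ; assoc = λ x y z → assoc (proj₁ x) (proj₁ y) (proj₁ z)
            }
          ; identity = (λ x → identityˡ (proj₁ x)) , (λ x → identityʳ (proj₁ x))
          }
        ; inverse = (λ x → inverseˡ (proj₁ x)) , (λ x → inverseʳ (proj₁ x))
        ; ⁻¹-cong = ⁻¹-cong
        }
      ; comm = λ x y → comm (proj₁ x) (proj₁ y)
      }
    }
    where
    open SetoidReasoning setoid

    ×-ε : ∀ k → k ×ₙ ε ≈ ε
    ×-ε zero    = refl
    ×-ε (suc k) = trans (identityˡ (k ×ₙ ε)) (×-ε k)

    ×-⁻¹ : ∀ k x → k ×ₙ (x ⁻¹) ≈ (k ×ₙ x) ⁻¹
    ×-⁻¹ zero    x = sym ε⁻¹≈ε
    ×-⁻¹ (suc k) x = trans (∙-congˡ (×-⁻¹ k x)) (⁻¹-∙-comm x (k ×ₙ x))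

    ×-kills : ∀ k l {x} → l ×ₙ x ≈ ε → (k ℕ.* l) ×ₙ x ≈ ε
    ×-kills k l {x} p = trans (sym (×-assocˡ x k l)) (trans (×-congʳ k p) (×-ε k))

    tor-∙ : ∀ {x y} → IsTorsion x → IsTorsion y → IsTorsion (x ∙ y)
    tor-∙ {x} {y} (k , k≢0 , p) (l , l≢0 , q) =
      k ℕ.* l , m*n≢0 k l {{k≢0}} {{l≢0}} , (begin
        (k ℕ.* l) ×ₙ (x ∙ y)                  ≈⟨ ×-distrib-+ x y (k ℕ.* l) ⟩
        (k ℕ.* l) ×ₙ x ∙ (k ℕ.* l) ×ₙ y       ≡⟨ ≡.cong (λ j → j ×ₙ x ∙ (k ℕ.* l) ×ₙ y) (*-comm k l) ⟩
        (l ℕ.* k) ×ₙ x ∙ (k ℕ.* l) ×ₙ y       ≈⟨ ∙-cong (×-kills l k p) (×-kills k l q) ⟩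
        ε ∙ ε                                 ≈⟨ identityʳ ε ⟩
        ε                                     ∎)

    tor-⁻¹ : ∀ {x} → IsTorsion x → IsTorsion (x ⁻¹)
    tor-⁻¹ {x} (k , k≢0 , p) =
      k , k≢0 , trans (×-⁻¹ k x) (trans (⁻¹-cong p) ε⁻¹≈ε)

  -- The underlying setoid of Γ[d] = {x ∈ Γ ∣ d x = 0}.
  _[_] : ℕ → Setoid (c ⊔ ℓ) ℓ
  _[_] d = record
    { Carrier = ∃[ x ] d ×ₙ x ≈ ε
    ; _≈_ = λ x y → proj₁ x ≈ proj₁ y
    ; isEquivalence = record { refl = refl ; sym = sym ; trans = trans }
    }

  IsTorsionWiseFinite : Set (c ⊔ ℓ)
  IsTorsionWiseFinite = ∀ d → .{{NonZero d}} → IsFinite (_[_] d)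

  IsDivisible : Set (c ⊔ ℓ)
  IsDivisible = ∀ k → .{{NonZero k}} → ∀ y → ∃[ x ] k ×ₙ x ≈ y

Hom : ∀ {c₁ ℓ₁ c₂ ℓ₂} → AbelianGroup c₁ ℓ₁ → AbelianGroup c₂ ℓ₂ →
      Setoid (c₁ ⊔ ℓ₁ ⊔ c₂ ⊔ ℓ₂) (c₁ ⊔ ℓ₂)
Hom H G = record
  { Carrier = GroupHomomorphism H.rawGroup G.rawGroup
  ; _≈_ = λ f g → ∀ x → ⟦ f ⟧ x G.≈ ⟦ g ⟧ x
  ; isEquivalence = record
    { refl = λ _ → G.refl
    ; sym = λ p x → G.sym (p x)
    ; trans = λ p q x → G.trans (p x) (q x)
    }
  }
  where
  module H = AbelianGroup H
  module G = AbelianGroup G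
  open GroupHomomorphism using (⟦_⟧)

-- Constructively, ranks and cardinalities need not be computable from Γ and G,
-- so the functions S ↦ r_S and S ↦ m(S;G) are characterised by the following
-- two properties, each of which determines its function uniquely.

IsRankFunction : ∀ {c ℓ} (Γ : AbelianGroup c ℓ) → Vector (AbelianGroup.Carrier Γ) n →
                 (Subset n → ℕ) → Set (c ⊔ ℓ)
IsRankFunction Γ A r = ∀ S → IsRank Γ (Generated Γ (_↾_ Γ A S)) (r S)

-- m(S;G) = # Hom((Γ/⟨S⟩)ₜₒᵣ, G)
IsMultiplicity : ∀ {c₁ ℓ₁ c₂ ℓ₂} (Γ : AbelianGroup c₁ ℓ₁) → AbelianGroup c₂ ℓ₂ →
                 Vector (AbelianGroup.Carrier Γ) n →
                 (Subset n → ℕ) → Set (c₁ ⊔ ℓ₁ ⊔ c₂ ⊔ ℓ₂)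
IsMultiplicity Γ G A m =
  ∀ S → HasCardinality (Hom (torsion (quotient Γ (_↾_ Γ A S))) G) (m S)

-- Every subset of Fin n, listed exactly once.
subsets : ∀ n → List (Subset n)
subsets zero    = List.[ [] ]
subsets (suc n) = List.map (false ∷_) (subsets n) ++ List.map (true ∷_) (subsets n)

∑[_⊆-⊆_]_ : Subset n → Subset n → (Subset n → ℤ) → ℤ
∑[ S ⊆-⊆ T ] f =
  foldr ℤ._+_ 0ℤ (List.map f (filter (λ B → S ⊆? B ×-dec B ⊆? T) (subsets _)))

{-# OPTIONS --safe #-}
module Submission where

-- For a finite group D the group P_B = Hom(Γ/⟨B⟩, D) is easier to count than Hom((Γ/⟨B⟩)ₜₒᵣ, G).
-- Choose d > 0 killing the torsion of every Γ/⟨B⟩ and put D = G[d], N = #D.  Since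
-- Γ/⟨B⟩ ≅ (Γ/⟨B⟩)ₜₒᵣ ⊕ ℤ^(R - r_B) with R = rank Γ, we have #P_B · N^(r_B) = m(B) · N^R, and
-- for S ⊆ B the group P_B consists of the φ ∈ P_S that vanish on B.
--
-- (1), (2): P_{S ∪ α} is the kernel of the evaluation P_S → D at α, whose image has order
-- dividing N.
-- (4), (5): up to a positive factor the alternating sums are sums over φ ∈ P_∅ of a product over
-- i of [φ(αᵢ) = 0] for i ∈ S, and of 1 - [φ(αᵢ) = 0], respectively N [φ(αᵢ) = 0] - 1, for
-- i ∈ T ∖ S.  In (4) all terms are nonnegative.  In (5) each factor is a positive definite
-- function of φ, because N [a = b] - 1 = N⁻¹ ∑_c (N [a = c] - 1) (N [b = c] - 1) on D; by Schur's
-- product theorem so is the product, and a positive definite function on a finite abelian group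
-- has a nonnegative sum.
-- (3): it suffices that P_S = P_{S ⊔ B} + P_{S ⊔ C}, since P_T is the intersection.  Given φ ∈ P_S,
-- glue φ on the saturation of ⟨S⟩ with 0 on ⟨S ⊔ B⟩, extend to Γ → G by divisibility, and
-- transport the restriction to the torsion of Γ/⟨S ⊔ B⟩ back to P_{S ⊔ B}.
--
-- All conclusions are decidable, so the choices above need only exist up to double negation.

open import Algebra.Bundles using (AbelianGroup; CommutativeMonoid; Semiring)
import Algebra.Construct.DirectProduct as DirectProduct
open import Algebra.Morphism.Bundles using (GroupHomomorphism)
import Algebra.Properties.AbelianGroup
import Algebra.Properties.CommutativeMonoid.Mult
import Algebra.Properties.CommutativeMonoid.Sum
import Algebra.Properties.CommutativeSemigroup
import Algebra.Properties.Semiring.Sum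
open import Data.Bool.Base using (Bool; true; false; if_then_else_)
open import Data.Empty using (⊥-elim)
open import Data.Fin.Base
  using (Fin; zero; suc; punchIn; _↑ˡ_; _↑ʳ_; splitAt; combine; remQuot; funToFin; finToFun)
open import Data.Fin.Permutation using (permutation)
import Data.Fin.Properties as Fin
open import Data.Fin.Subset using (Subset; _⊆_; ∣_∣; _∈_; _∉_; _∪_; _∩_; _─_; ⁅_⁆; Empty; ⊥)
open import Data.Fin.Subset.Properties
  using (_⊆?_; drop-∷-⊆; p⊆q⇒∣p∣≤∣q∣; out⊆; s⊆s; _∈?_; ∪-identityʳ; ⊆-refl; ⊆-min; p⊂q⇒∣p∣<∣q∣;
    p⊆p∪q; q⊆p∪q; x∈p∪q⁻; x∈⁅x⁆; x∈⁅y⁆⇒x≡y; ⊆-antisym; x∈p∩q⁺; x∈p∩q⁻)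
open import Data.Integer.Base as ℤ using (ℤ; +_; -[1+_]; 0ℤ; 1ℤ; _⊖_; -1ℤ)
import Data.Integer.DivMod as ℤ
import Data.Integer.Properties as ℤ
import Data.Integer.Tactic.RingSolver as ℤ
open import Data.List.Base as List using (List; []; _∷_; filter; foldr)
open import Data.Nat.Base as ℕ using (ℕ; zero; suc; NonZero; _+_; _*_; _∸_; _^_)
open import Data.Nat.Divisibility using (_∣_; divides; _∣?_; ∣-trans; m∣m*n; n∣m*n)
open import Data.Nat.Induction using (<-rec)
import Data.Nat.Properties as ℕ
import Data.Nat.Tactic.RingSolver as ℕ
open import Data.Product.Base using (Σ; ∃; ∃-syntax; _×_; _,_; proj₁; proj₂; uncurry)
open import Data.Product.Relation.Binary.Pointwise.NonDependent using (×-setoid)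
open import Data.Sum.Base using (inj₁; inj₂; [_,_]′)
open import Data.Vec.Base using ([]; _∷_; lookup; here; there)
import Data.Vec.Base as Vec
open import Data.Vec.Functional using (Vector; insertAt; _++_) renaming (_∷_ to _∷ᵥ_)
open import Data.Vec.Functional.Properties using (insertAt-lookup; insertAt-punchIn)
open import Data.Vec.Functional.Relation.Binary.Equality.Setoid using (≋-setoid)
open import Defs
open import Function.Base using (_∘_)
open import Function.Bundles using (Inverse)
open import Function.Definitions using (Injective)
open import Level using (Level; _⊔_)
open import Relation.Binary.Bundles using (Setoid)
open import Relation.Binary.PropositionalEquality as ≡ using (_≡_; _≢_; _≗_)
import Relation.Binary.Reasoning.Setoid as SetoidReasoning
open import Relation.Nullary using (¬_; yes; no; Dec; does; contradiction)
open import Relation.Nullary.Decidable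
  using (¬?; decidable-stable; ¬¬-excluded-middle; map′; dec-true; _×-dec_; _→-dec_)
open import Relation.Unary using (Pred)

-- The sets counted by m(S) and m(B) cannot be compared directly: for S ⊆ B the map (Γ/⟨S⟩)ₜₒᵣ →
-- (Γ/⟨B⟩)ₜₒᵣ is in general neither injective nor surjective. Between the whole quotients the
-- projection is surjective, so homomorphisms out of Γ/⟨B⟩ embed into those out of Γ/⟨S⟩. The target
-- must then be finite, since Hom(ℤ, G) = G need not be; this is why G is cut down to G[d]. The
-- price is a power of N depending on the rank of ⟨B⟩, and the rank hypothesis of each statement
-- says exactly how that power varies. Positivity in (5) could be read off from a Fourier transform;
-- Schur's theorem replaces complex characters by integer kernels that are Gram matrices up to a
-- positive integer factor. In (3) the group G[d], being finite, is divisible only if it is trivial.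
-- The extension is therefore made with values in G and returns to G[d] through torsion elements, on
-- which d bounds the order of the values.

record IsSubgroup {c ℓ p} (Γ : AbelianGroup c ℓ) (H : Pred (AbelianGroup.Carrier Γ) p) : Set (c ⊔ ℓ ⊔ p) where
  open AbelianGroup Γ
  field
    H-resp : ∀ {x y} → x ≈ y → H x → H y
    H-ε    : H ε
    H-∙    : ∀ {x y} → H x → H y → H (x ∙ y)
    H-⁻¹   : ∀ {x} → H x → H (x ⁻¹)

-- Integer multiples, linear combinations and operations on subgroups

module Combinations {c ℓ} (Γ : AbelianGroup c ℓ) where
  open AbelianGroup Γ
  open Algebra.Properties.AbelianGroup Γ public
    using (ε⁻¹≈ε; ⁻¹-∙-comm; ⁻¹-involutive; x∙y⁻¹≈ε⇒x≈y; x≈y⇒x∙y⁻¹≈ε)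
  open Algebra.Properties.CommutativeMonoid.Mult commutativeMonoid public
    using (×-congʳ; ×-assocˡ; ×-distrib-+; ×-homo-+) renaming (_×_ to _×ₙ_)
  open Algebra.Properties.CommutativeMonoid.Sum commutativeMonoid public
    using (sum; sum-cong-≋; sum-remove; ∑-distrib-+; sum-replicate-zero)
  open Algebra.Properties.CommutativeSemigroup commutativeSemigroup public
    using (interchange)
  open SetoidReasoning setoid

  infixr 8 _∙∙_
  _∙∙_ : ℤ → Carrier → Carrier
  _∙∙_ = _·_ Γ

  private
    variable
      n : ℕ

  ·-cong : ∀ i {x y} → x ≈ y → i ∙∙ x ≈ i ∙∙ y
  ·-cong (+ m)    p = ×-congʳ m p
  ·-cong -[1+ m ] p = ⁻¹-cong (×-congʳ (suc m) p)

  ·-congˡ : ∀ {i j} x → i ≡ j → i ∙∙ x ≈ j ∙∙ x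
  ·-congˡ x ≡.refl = refl

  ×-ε : ∀ k → k ×ₙ ε ≈ ε
  ×-ε zero    = refl
  ×-ε (suc k) = trans (identityˡ _) (×-ε k)

  ×-⁻¹ : ∀ k x → k ×ₙ (x ⁻¹) ≈ (k ×ₙ x) ⁻¹
  ×-⁻¹ zero    x = sym ε⁻¹≈ε
  ×-⁻¹ (suc k) x = trans (∙-congˡ (×-⁻¹ k x)) (⁻¹-∙-comm x (k ×ₙ x))

  ⊖-· : ∀ m n x → (m ⊖ n) ∙∙ x ≈ m ×ₙ x ∙ (n ×ₙ x) ⁻¹
  ⊖-· m       zero    x = sym (trans (∙-congˡ ε⁻¹≈ε) (identityʳ _))
  ⊖-· zero    (suc n) x = sym (identityˡ _)
  ⊖-· (suc m) (suc n) x = begin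
    (suc m ⊖ suc n) ∙∙ x                 ≈⟨ ·-congˡ x (ℤ.[1+m]⊖[1+n]≡m⊖n m n) ⟩
    (m ⊖ n) ∙∙ x                         ≈⟨ ⊖-· m n x ⟩
    m ×ₙ x ∙ (n ×ₙ x) ⁻¹                 ≈⟨ identityˡ _ ⟨
    ε ∙ (m ×ₙ x ∙ (n ×ₙ x) ⁻¹)           ≈⟨ ∙-congʳ (inverseʳ x) ⟨
    (x ∙ x ⁻¹) ∙ (m ×ₙ x ∙ (n ×ₙ x) ⁻¹)  ≈⟨ interchange x (x ⁻¹) _ _ ⟩
    suc m ×ₙ x ∙ (x ⁻¹ ∙ (n ×ₙ x) ⁻¹)    ≈⟨ ∙-congˡ (⁻¹-∙-comm x _) ⟩
    suc m ×ₙ x ∙ (suc n ×ₙ x) ⁻¹         ∎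

  +-· : ∀ i j x → (i ℤ.+ j) ∙∙ x ≈ i ∙∙ x ∙ j ∙∙ x
  +-· (+ m)    (+ n)    x = ×-homo-+ x m n
  +-· (+ m)    -[1+ n ] x = ⊖-· m (suc n) x
  +-· -[1+ m ] (+ n)    x = trans (⊖-· n (suc m) x) (comm _ _)
  +-· -[1+ m ] -[1+ n ] x = begin
    (suc (suc (m + n)) ×ₙ x) ⁻¹          ≡⟨ ≡.cong (λ k → (suc k ×ₙ x) ⁻¹) (ℕ.+-suc m n) ⟨
    ((suc m + suc n) ×ₙ x) ⁻¹            ≈⟨ ⁻¹-cong (×-homo-+ x (suc m) (suc n)) ⟩
    (suc m ×ₙ x ∙ suc n ×ₙ x) ⁻¹         ≈⟨ ⁻¹-∙-comm _ _ ⟨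
    (suc m ×ₙ x) ⁻¹ ∙ (suc n ×ₙ x) ⁻¹    ∎

  neg-· : ∀ i x → (ℤ.- i) ∙∙ x ≈ (i ∙∙ x) ⁻¹
  neg-· (+ zero)  x = sym ε⁻¹≈ε
  neg-· (+ suc m) x = refl
  neg-· -[1+ m ]  x = sym (⁻¹-involutive _)

  ·-∙ : ∀ i x y → i ∙∙ (x ∙ y) ≈ i ∙∙ x ∙ i ∙∙ y
  ·-∙ (+ m)    x y = ×-distrib-+ x y m
  ·-∙ -[1+ m ] x y = trans (⁻¹-cong (×-distrib-+ x y (suc m))) (sym (⁻¹-∙-comm _ _))

  ·-ε : ∀ i → i ∙∙ ε ≈ ε
  ·-ε (+ m)    = ×-ε m
  ·-ε -[1+ m ] = trans (⁻¹-cong (×-ε (suc m))) ε⁻¹≈ε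

  ·-⁻¹ : ∀ i x → i ∙∙ (x ⁻¹) ≈ (i ∙∙ x) ⁻¹
  ·-⁻¹ (+ m)    x = ×-⁻¹ m x
  ·-⁻¹ -[1+ m ] x = ⁻¹-cong (×-⁻¹ (suc m) x)

  1-· : ∀ x → 1ℤ ∙∙ x ≈ x
  1-· x = identityʳ x

  +*-· : ∀ m j x → (+ m ℤ.* j) ∙∙ x ≈ m ×ₙ (j ∙∙ x)
  +*-· zero    j x = ·-congˡ x (ℤ.*-zeroˡ j)
  +*-· (suc m) j x = begin
    (+ suc m ℤ.* j) ∙∙ x             ≈⟨ ·-congˡ x (ℤ.suc-* (+ m) j) ⟩
    (j ℤ.+ + m ℤ.* j) ∙∙ x           ≈⟨ +-· j (+ m ℤ.* j) x ⟩
    j ∙∙ x ∙ (+ m ℤ.* j) ∙∙ x        ≈⟨ ∙-congˡ (+*-· m j x) ⟩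
    suc m ×ₙ (j ∙∙ x)                ∎

  *-· : ∀ i j x → (i ℤ.* j) ∙∙ x ≈ i ∙∙ (j ∙∙ x)
  *-· (+ m)    j x = +*-· m j x
  *-· -[1+ m ] j x = begin
    (-[1+ m ] ℤ.* j) ∙∙ x            ≈⟨ ·-congˡ x (ℤ.neg-distribˡ-* (+ suc m) j) ⟨
    (ℤ.- (+ suc m ℤ.* j)) ∙∙ x       ≈⟨ neg-· (+ suc m ℤ.* j) x ⟩
    ((+ suc m ℤ.* j) ∙∙ x) ⁻¹        ≈⟨ ⁻¹-cong (+*-· (suc m) j x) ⟩
    (suc m ×ₙ (j ∙∙ x)) ⁻¹           ∎

  lin : Vector ℤ n → Vector Carrier n → Carrier
  lin z v = sum (λ i → z i ∙∙ v i)

  lin-cong : {z w : Vector ℤ n} → (∀ i → z i ≡ w i) → ∀ v → lin z v ≈ lin w v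
  lin-cong p v = sum-cong-≋ (λ i → ·-congˡ (v i) (p i))

  lin-+ : ∀ (z w : Vector ℤ n) v → lin (λ i → z i ℤ.+ w i) v ≈ lin z v ∙ lin w v
  lin-+ z w v = trans (sum-cong-≋ (λ i → +-· (z i) (w i) (v i)))
    (∑-distrib-+ (λ i → z i ∙∙ v i) (λ i → w i ∙∙ v i))

  lin-0 : ∀ (v : Vector Carrier n) → lin (λ _ → 0ℤ) v ≈ ε
  lin-0 {n} v = sum-replicate-zero n

  lin-* : ∀ k (z : Vector ℤ n) v → lin (λ i → k ℤ.* z i) v ≈ k ∙∙ lin z v
  lin-* {zero}  k z v = sym (·-ε k)
  lin-* {suc n} k z v = begin
    (k ℤ.* z zero) ∙∙ v zero ∙ lin (λ i → k ℤ.* z (suc i)) (v ∘ suc)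
      ≈⟨ ∙-cong (*-· k (z zero) (v zero)) (lin-* k (z ∘ suc) (v ∘ suc)) ⟩
    k ∙∙ (z zero ∙∙ v zero) ∙ k ∙∙ lin (z ∘ suc) (v ∘ suc)
      ≈⟨ ·-∙ k _ _ ⟨
    k ∙∙ lin z v ∎

  lin-neg : ∀ (z : Vector ℤ n) v → lin (λ i → ℤ.- z i) v ≈ lin z v ⁻¹
  lin-neg z v = begin
    lin (λ i → ℤ.- z i) v           ≈⟨ lin-cong (λ i → ≡.sym (ℤ.-1*i≡-i (z i))) v ⟩
    lin (λ i → ℤ.-1ℤ ℤ.* z i) v     ≈⟨ lin-* ℤ.-1ℤ z v ⟩
    ℤ.-1ℤ ∙∙ lin z v                ≈⟨ ⁻¹-cong (identityʳ _) ⟩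
    lin z v ⁻¹                      ∎

  δ : Fin n → Vector ℤ n
  δ zero    zero    = 1ℤ
  δ zero    (suc j) = 0ℤ
  δ (suc i) zero    = 0ℤ
  δ (suc i) (suc j) = δ i j

  lin-δ : ∀ (v : Vector Carrier n) i → lin (δ i) v ≈ v i
  lin-δ v zero    = trans (∙-cong (1-· (v zero)) (lin-0 (v ∘ suc))) (identityʳ _)
  lin-δ v (suc i) = trans (identityˡ _) (lin-δ (v ∘ suc) i)

  Spanned : Vector Carrier n → Pred Carrier ℓ
  Spanned v x = ∃[ z ] x ≈ lin z v

  lin-gen : ∀ (v : Vector Carrier n) i → Spanned v (v i)
  lin-gen v i = δ i , sym (lin-δ v i)

  spanned-isSubgroup : (v : Vector Carrier n) → IsSubgroup Γ (Spanned v)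
  spanned-isSubgroup v = record
    { H-resp = λ { x≈y (z , p) → z , trans (sym x≈y) p }
    ; H-ε    = (λ _ → 0ℤ) , sym (lin-0 v)
    ; H-∙    = λ { (z , p) (w , q) → (λ i → z i ℤ.+ w i) , trans (∙-cong p q) (sym (lin-+ z w v)) }
    ; H-⁻¹   = λ { (z , p) → (λ i → ℤ.- z i) , trans (⁻¹-cong p) (sym (lin-neg z v)) }
    }

  module _ {p} {H : Pred Carrier p} (isSubgroup : IsSubgroup Γ H) where
    open IsSubgroup isSubgroup

    H-× : ∀ k {x} → H x → H (k ×ₙ x)
    H-× zero    h = H-ε
    H-× (suc k) h = H-∙ h (H-× k h)

    H-· : ∀ i {x} → H x → H (i ∙∙ x)
    H-· (+ k)    h = H-× k h
    H-· -[1+ k ] h = H-⁻¹ (H-× (suc k) h)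

    H-sum : (v : Vector Carrier n) → (∀ i → H (v i)) → H (sum v)
    H-sum {zero}  v h = H-ε
    H-sum {suc n} v h = H-∙ (h zero) (H-sum (v ∘ suc) (h ∘ suc))

    H-lin : ∀ (z : Vector ℤ n) v → (∀ i → H (v i)) → H (lin z v)
    H-lin z v h = H-sum _ (λ i → H-· (z i) (h i))

    generated⊆ : ∀ {I : Set} {v : I → Carrier} → (∀ i → H (v i)) → ∀ {x} → Generated Γ v x → H x
    generated⊆ h (gen i)    = h i
    generated⊆ h unit       = H-ε
    generated⊆ h (mul g g′) = H-∙ (generated⊆ h g) (generated⊆ h g′)
    generated⊆ h (inv g)    = H-⁻¹ (generated⊆ h g)
    generated⊆ h (resp e g) = H-resp e (generated⊆ h g)

    -- The subgroup H + ℤa. Keeping the coefficient `j` as data allows a case distinction on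
    -- `j ≡ 0ℤ`, although membership in `H` is not decidable.
    Adjoin : Carrier → Pred Carrier p
    Adjoin a x = ∃[ j ] H (x ∙ (j ∙∙ a) ⁻¹)

    Adjoin-isSubgroup : ∀ a → IsSubgroup Γ (Adjoin a)
    Adjoin-isSubgroup a = record
      { H-resp = λ { x≈y (j , h) → j , H-resp (∙-congʳ x≈y) h }
      ; H-ε    = 0ℤ , H-resp (sym (trans (identityˡ _) ε⁻¹≈ε)) H-ε
      ; H-∙    = λ { (i , h) (j , h′) → i ℤ.+ j , H-resp
                   (trans (interchange _ _ _ _) (∙-congˡ (trans (⁻¹-∙-comm _ _) (⁻¹-cong (sym (+-· i j a))))))
                   (H-∙ h h′) }
      ; H-⁻¹   = λ { (j , h) → ℤ.- j , H-resp (trans (sym (⁻¹-∙-comm _ _)) (∙-congˡ (⁻¹-cong (sym (neg-· j a))))) (H-⁻¹ h) }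
      }

    ⊆Adjoin : ∀ {a x} → H x → Adjoin a x
    ⊆Adjoin h = 0ℤ , H-resp (sym (trans (∙-congˡ ε⁻¹≈ε) (identityʳ _))) h

    ∈Adjoin : ∀ a → Adjoin a a
    ∈Adjoin a = 1ℤ , H-resp (sym (trans (∙-congˡ (⁻¹-cong (1-· a))) (inverseʳ a))) H-ε

    -- The preimage in Γ of the torsion subgroup of Γ/H. Phrased inside Γ, it can be compared for
    -- different `H`.
    Saturation : Pred Carrier p
    Saturation x = ∃[ k ] NonZero k × H (k ×ₙ x)

    Saturation-isSubgroup : IsSubgroup Γ Saturation
    Saturation-isSubgroup = record
      { H-resp = λ { x≈y (k , k≢0 , h) → k , k≢0 , H-resp (×-congʳ k x≈y) h }
      ; H-ε    = 1 , _ , H-resp (sym (×-ε 1)) H-ε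
      ; H-∙    = λ { {x} {y} (k , k≢0 , h) (l , l≢0 , h′) → k * l , ℕ.m*n≢0 k l {{k≢0}} {{l≢0}} ,
                   H-resp (sym (×-distrib-+ x y (k * l))) (H-∙
                     (H-resp (trans (×-assocˡ x l k) (reflexive (≡.cong (_×ₙ x) (ℕ.*-comm l k)))) (H-× l h))
                     (H-resp (×-assocˡ y k l) (H-× k h′))) }
      ; H-⁻¹   = λ { {x} (k , k≢0 , h) → k , k≢0 , H-resp (sym (×-⁻¹ k x)) (H-⁻¹ h) }
      }

    ⊆Saturation : ∀ {x} → H x → Saturation x
    ⊆Saturation {x} h = 1 , _ , H-resp (sym (identityʳ x)) h

  generated-isSubgroup : ∀ {I : Set} (v : I → Carrier) → IsSubgroup Γ (Generated Γ v)
  generated-isSubgroup v = record { H-resp = resp ; H-ε = unit ; H-∙ = mul ; H-⁻¹ = inv }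

  generated⇒spanned : ∀ (v : Vector Carrier n) {x} → Generated Γ v x → Spanned v x
  generated⇒spanned v = generated⊆ (spanned-isSubgroup v) (lin-gen v)

-- Rank bounds under adjunction and saturation

module Rank {c ℓ} (Γ : AbelianGroup c ℓ) where
  open AbelianGroup Γ
  open Combinations Γ
  open SetoidReasoning setoid

  private
    variable
      n : ℕ

  -- Only the upper half of `IsRank`: it can be carried through an adjunction without deciding
  -- whether the rank really grows.
  RankBound : ∀ {p} → Pred Carrier p → ℕ → Set _
  RankBound H r = ∀ {k} (w : Vector Carrier k) → (∀ i → H (w i)) → LinearlyIndependent Γ w → k ℕ.≤ r

  lin-multiples : ∀ (z j : Vector ℤ n) x → ∃[ k ] lin z (λ i → j i ∙∙ x) ≈ k ∙∙ x
  lin-multiples {zero}  z j x = 0ℤ , refl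
  lin-multiples {suc n} z j x with k , p ← lin-multiples (z ∘ suc) (j ∘ suc) x =
    z zero ℤ.* j zero ℤ.+ k ,
    trans (∙-cong (sym (*-· (z zero) (j zero) x)) p) (sym (+-· (z zero ℤ.* j zero) k x))

  lin-∙⁻¹ : ∀ (z : Vector ℤ n) u v → lin z (λ i → u i ∙ v i ⁻¹) ≈ lin z u ∙ lin z v ⁻¹
  lin-∙⁻¹ z u v = begin
    lin z (λ i → u i ∙ v i ⁻¹)
      ≈⟨ sum-cong-≋ (λ i → ·-∙ (z i) (u i) (v i ⁻¹)) ⟩
    sum (λ i → z i ∙∙ u i ∙ z i ∙∙ (v i ⁻¹))
      ≈⟨ ∑-distrib-+ (λ i → z i ∙∙ u i) (λ i → z i ∙∙ (v i ⁻¹)) ⟩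
    lin z u ∙ lin z (λ i → v i ⁻¹)
      ≈⟨ ∙-congˡ (sum-cong-≋ (λ i → trans (·-⁻¹ (z i) (v i)) (sym (neg-· (z i) (v i))))) ⟩
    lin z u ∙ lin (λ i → ℤ.- z i) v
      ≈⟨ ∙-congˡ (lin-neg z v) ⟩
    lin z u ∙ lin z v ⁻¹ ∎

  module Pivot {k} (w : Vector Carrier (suc k)) (j : Vector ℤ (suc k)) (p : Fin (suc k)) (jp≢0 : j p ≢ 0ℤ) where
    -- Fraction-free Gaussian elimination: if w i ≡ j i · a modulo H for all i, then j p · w q - j q
    -- · w p lies in H, because the two multiples of a cancel.
    pivoted : Vector Carrier k
    pivoted i = j p ∙∙ w (punchIn p i) ∙ (j (punchIn p i) ∙∙ w p) ⁻¹

    pivoted∈ : ∀ {q} {H : Pred Carrier q} → IsSubgroup Γ H → ∀ {a} →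
               (∀ i → H (w i ∙ (j i ∙∙ a) ⁻¹)) → ∀ i → H (pivoted i)
    pivoted∈ isSubgroup {a} h i =
      H-resp eq (H-∙ (H-· isSubgroup (j p) (h q)) (H-⁻¹ (H-· isSubgroup (j q) (h p))))
      where
      open IsSubgroup isSubgroup
      q = punchIn p i
      expand : ∀ s t → j s ∙∙ (w t ∙ (j t ∙∙ a) ⁻¹) ≈ j s ∙∙ w t ∙ ((j s ℤ.* j t) ∙∙ a) ⁻¹
      expand s t = trans (·-∙ (j s) _ _)
        (∙-congˡ (trans (·-⁻¹ (j s) _) (⁻¹-cong (sym (*-· (j s) (j t) a)))))
      b = (j p ℤ.* j q) ∙∙ a
      eq : j p ∙∙ (w q ∙ (j q ∙∙ a) ⁻¹) ∙ (j q ∙∙ (w p ∙ (j p ∙∙ a) ⁻¹)) ⁻¹ ≈ pivoted i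
      eq = begin
        j p ∙∙ (w q ∙ (j q ∙∙ a) ⁻¹) ∙ (j q ∙∙ (w p ∙ (j p ∙∙ a) ⁻¹)) ⁻¹
          ≈⟨ ∙-cong (expand p q) (⁻¹-cong (trans (expand q p) (∙-congˡ (⁻¹-cong (·-congˡ a (ℤ.*-comm (j q) (j p))))))) ⟩
        (j p ∙∙ w q ∙ b ⁻¹) ∙ (j q ∙∙ w p ∙ b ⁻¹) ⁻¹
          ≈⟨ ∙-congˡ (⁻¹-∙-comm _ _) ⟨
        (j p ∙∙ w q ∙ b ⁻¹) ∙ ((j q ∙∙ w p) ⁻¹ ∙ b ⁻¹ ⁻¹)
          ≈⟨ interchange _ _ _ _ ⟩
        pivoted i ∙ (b ⁻¹ ∙ b ⁻¹ ⁻¹)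
          ≈⟨ trans (∙-congˡ (inverseʳ _)) (identityʳ _) ⟩
        pivoted i ∎

    -- A relation z among the eliminated vectors is a relation among the `w i` whose coefficients
    -- off the pivot are z i · j p. These vanish, and ℤ has no zero divisors.
    pivoted-independent : LinearlyIndependent Γ w → LinearlyIndependent Γ pivoted
    pivoted-independent ind z z≈ε i =
      [ (λ zi≡0 → zi≡0) , (λ jp≡0 → ⊥-elim (jp≢0 jp≡0)) ]′ (ℤ.i*j≡0⇒i≡0∨j≡0 (z i) zijp≡0)
      where
      m = proj₁ (lin-multiples z (j ∘ punchIn p) (w p))
      -- The pivot entry -m undoes the multiples of `w p` that the elimination subtracted.
      y = insertAt (λ i → z i ℤ.* j p) p (ℤ.- m)
      y≈ε : lin y w ≈ ε
      y≈ε = begin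
        lin y w
          ≈⟨ sum-remove {i = p} (λ i → y i ∙∙ w i) ⟩
        y p ∙∙ w p ∙ lin (y ∘ punchIn p) (w ∘ punchIn p)
          ≈⟨ ∙-cong (·-congˡ (w p) (insertAt-lookup (λ i → z i ℤ.* j p) p (ℤ.- m)))
                    (lin-cong (insertAt-punchIn (λ i → z i ℤ.* j p) p (ℤ.- m)) (w ∘ punchIn p)) ⟩
        (ℤ.- m) ∙∙ w p ∙ lin (λ i → z i ℤ.* j p) (w ∘ punchIn p)
          ≈⟨ comm _ _ ⟩
        lin (λ i → z i ℤ.* j p) (w ∘ punchIn p) ∙ (ℤ.- m) ∙∙ w p
          ≈⟨ ∙-cong (sum-cong-≋ (λ i → *-· (z i) (j p) (w (punchIn p i))))
                    (trans (neg-· m (w p)) (⁻¹-cong (sym (proj₂ (lin-multiples z (j ∘ punchIn p) (w p)))))) ⟩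
        lin z (λ i → j p ∙∙ w (punchIn p i)) ∙ lin z (λ i → j (punchIn p i) ∙∙ w p) ⁻¹
          ≈⟨ lin-∙⁻¹ z _ _ ⟨
        lin z pivoted
          ≈⟨ z≈ε ⟩
        ε ∎
      zijp≡0 : z i ℤ.* j p ≡ 0ℤ
      zijp≡0 = ≡.trans (≡.sym (insertAt-punchIn (λ i → z i ℤ.* j p) p (ℤ.- m) i)) (ind y y≈ε (punchIn p i))

  module _ {q} {H : Pred Carrier q} (isSubgroup : IsSubgroup Γ H) where
    open IsSubgroup isSubgroup

    -- Either some coefficient of a is nonzero, and pivoting on it leaves k independent vectors in
    -- H, or all of the vectors lie in H already.
    rankBound-Adjoin : ∀ {r} → RankBound H r → ∀ a → RankBound (Adjoin isSubgroup a) (suc r)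
    rankBound-Adjoin bound a {zero}  w h ind = ℕ.z≤n
    rankBound-Adjoin bound a {suc k} w h ind with Fin.any? (λ i → ¬? (proj₁ (h i) ℤ.≟ 0ℤ))
    ... | yes (p , jp≢0) = ℕ.s≤s (bound pivoted (pivoted∈ isSubgroup (λ i → proj₂ (h i))) (pivoted-independent ind))
      where open Pivot w (λ i → proj₁ (h i)) p jp≢0
    ... | no ∄p = ℕ.m≤n⇒m≤1+n (bound w w∈H ind)
      where
      w∈H : ∀ i → H (w i)
      w∈H i = H-resp (trans (∙-congˡ (trans (⁻¹-cong (·-congˡ a ji≡0)) ε⁻¹≈ε)) (identityʳ _)) (proj₂ (h i))
        where ji≡0 = decidable-stable (proj₁ (h i) ℤ.≟ 0ℤ) (λ ji≢0 → ∄p (i , ji≢0))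

    -- Multiplying each vector by its own nonzero integer moves it into H and preserves
    -- independence.
    rankBound-Saturation : ∀ {r} → RankBound H r → RankBound (Saturation isSubgroup) r
    rankBound-Saturation bound w h ind = bound (λ i → proj₁ (h i) ×ₙ w i) (λ i → proj₂ (proj₂ (h i))) ind′
      where
      ind′ : LinearlyIndependent Γ (λ i → proj₁ (h i) ×ₙ w i)
      ind′ z z≈ε i = [ (λ zi≡0 → zi≡0) , (λ k≡0 → ⊥-elim (ℕ.≢-nonZero⁻¹ _ {{proj₁ (proj₂ (h i))}} (ℤ.+-injective k≡0))) ]′
        (ℤ.i*j≡0⇒i≡0∨j≡0 (z i) (ind (λ i → z i ℤ.* + proj₁ (h i))
          (trans (sum-cong-≋ (λ i → *-· (z i) (+ proj₁ (h i)) (w i))) z≈ε) i))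

  rankBound-span : ∀ {s q r} {H : Pred Carrier q} (isSubgroup : IsSubgroup Γ H) → RankBound H r →
                   (v : Vector Carrier s) → RankBound (λ x → ∃[ z ] H (x ∙ lin z v ⁻¹)) (r + s)
  rankBound-span {zero}  {r = r} isSubgroup bound v {k} w h ind =
    ≡.subst (k ℕ.≤_) (≡.sym (ℕ.+-identityʳ r))
      (bound w (λ i → H-resp (trans (∙-congˡ ε⁻¹≈ε) (identityʳ _)) (proj₂ (h i))) ind)
    where open IsSubgroup isSubgroup
  rankBound-span {suc s} {r = r} isSubgroup bound v {k} w h ind =
    ≡.subst (k ℕ.≤_) (≡.sym (ℕ.+-suc r s))
      (rankBound-span (Adjoin-isSubgroup isSubgroup (v zero)) (rankBound-Adjoin isSubgroup bound (v zero))
        (v ∘ suc) w (λ i → proj₁ (h i) ∘ suc , proj₁ (h i) zero , H-resp eq (proj₂ (h i))) ind)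
    where
    open IsSubgroup isSubgroup
    eq : ∀ {x y u} → x ∙ (y ∙ u) ⁻¹ ≈ (x ∙ u ⁻¹) ∙ y ⁻¹
    eq {x} {y} {u} = trans (∙-congˡ (trans (sym (⁻¹-∙-comm y u)) (comm _ _))) (sym (assoc x _ _))

  lin-++ : ∀ {r s} (z : Vector ℤ (r + s)) (u : Vector Carrier r) (v : Vector Carrier s) →
           lin z (u ++ v) ≈ lin (z ∘ (_↑ˡ s)) u ∙ lin (z ∘ (r ↑ʳ_)) v
  lin-++ {zero}  z u v = sym (identityˡ _)
  lin-++ {suc r} {s} z u v = begin
    z zero ∙∙ u zero ∙ lin (z ∘ suc) ((u ++ v) ∘ suc)
      ≈⟨ ∙-congˡ (sum-cong-≋ (λ i → ·-cong (z (suc i)) (reflexive (++-suc i)))) ⟩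
    z zero ∙∙ u zero ∙ lin (z ∘ suc) ((u ∘ suc) ++ v)
      ≈⟨ ∙-congˡ (lin-++ (z ∘ suc) (u ∘ suc) v) ⟩
    z zero ∙∙ u zero ∙ (lin (z ∘ suc ∘ (_↑ˡ s)) (u ∘ suc) ∙ lin (z ∘ suc ∘ (r ↑ʳ_)) v)
      ≈⟨ assoc _ _ _ ⟨
    lin (z ∘ (_↑ˡ s)) u ∙ lin (z ∘ (suc r ↑ʳ_)) v ∎
    where
    ++-suc : ∀ i → (u ++ v) (suc i) ≡ ((u ∘ suc) ++ v) i
    ++-suc i with splitAt r i
    ... | inj₁ _ = ≡.refl
    ... | inj₂ _ = ≡.refl

  Everything : Pred Carrier _
  Everything x = x ≈ x

  -- Additivity of rank along H → Γ → Γ/H, with `v` a lifted basis of the free part of Γ/H. A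
  -- relation on `u ++ v` puts its v-part into H, so that part vanishes, and then so does the
  -- u-part. The upper bound holds because the saturation of H and the span of v together give all
  -- of Γ.
  rank-additive : ∀ {s q r} {H : Pred Carrier q} (isSubgroup : IsSubgroup Γ H) → IsRank Γ H r →
                  (v : Vector Carrier s) → (∀ z → H (lin z v) → ∀ i → z i ≡ 0ℤ) →
                  (∀ x → ∃[ z ] Saturation isSubgroup (x ∙ lin z v ⁻¹)) →
                  IsRank Γ Everything (r + s)
  rank-additive {s} {r = r} isSubgroup ((u , u∈H , u-ind) , bound) v v-ind spanning =
    ((u ++ v) , (λ _ → refl) , ind) ,
    λ w _ w-ind → rankBound-span (Saturation-isSubgroup isSubgroup) (rankBound-Saturation isSubgroup bound) v w
      (λ i → spanning (w i)) w-ind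
    where
    open IsSubgroup isSubgroup
    module _ (z : Vector ℤ (r + s)) (z≈ε : lin z (u ++ v) ≈ ε) where
      zu = lin (z ∘ (_↑ˡ s)) u
      zv = lin (z ∘ (r ↑ʳ_)) v
      zu∙zv≈ε : zu ∙ zv ≈ ε
      zu∙zv≈ε = trans (sym (lin-++ z u v)) z≈ε
      z-right≡0 : ∀ i → z (r ↑ʳ i) ≡ 0ℤ
      z-right≡0 = v-ind (z ∘ (r ↑ʳ_)) (H-resp (sym (Algebra.Properties.AbelianGroup.inverseʳ-unique Γ _ _ zu∙zv≈ε)) (H-⁻¹ (H-lin isSubgroup (z ∘ (_↑ˡ s)) u u∈H)))
      z-left≡0 : ∀ i → z (i ↑ˡ s) ≡ 0ℤ
      z-left≡0 = u-ind (z ∘ (_↑ˡ s)) (trans (sym (trans (∙-congˡ (trans (lin-cong z-right≡0 v) (lin-0 v))) (identityʳ _))) zu∙zv≈ε)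
    ind : LinearlyIndependent Γ (u ++ v)
    ind z z≈ε i with splitAt r i in eq
    ... | inj₁ i′ = ≡.trans (≡.cong z (≡.sym (Fin.splitAt⁻¹-↑ˡ eq))) (z-left≡0 z z≈ε i′)
    ... | inj₂ i′ = ≡.trans (≡.cong z (≡.sym (Fin.splitAt⁻¹-↑ʳ eq))) (z-right≡0 z z≈ε i′)

  rank-mono : ∀ {p q} {H : Pred Carrier p} {K : Pred Carrier q} → (∀ {x} → H x → K x) →
              ∀ {r s} → IsRank Γ H r → IsRank Γ K s → r ℕ.≤ s
  rank-mono H⊆K ((u , u∈H , u-ind) , _) (_ , bound) = bound u (λ i → H⊆K (u∈H i)) u-ind

-- Splitting off the free part of a finitely generated group

record Bézout (a b : ℤ) : Set where
  constructor bézout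
  field
    {g a′ b′ s t} : ℤ
    a≡ : a ≡ g ℤ.* a′
    b≡ : b ≡ g ℤ.* b′
    -- The cofactors themselves are coprime. Unlike s a + t b = g, this keeps its content when g =
    -- 0, and the rows (a′, b′) and (-t, s) always have determinant 1.
    bézout-eq : s ℤ.* a′ ℤ.+ t ℤ.* b′ ≡ 1ℤ

module _ where
  open ≡.≡-Reasoning

  bézout-step : ∀ {a b} q r → a ≡ r ℤ.+ q ℤ.* b → Bézout b r → Bézout a b
  bézout-step {a} {b} q r a≡ (bézout {g = g} {a′ = b′} {b′ = r′} {s = s} {t = t} b≡ r≡ eq) = bézout
    {g = g} {a′ = r′ ℤ.+ q ℤ.* b′} {b′ = b′} {s = t} {t = s ℤ.- t ℤ.* q}
    (begin
      a                                      ≡⟨ a≡ ⟩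
      r ℤ.+ q ℤ.* b                          ≡⟨ ≡.cong₂ (λ x y → x ℤ.+ q ℤ.* y) r≡ b≡ ⟩
      g ℤ.* r′ ℤ.+ q ℤ.* (g ℤ.* b′)          ≡⟨ identity₁ g r′ q b′ ⟩
      g ℤ.* (r′ ℤ.+ q ℤ.* b′)                ∎)
    b≡
    (≡.trans (identity₂ s t q r′ b′) eq)
    where
    identity₁ : ∀ g r q b → g ℤ.* r ℤ.+ q ℤ.* (g ℤ.* b) ≡ g ℤ.* (r ℤ.+ q ℤ.* b)
    identity₁ = ℤ.solve-∀
    identity₂ : ∀ s t q r b → t ℤ.* (r ℤ.+ q ℤ.* b) ℤ.+ (s ℤ.- t ℤ.* q) ℤ.* b ≡ s ℤ.* b ℤ.+ t ℤ.* r
    identity₂ = ℤ.solve-∀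

  bézout-identity : ∀ a b → Bézout a b
  bézout-identity a b = <-rec (λ n → ∀ a b → ℤ.∣ b ∣ ≡ n → Bézout a b) step ℤ.∣ b ∣ a b ≡.refl
    where
    step : ∀ n → (∀ {m} → m ℕ.< n → ∀ a b → ℤ.∣ b ∣ ≡ m → Bézout a b) → ∀ a b → ℤ.∣ b ∣ ≡ n → Bézout a b
    step n rec a b |b|≡n with b ℤ.≟ 0ℤ
    ... | yes ≡.refl = bézout {g = a} {a′ = 1ℤ} {b′ = 0ℤ} {s = 1ℤ} {t = 0ℤ} (≡.sym (ℤ.*-identityʳ a)) (≡.sym (ℤ.*-zeroʳ a)) ≡.refl
    ... | no b≢0 = bézout-step (a ℤ./ b) (+ (a ℤ.% b)) (ℤ.a≡a%n+[a/n]*n a b)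
                     (rec (≡.subst (a ℤ.% b ℕ.<_) |b|≡n (ℤ.n%d<d a b)) b (+ (a ℤ.% b)) ≡.refl)
      where instance _ = ℤ.≢-nonZero b≢0

module Splitting {c ℓ} (Δ : AbelianGroup c ℓ) where
  open AbelianGroup Δ
  open Combinations Δ
  open SetoidReasoning setoid

  private
    variable
      n : ℕ

  combine₂ : ∀ p q a b c d x y →
    p ∙∙ (a ∙∙ x ∙ b ∙∙ y) ∙ q ∙∙ (c ∙∙ x ∙ d ∙∙ y) ≈ (p ℤ.* a ℤ.+ q ℤ.* c) ∙∙ x ∙ (p ℤ.* b ℤ.+ q ℤ.* d) ∙∙ y
  combine₂ p q a b c d x y = begin
    p ∙∙ (a ∙∙ x ∙ b ∙∙ y) ∙ q ∙∙ (c ∙∙ x ∙ d ∙∙ y)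
      ≈⟨ ∙-cong (distribute p a b) (distribute q c d) ⟩
    ((p ℤ.* a) ∙∙ x ∙ (p ℤ.* b) ∙∙ y) ∙ ((q ℤ.* c) ∙∙ x ∙ (q ℤ.* d) ∙∙ y)
      ≈⟨ interchange _ _ _ _ ⟩
    ((p ℤ.* a) ∙∙ x ∙ (q ℤ.* c) ∙∙ x) ∙ ((p ℤ.* b) ∙∙ y ∙ (q ℤ.* d) ∙∙ y)
      ≈⟨ ∙-cong (+-· (p ℤ.* a) (q ℤ.* c) x) (+-· (p ℤ.* b) (q ℤ.* d) y) ⟨
    (p ℤ.* a ℤ.+ q ℤ.* c) ∙∙ x ∙ (p ℤ.* b ℤ.+ q ℤ.* d) ∙∙ y ∎
    where
    distribute : ∀ p a b → p ∙∙ (a ∙∙ x ∙ b ∙∙ y) ≈ (p ℤ.* a) ∙∙ x ∙ (p ℤ.* b) ∙∙ y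
    distribute p a b = trans (·-∙ p _ _) (sym (∙-cong (*-· p a x) (*-· p b y)))

  -- A change of generators turning lin z v into a multiple of the first generator.
  record Reduction {n} (v : Vector Carrier (suc n)) (z : Vector ℤ (suc n)) : Set (c ⊔ ℓ) where
    field
      v′      : Vector Carrier (suc n)
      g       : ℤ
      value   : lin z v ≈ g ∙∙ v′ zero
      spanned : ∀ i → Spanned v′ (v i)
      nonzero : g ≡ 0ℤ → ∀ i → z i ≡ 0ℤ

  spanned-trans : ∀ {m n} {v : Vector Carrier m} (w : Vector Carrier n) →
                  (∀ i → Spanned w (v i)) → ∀ {x} → Spanned v x → Spanned w x
  spanned-trans {v = v} w h (z , p) =
    IsSubgroup.H-resp (spanned-isSubgroup w) (sym p) (H-lin (spanned-isSubgroup w) z v h)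

  -- By induction the tail of the combination becomes a multiple of one generator; Bézout then
  -- merges that coefficient with `z zero`.
  reduction : ∀ {n} (v : Vector Carrier (suc n)) z → Reduction v z
  reduction {zero} v z = record
    { v′ = v ; g = z zero ; value = identityʳ _ ; spanned = lin-gen v
    ; nonzero = λ { z≡0 zero → z≡0 } }
  reduction {suc n} v z = record
    { v′      = new
    ; g       = g
    ; value   = begin
        z zero ∙∙ v zero ∙ lin (z ∘ suc) (v ∘ suc)
          ≈⟨ ∙-cong (·-congˡ (v zero) a≡) (trans T.value (·-congˡ w₀ b≡)) ⟩
        (g ℤ.* a′) ∙∙ v zero ∙ (g ℤ.* b′) ∙∙ w₀
          ≈⟨ ∙-cong (*-· g a′ _) (*-· g b′ _) ⟩
        g ∙∙ (a′ ∙∙ v zero) ∙ g ∙∙ (b′ ∙∙ w₀)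
          ≈⟨ ·-∙ g _ _ ⟨
        g ∙∙ new zero ∎
    ; spanned = λ { zero → v₀∈ ; (suc i) → spanned-trans new w∈ (T.spanned i) }
    ; nonzero = λ { g≡0 zero    → ≡.trans a≡ (≡.cong (ℤ._* a′) g≡0)
                  ; g≡0 (suc i) → T.nonzero (≡.trans b≡ (≡.cong (ℤ._* b′) g≡0)) i }
    }
    where
    module T = Reduction (reduction (v ∘ suc) (z ∘ suc))
    open Bézout (bézout-identity (z zero) T.g)
    w₀ = T.v′ zero
    new : Vector Carrier (suc (suc n))
    -- The pair (v₀, w₀) is changed by the determinant-one matrix with rows (a′, b′) and (-t, s).
    -- The inverse has rows (s, -b′) and (t, a′), which are the coefficients in `v₀∈` and `w∈`.
    new zero          = a′ ∙∙ v zero ∙ b′ ∙∙ w₀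
    new (suc zero)    = (ℤ.- t) ∙∙ v zero ∙ s ∙∙ w₀
    new (suc (suc i)) = T.v′ (suc i)
    span₂ : ∀ p q {x} → p ∙∙ new zero ∙ q ∙∙ new (suc zero) ≈ x → Spanned new x
    span₂ p q eq = H-resp eq (H-∙ (H-· (spanned-isSubgroup new) p (lin-gen new zero))
                                  (H-· (spanned-isSubgroup new) q (lin-gen new (suc zero))))
      where open IsSubgroup (spanned-isSubgroup new)
    v₀∈ : Spanned new (v zero)
    v₀∈ = span₂ s (ℤ.- b′) (begin
      s ∙∙ new zero ∙ (ℤ.- b′) ∙∙ new (suc zero)
        ≈⟨ combine₂ s (ℤ.- b′) a′ b′ (ℤ.- t) s (v zero) w₀ ⟩
      (s ℤ.* a′ ℤ.+ (ℤ.- b′) ℤ.* (ℤ.- t)) ∙∙ v zero ∙ (s ℤ.* b′ ℤ.+ (ℤ.- b′) ℤ.* s) ∙∙ w₀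
        ≈⟨ ∙-cong (·-congˡ (v zero) (≡.trans (e₁ s a′ b′ t) bézout-eq)) (·-congˡ w₀ (e₂ s b′)) ⟩
      1ℤ ∙∙ v zero ∙ ε
        ≈⟨ trans (identityʳ _) (1-· _) ⟩
      v zero ∎)
      where
      e₁ : ∀ s a b t → s ℤ.* a ℤ.+ (ℤ.- b) ℤ.* (ℤ.- t) ≡ s ℤ.* a ℤ.+ t ℤ.* b
      e₁ = ℤ.solve-∀
      e₂ : ∀ s b → s ℤ.* b ℤ.+ (ℤ.- b) ℤ.* s ≡ 0ℤ
      e₂ = ℤ.solve-∀
    w∈ : ∀ i → Spanned new (T.v′ i)
    w∈ (suc i) = lin-gen new (suc (suc i))
    w∈ zero    = span₂ t a′ (begin
      t ∙∙ new zero ∙ a′ ∙∙ new (suc zero)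
        ≈⟨ combine₂ t a′ a′ b′ (ℤ.- t) s (v zero) w₀ ⟩
      (t ℤ.* a′ ℤ.+ a′ ℤ.* (ℤ.- t)) ∙∙ v zero ∙ (t ℤ.* b′ ℤ.+ a′ ℤ.* s) ∙∙ w₀
        ≈⟨ ∙-cong (·-congˡ (v zero) (e₁ a′ t)) (·-congˡ w₀ (≡.trans (e₂ s a′ b′ t) bézout-eq)) ⟩
      ε ∙ 1ℤ ∙∙ w₀
        ≈⟨ trans (identityˡ _) (1-· _) ⟩
      w₀ ∎)
      where
      e₁ : ∀ a t → t ℤ.* a ℤ.+ a ℤ.* (ℤ.- t) ≡ 0ℤ
      e₁ = ℤ.solve-∀
      e₂ : ∀ s a b t → t ℤ.* b ℤ.+ a ℤ.* s ≡ s ℤ.* a ℤ.+ t ℤ.* b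
      e₂ = ℤ.solve-∀

  -- One `k` serves all x; it ends up annihilating the whole torsion subgroup.
  SpansModulo : ℕ → Vector Carrier n → Set _
  SpansModulo k v = ∀ x → ∃[ z ] k ×ₙ (x ∙ lin z v ⁻¹) ≈ ε

  -- A basis of the free part; k annihilates the torsion part.
  record Split : Set (c ⊔ ℓ) where
    field
      {s k}       : ℕ
      v           : Vector Carrier s
      independent : LinearlyIndependent Δ v
      k≢0         : NonZero k
      spanning    : SpansModulo k v

  ∣·∣-annihilates : ∀ i {x} → i ∙∙ x ≈ ε → ℤ.∣ i ∣ ×ₙ x ≈ ε
  ∣·∣-annihilates (+ m)    p = p
  ∣·∣-annihilates -[1+ m ] p = trans (sym (⁻¹-involutive _)) (trans (⁻¹-cong p) ε⁻¹≈ε)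

  ×-kills : ∀ k l {x} → l ×ₙ x ≈ ε → (k * l) ×ₙ x ≈ ε
  ×-kills k l {x} p = trans (sym (×-assocˡ x k l)) (trans (×-congʳ k p) (×-ε k))

  -- After the change of generators the relation reads g · v′₀ = 0 with g ≠ 0. So v′₀ is torsion and
  -- may be dropped, provided that k is multiplied by ∣g∣.
  drop-generator : ∀ {n k} (v : Vector Carrier (suc n)) z → ¬ (∀ i → z i ≡ 0ℤ) → lin z v ≈ ε → NonZero k → SpansModulo k v →
                   ∃[ k′ ] NonZero k′ × Σ (Vector Carrier n) (SpansModulo k′)
  drop-generator {k = k} v z z≢0 z≈ε k≢0 spans = ℤ.∣ R.g ∣ * k , ℕ.m*n≢0 ℤ.∣ R.g ∣ k {{∣g∣≢0}} {{k≢0}} , R.v′ ∘ suc , spans′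
    where
    module R = Reduction (reduction v z)
    ∣g∣≢0 : NonZero ℤ.∣ R.g ∣
    ∣g∣≢0 = ℕ.≢-nonZero (λ ∣g∣≡0 → z≢0 (R.nonzero (ℤ.∣i∣≡0⇒i≡0 ∣g∣≡0)))
    spans′ : SpansModulo (ℤ.∣ R.g ∣ * k) (R.v′ ∘ suc)
    spans′ x with z , p ← spans x with y , q ← spanned-trans {v = v} R.v′ R.spanned (z , refl) = y ∘ suc , (begin
      gk ×ₙ (x ∙ L ⁻¹)
        ≈⟨ ×-congʳ gk eq ⟩
      gk ×ₙ ((x ∙ lin z v ⁻¹) ∙ y zero ∙∙ R.v′ zero)
        ≈⟨ ×-distrib-+ _ _ gk ⟩
      gk ×ₙ (x ∙ lin z v ⁻¹) ∙ gk ×ₙ (y zero ∙∙ R.v′ zero)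
        ≈⟨ ∙-cong (×-kills ℤ.∣ R.g ∣ k p)
             (trans (reflexive (≡.cong (_×ₙ (y zero ∙∙ R.v′ zero)) (ℕ.*-comm ℤ.∣ R.g ∣ k))) (×-kills k ℤ.∣ R.g ∣ killed)) ⟩
      ε ∙ ε
        ≈⟨ identityʳ ε ⟩
      ε ∎)
      where
      gk = ℤ.∣ R.g ∣ * k
      L = lin (y ∘ suc) (R.v′ ∘ suc)
      eq : x ∙ L ⁻¹ ≈ (x ∙ lin z v ⁻¹) ∙ y zero ∙∙ R.v′ zero
      eq = begin
        x ∙ L ⁻¹
          ≈⟨ ∙-congˡ (identityʳ _) ⟨
        x ∙ (L ⁻¹ ∙ ε)
          ≈⟨ ∙-congˡ (∙-congˡ (inverseˡ _)) ⟨
        x ∙ (L ⁻¹ ∙ ((y zero ∙∙ R.v′ zero) ⁻¹ ∙ y zero ∙∙ R.v′ zero))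
          ≈⟨ ∙-congˡ (assoc _ _ _) ⟨
        x ∙ ((L ⁻¹ ∙ (y zero ∙∙ R.v′ zero) ⁻¹) ∙ y zero ∙∙ R.v′ zero)
          ≈⟨ assoc _ _ _ ⟨
        (x ∙ (L ⁻¹ ∙ (y zero ∙∙ R.v′ zero) ⁻¹)) ∙ y zero ∙∙ R.v′ zero
          ≈⟨ ∙-congʳ (∙-congˡ (trans (comm _ _) (trans (⁻¹-∙-comm _ _) (⁻¹-cong (sym q))))) ⟩
        (x ∙ lin z v ⁻¹) ∙ y zero ∙∙ R.v′ zero ∎
      killed : ℤ.∣ R.g ∣ ×ₙ (y zero ∙∙ R.v′ zero) ≈ ε
      killed = begin
        (+ ℤ.∣ R.g ∣) ∙∙ (y zero ∙∙ R.v′ zero)   ≈⟨ *-· (+ ℤ.∣ R.g ∣) (y zero) _ ⟨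
        (+ ℤ.∣ R.g ∣ ℤ.* y zero) ∙∙ R.v′ zero    ≈⟨ ·-congˡ _ (ℤ.*-comm (+ ℤ.∣ R.g ∣) (y zero)) ⟩
        (y zero ℤ.* + ℤ.∣ R.g ∣) ∙∙ R.v′ zero    ≈⟨ *-· (y zero) (+ ℤ.∣ R.g ∣) _ ⟩
        y zero ∙∙ (ℤ.∣ R.g ∣ ×ₙ R.v′ zero)       ≈⟨ ·-cong (y zero) (∣·∣-annihilates R.g (trans (sym R.value) z≈ε)) ⟩
        y zero ∙∙ ε                              ≈⟨ ·-ε (y zero) ⟩
        ε                                        ∎

  -- Independence of the generators is not decidable, hence the excluded middle under a double
  -- negation. Each nontrivial relation removes one generator, so the process ends.
  ¬¬-split : ∀ n {k} (v : Vector Carrier n) → NonZero k → SpansModulo k v → ¬ ¬ Split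
  ¬¬-split n {k} v k≢0 spans ¬split = ¬¬-excluded-middle
    {A = ∃[ z ] lin z v ≈ ε × ¬ (∀ i → z i ≡ 0ℤ)} λ
    { (no indep) → ¬split (record
        { v = v ; k≢0 = k≢0 ; spanning = spans
        ; independent = λ z z≈ε i → decidable-stable (z i ℤ.≟ 0ℤ)
            (λ zi≢0 → indep (z , z≈ε , λ z≡0 → zi≢0 (z≡0 i))) })
    ; (yes (z , z≈ε , z≢0)) → shrink n v spans z z≈ε z≢0 }
    where
    shrink : ∀ n (v : Vector Carrier n) → SpansModulo k v → ∀ z → lin z v ≈ ε → ¬ ¬ (∀ i → z i ≡ 0ℤ)
    shrink zero    v spans z z≈ε z≢0 = z≢0 (λ ())
    shrink (suc n) v spans z z≈ε z≢0 with k′ , k′≢0 , v′ , spans′ ← drop-generator v z z≢0 z≈ε k≢0 spans =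
      ¬¬-split n v′ k′≢0 spans′ ¬split

  finitelyGenerated⇒¬¬split : IsFinitelyGenerated Δ → ¬ ¬ Split
  finitelyGenerated⇒¬¬split (n , g , generates) = ¬¬-split n {1} g _ λ x →
    let z , p = generated⇒spanned g (generates x) in z , trans (identityʳ _) (x≈y⇒x∙y⁻¹≈ε p)

-- Cardinalities of setoids

module _ {a₁ ℓ₁ a₂ ℓ₂} {X : Setoid a₁ ℓ₁} {Y : Setoid a₂ ℓ₂} where
  private
    module X = Setoid X
    module Y = Setoid Y

  mkInverse : (to : X.Carrier → Y.Carrier) (from : Y.Carrier → X.Carrier) →
              (∀ {x y} → x X.≈ y → to x Y.≈ to y) → (∀ {x y} → x Y.≈ y → from x X.≈ from y) →
              (∀ y → to (from y) Y.≈ y) → (∀ x → from (to x) X.≈ x) → Inverse X Y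
  mkInverse to from to-cong from-cong invˡ invʳ = record
    { to = to ; from = from ; to-cong = to-cong ; from-cong = from-cong
    ; inverse = (λ {x} p → Y.trans (to-cong p) (invˡ x)) , (λ {x} p → X.trans (from-cong p) (invʳ x)) }

module _ {a₁ ℓ₁ a₂ ℓ₂} {X : Setoid a₁ ℓ₁} {Y : Setoid a₂ ℓ₂} where
  private
    module X = Setoid X
    module Y = Setoid Y

  cardinality-transport : ∀ {k} → Inverse X Y → HasCardinality Y k → HasCardinality X k
  cardinality-transport f c = mkInverse (c.to ∘ f.to) (f.from ∘ c.from) (c.to-cong ∘ f.to-cong) (f.from-cong ∘ c.from-cong)
    (λ y → ≡.trans (c.to-cong (f.strictlyInverseˡ (c.from y))) (c.strictlyInverseˡ y))
    (λ x → X.trans (f.from-cong (c.strictlyInverseʳ (f.to x))) (f.strictlyInverseʳ x))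
    where
    module f = Inverse f
    module c = Inverse c

  cardinality-× : ∀ {m n} → HasCardinality X m → HasCardinality Y n → HasCardinality (×-setoid X Y) (m * n)
  cardinality-× {m} {n} c d = mkInverse
    (λ (x , y) → combine (c.to x) (d.to y))
    (λ i → c.from (proj₁ (remQuot {m} n i)) , d.from (proj₂ (remQuot {m} n i)))
    (λ (p , q) → ≡.cong₂ combine (c.to-cong p) (d.to-cong q))
    (λ { ≡.refl → X.refl , Y.refl })
    (λ i → ≡.trans (≡.cong₂ combine (c.strictlyInverseˡ _) (d.strictlyInverseˡ _)) (Fin.combine-remQuot {m} n i))
    (λ (x , y) → X.trans (c.from-cong (≡.cong proj₁ (Fin.remQuot-combine (c.to x) (d.to y)))) (c.strictlyInverseʳ x)
               , Y.trans (d.from-cong (≡.cong proj₂ (Fin.remQuot-combine (c.to x) (d.to y)))) (d.strictlyInverseʳ y))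
    where
    module c = Inverse c
    module d = Inverse d

funToFin-cong : ∀ {m n} {f g : Fin m → Fin n} → (∀ i → f i ≡ g i) → funToFin f ≡ funToFin g
funToFin-cong {zero}  p = ≡.refl
funToFin-cong {suc m} p = ≡.cong₂ combine (p zero) (funToFin-cong (p ∘ suc))

module _ {a ℓ} {X : Setoid a ℓ} where
  cardinality-^ : ∀ {n} s → HasCardinality X n → HasCardinality (≋-setoid X s) (n ^ s)
  cardinality-^ {n} s c = mkInverse
    (λ f → funToFin (c.to ∘ f)) (λ i → c.from ∘ finToFun {n} {s} i)
    (λ p → funToFin-cong (c.to-cong ∘ p)) (λ { ≡.refl _ → X.refl })
    (λ i → ≡.trans (funToFin-cong {s} (λ j → c.strictlyInverseˡ (finToFun i j))) (Fin.funToFin-finToFin {s} i))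
    (λ f j → X.trans (c.from-cong (Fin.finToFun-funToFin (c.to ∘ f) j)) (c.strictlyInverseʳ (f j)))
    where
    module X = Setoid X
    module c = Inverse c

-- Homomorphisms, and the order of Hom(Δ, G[d])

module Homomorphisms {c₁ ℓ₁ c₂ ℓ₂} (H : AbelianGroup c₁ ℓ₁) (G : AbelianGroup c₂ ℓ₂) where
  private
    module H = AbelianGroup H
    module G = AbelianGroup G
    module CH = Combinations H
    module CG = Combinations G
  open GroupHomomorphism
  open SetoidReasoning G.setoid

  mkHom : (f : H.Carrier → G.Carrier) → (∀ {x y} → x H.≈ y → f x G.≈ f y) →
          (∀ x y → f (x H.∙ y) G.≈ f x G.∙ f y) → GroupHomomorphism H.rawGroup G.rawGroup
  mkHom f f-cong f-homo = record
    { ⟦_⟧ = f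
    ; isGroupHomomorphism = record
      { isMonoidHomomorphism = record
        { isMagmaHomomorphism = record { isRelHomomorphism = record { cong = f-cong } ; homo = f-homo }
        ; ε-homo = f-ε
        }
      ; ⁻¹-homo = λ x → inverseʳ-unique _ _ (G.trans (G.sym (f-homo x (x H.⁻¹))) (G.trans (f-cong (H.inverseʳ x)) f-ε))
      }
    }
    where
    open Algebra.Properties.AbelianGroup G using (identityʳ-unique; inverseʳ-unique)
    f-ε : f H.ε G.≈ G.ε
    f-ε = identityʳ-unique _ _ (G.trans (G.sym (f-homo H.ε H.ε)) (f-cong (H.identityʳ H.ε)))

  module _ (φ : GroupHomomorphism H.rawGroup G.rawGroup) where
    hom-× : ∀ k x → ⟦ φ ⟧ (k CH.×ₙ x) G.≈ k CG.×ₙ ⟦ φ ⟧ x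
    hom-× zero    x = ε-homo φ
    hom-× (suc k) x = G.trans (homo φ _ _) (G.∙-congˡ (hom-× k x))

    hom-· : ∀ i x → ⟦ φ ⟧ (i CH.∙∙ x) G.≈ i CG.∙∙ ⟦ φ ⟧ x
    hom-· (+ k)    x = hom-× k x
    hom-· -[1+ k ] x = G.trans (⁻¹-homo φ _) (G.⁻¹-cong (hom-× (suc k) x))

    hom-lin : ∀ {n} (z : Vector ℤ n) v → ⟦ φ ⟧ (CH.lin z v) G.≈ CG.lin z (⟦ φ ⟧ ∘ v)
    hom-lin {zero}  z v = ε-homo φ
    hom-lin {suc n} z v = G.trans (homo φ _ _) (G.∙-cong (hom-· (z zero) (v zero)) (hom-lin (z ∘ suc) (v ∘ suc)))

    hom-∙⁻¹ : ∀ x y → ⟦ φ ⟧ (x H.∙ y H.⁻¹) G.≈ ⟦ φ ⟧ x G.∙ ⟦ φ ⟧ y G.⁻¹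
    hom-∙⁻¹ x y = G.trans (homo φ _ _) (G.∙-congˡ (⁻¹-homo φ y))

-- A group structure on `G [ d ]` with literally the same carrier and equality, so that a
-- cardinality of that setoid is also the order of this group.
torsionSubgroup : ∀ {c ℓ} → AbelianGroup c ℓ → ℕ → AbelianGroup (c ⊔ ℓ) ℓ
torsionSubgroup G d = record
  { Carrier = ∃[ x ] d ×ₙ x ≈ ε
  ; _≈_ = λ x y → proj₁ x ≈ proj₁ y
  ; _∙_ = λ (x , p) (y , q) → x ∙ y , trans (×-distrib-+ x y d) (trans (∙-cong p q) (identityʳ ε))
  ; ε = ε , ×-ε d
  ; _⁻¹ = λ (x , p) → x ⁻¹ , trans (×-⁻¹ d x) (trans (⁻¹-cong p) ε⁻¹≈ε)
  ; isAbelianGroup = record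
    { isGroup = record
      { isMonoid = record
        { isSemigroup = record
          { isMagma = record
            { isEquivalence = record { refl = refl ; sym = sym ; trans = trans }
            ; ∙-cong = ∙-cong
            }
          ; assoc = λ x y z → assoc (proj₁ x) (proj₁ y) (proj₁ z)
          }
        ; identity = (λ x → identityˡ (proj₁ x)) , (λ x → identityʳ (proj₁ x))
        }
      ; inverse = (λ x → inverseˡ (proj₁ x)) , (λ x → inverseʳ (proj₁ x))
      ; ⁻¹-cong = ⁻¹-cong
      }
    ; comm = λ x y → comm (proj₁ x) (proj₁ y)
    }
  }
  where
  open AbelianGroup G
  open Combinations G

-- Since Δ ≅ Δₜₒᵣ ⊕ ℤˢ and d kills Δₜₒᵣ, a homomorphism Δ → G[d] amounts to
-- a homomorphism Δₜₒᵣ → G and s elements of G[d].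
module _ {c₁ ℓ₁ c₂ ℓ₂} (Δ : AbelianGroup c₁ ℓ₁) (G : AbelianGroup c₂ ℓ₂) where
  module SplitHom (split : Splitting.Split Δ) (d : ℕ) (k∣d : Splitting.Split.k split ∣ d) where
    open Splitting Δ
    open Split split
    private
      module Δ = AbelianGroup Δ
      module G = AbelianGroup G
      module CΔ = Combinations Δ
      module CG = Combinations G

      Gd = torsionSubgroup G d
      module Gd = AbelianGroup Gd
      module CGd = Combinations Gd
      module HT = Homomorphisms (torsion Δ) G
      module HGd = Homomorphisms Δ Gd
    open GroupHomomorphism

    private
      -- Torsion is the saturation of the zero subgroup, which supplies its closure properties.
      trivial : IsSubgroup Δ (Δ._≈ Δ.ε)
      trivial = record
        { H-resp = λ p q → Δ.trans (Δ.sym p) q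
        ; H-ε = Δ.refl
        ; H-∙ = λ p q → Δ.trans (Δ.∙-cong p q) (Δ.identityʳ _)
        ; H-⁻¹ = λ p → Δ.trans (Δ.⁻¹-cong p) CΔ.ε⁻¹≈ε
        }
      open IsSubgroup (CΔ.Saturation-isSubgroup trivial)

    torsion-lin : ∀ z → IsTorsion Δ (CΔ.lin z v) → ∀ i → z i ≡ 0ℤ
    torsion-lin z (l , l≢0 , p) i = [ (λ l≡0 → ⊥-elim (ℕ.≢-nonZero⁻¹ l {{l≢0}} (ℤ.+-injective l≡0))) , (λ zi≡0 → zi≡0) ]′
      (ℤ.i*j≡0⇒i≡0∨j≡0 (+ l) (independent (λ i → + l ℤ.* z i) (Δ.trans (CΔ.lin-* (+ l) z v) p) i))

    -- Two expansions of equal elements differ by a torsion combination of the basis, which must be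
    -- zero. Congruence and additivity of `coordinates`, and its values on torsion and on the basis,
    -- are all instances.
    coordinates-unique : ∀ {x y} z w → x Δ.≈ y → IsTorsion Δ (x Δ.∙ CΔ.lin z v Δ.⁻¹) → IsTorsion Δ (y Δ.∙ CΔ.lin w v Δ.⁻¹) →
                         ∀ i → w i ≡ z i
    coordinates-unique {x} {y} z w x≈y tz tw i = ℤ.i-j≡0⇒i≡j (w i) (z i)
      (torsion-lin (λ i → w i ℤ.- z i) (H-resp eq (H-∙ tz (H-⁻¹ tw))) i)
      where
      open SetoidReasoning Δ.setoid
      Z = CΔ.lin z v
      W = CΔ.lin w v
      eq : (x Δ.∙ Z Δ.⁻¹) Δ.∙ (y Δ.∙ W Δ.⁻¹) Δ.⁻¹ Δ.≈ CΔ.lin (λ i → w i ℤ.- z i) v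
      eq = begin
        (x Δ.∙ Z Δ.⁻¹) Δ.∙ (y Δ.∙ W Δ.⁻¹) Δ.⁻¹
          ≈⟨ Δ.∙-congˡ (CΔ.⁻¹-∙-comm _ _) ⟨
        (x Δ.∙ Z Δ.⁻¹) Δ.∙ (y Δ.⁻¹ Δ.∙ W Δ.⁻¹ Δ.⁻¹)
          ≈⟨ CΔ.interchange _ _ _ _ ⟩
        (x Δ.∙ y Δ.⁻¹) Δ.∙ (Z Δ.⁻¹ Δ.∙ W Δ.⁻¹ Δ.⁻¹)
          ≈⟨ Δ.∙-cong (CΔ.x≈y⇒x∙y⁻¹≈ε x≈y) (Δ.∙-congˡ (CΔ.⁻¹-involutive W)) ⟩
        Δ.ε Δ.∙ (Z Δ.⁻¹ Δ.∙ W)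
          ≈⟨ Δ.trans (Δ.identityˡ _) (Δ.comm _ _) ⟩
        W Δ.∙ Z Δ.⁻¹
          ≈⟨ Δ.∙-congˡ (CΔ.lin-neg z v) ⟨
        W Δ.∙ CΔ.lin (λ i → ℤ.- z i) v
          ≈⟨ CΔ.lin-+ w (λ i → ℤ.- z i) v ⟨
        CΔ.lin (λ i → w i ℤ.- z i) v ∎

    coordinates : Δ.Carrier → Vector ℤ s
    coordinates x = proj₁ (spanning x)

    torsionPart : Δ.Carrier → ∃ (IsTorsion Δ)
    torsionPart x = x Δ.∙ CΔ.lin (coordinates x) v Δ.⁻¹ , k , k≢0 , proj₂ (spanning x)

    coordinates-cong : ∀ {x y} → x Δ.≈ y → ∀ i → coordinates x i ≡ coordinates y i
    coordinates-cong {x} {y} x≈y = coordinates-unique (coordinates y) (coordinates x) (Δ.sym x≈y)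
      (proj₂ (torsionPart y)) (proj₂ (torsionPart x))

    torsionPart-cong : ∀ {x y} → x Δ.≈ y → proj₁ (torsionPart x) Δ.≈ proj₁ (torsionPart y)
    torsionPart-cong x≈y = Δ.∙-cong x≈y (Δ.⁻¹-cong (CΔ.lin-cong (coordinates-cong x≈y) v))

    private
      ∙-lin : ∀ x y → (x Δ.∙ CΔ.lin (coordinates x) v Δ.⁻¹) Δ.∙ (y Δ.∙ CΔ.lin (coordinates y) v Δ.⁻¹)
              Δ.≈ (x Δ.∙ y) Δ.∙ CΔ.lin (λ i → coordinates x i ℤ.+ coordinates y i) v Δ.⁻¹
      ∙-lin x y = Δ.trans (CΔ.interchange _ _ _ _) (Δ.∙-congˡ (Δ.trans (CΔ.⁻¹-∙-comm _ _)
        (Δ.⁻¹-cong (Δ.sym (CΔ.lin-+ (coordinates x) (coordinates y) v)))))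

    coordinates-homo : ∀ x y i → coordinates (x Δ.∙ y) i ≡ coordinates x i ℤ.+ coordinates y i
    coordinates-homo x y = coordinates-unique (λ i → coordinates x i ℤ.+ coordinates y i) (coordinates (x Δ.∙ y)) Δ.refl
      (H-resp (∙-lin x y) (H-∙ (proj₂ (torsionPart x)) (proj₂ (torsionPart y)))) (proj₂ (torsionPart (x Δ.∙ y)))

    torsionPart-homo : ∀ x y → proj₁ (torsionPart (x Δ.∙ y)) Δ.≈ proj₁ (torsionPart x) Δ.∙ proj₁ (torsionPart y)
    torsionPart-homo x y = Δ.trans (Δ.∙-congˡ (Δ.⁻¹-cong (CΔ.lin-cong (coordinates-homo x y) v))) (Δ.sym (∙-lin x y))

    coordinates-torsion : ∀ {x} → IsTorsion Δ x → ∀ i → coordinates x i ≡ 0ℤ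
    coordinates-torsion {x} t = coordinates-unique (λ _ → 0ℤ) (coordinates x) Δ.refl
      (H-resp (Δ.sym (Δ.trans (Δ.∙-congˡ (Δ.trans (Δ.⁻¹-cong (CΔ.lin-0 v)) CΔ.ε⁻¹≈ε)) (Δ.identityʳ x))) t) (proj₂ (torsionPart x))

    torsionPart-torsion : ∀ {x} → IsTorsion Δ x → proj₁ (torsionPart x) Δ.≈ x
    torsionPart-torsion {x} t = Δ.trans (Δ.∙-congˡ (Δ.trans (Δ.⁻¹-cong
      (Δ.trans (CΔ.lin-cong (coordinates-torsion t) v) (CΔ.lin-0 v))) CΔ.ε⁻¹≈ε)) (Δ.identityʳ x)

    private
      vᵢ-residue : ∀ i → v i Δ.∙ CΔ.lin (CΔ.δ i) v Δ.⁻¹ Δ.≈ Δ.ε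
      vᵢ-residue i = CΔ.x≈y⇒x∙y⁻¹≈ε (Δ.sym (CΔ.lin-δ v i))

    coordinates-basis : ∀ i j → coordinates (v i) j ≡ CΔ.δ i j
    coordinates-basis i = coordinates-unique (CΔ.δ i) (coordinates (v i)) Δ.refl
      (H-resp (Δ.sym (vᵢ-residue i)) H-ε) (proj₂ (torsionPart (v i)))

    torsionPart-basis : ∀ i → proj₁ (torsionPart (v i)) Δ.≈ Δ.ε
    torsionPart-basis i = Δ.trans (Δ.∙-congˡ (Δ.⁻¹-cong (CΔ.lin-cong (coordinates-basis i) v))) (vᵢ-residue i)

    -- A torsion element equals its torsion part, which k kills.
    torsion-killed : ∀ {x} → IsTorsion Δ x → d CΔ.×ₙ x Δ.≈ Δ.ε
    torsion-killed {x} t = Δ.trans (Δ.reflexive (≡.cong (CΔ._×ₙ x) (_∣_.equality k∣d)))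
      (×-kills (_∣_.quotient k∣d) k (Δ.trans (CΔ.×-congʳ k (Δ.sym (torsionPart-torsion t))) (proj₂ (spanning x))))

    Hₜ = GroupHomomorphism (AbelianGroup.rawGroup (torsion Δ)) G.rawGroup
    Hd = GroupHomomorphism Δ.rawGroup Gd.rawGroup

    torsion-value : Hₜ → ∃ (IsTorsion Δ) → Gd.Carrier
    torsion-value ψ t = ⟦ ψ ⟧ t , G.trans (G.sym (HT.hom-× ψ d t)) (G.trans (⟦⟧-cong ψ (Δ.trans (×-torsion d t) (torsion-killed (proj₂ t)))) (ε-homo ψ))
      where
      ×-torsion : ∀ n t → proj₁ (Combinations._×ₙ_ (torsion Δ) n t) Δ.≈ n CΔ.×ₙ proj₁ t
      ×-torsion zero    t = Δ.refl
      ×-torsion (suc n) t = Δ.∙-congˡ (×-torsion n t)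

    restrict : Hd → Hₜ
    restrict φ = HT.mkHom (λ t → proj₁ (⟦ φ ⟧ (proj₁ t))) (⟦⟧-cong φ) (λ s t → homo φ (proj₁ s) (proj₁ t))

    extend : Hₜ → Vector Gd.Carrier s → Hd
    extend ψ w = HGd.mkHom
      (λ x → torsion-value ψ (torsionPart x) Gd.∙ CGd.lin (coordinates x) w)
      (λ {x} {y} x≈y → Gd.∙-cong {torsion-value ψ (torsionPart x)} {torsion-value ψ (torsionPart y)}
        {CGd.lin (coordinates x) w} {CGd.lin (coordinates y) w}
        (⟦⟧-cong ψ (torsionPart-cong x≈y)) (CGd.lin-cong (coordinates-cong x≈y) w))
      (λ x y → let
          a = torsion-value ψ (torsionPart x)
          b = torsion-value ψ (torsionPart y)
          c = CGd.lin (coordinates x) w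
          e = CGd.lin (coordinates y) w
        in Gd.trans {torsion-value ψ (torsionPart (x Δ.∙ y)) Gd.∙ CGd.lin (coordinates (x Δ.∙ y)) w} {(a Gd.∙ b) Gd.∙ (c Gd.∙ e)} {(a Gd.∙ c) Gd.∙ (b Gd.∙ e)}
          (Gd.∙-cong {torsion-value ψ (torsionPart (x Δ.∙ y))} {a Gd.∙ b} {CGd.lin (coordinates (x Δ.∙ y)) w} {c Gd.∙ e}
            (G.trans (⟦⟧-cong ψ (torsionPart-homo x y)) (homo ψ (torsionPart x) (torsionPart y)))
            (Gd.trans {CGd.lin (coordinates (x Δ.∙ y)) w} {CGd.lin (λ i → coordinates x i ℤ.+ coordinates y i) w} {c Gd.∙ e}
              (CGd.lin-cong (coordinates-homo x y) w) (CGd.lin-+ (coordinates x) (coordinates y) w)))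
          (CGd.interchange a b c e))

    extend-torsion : ∀ ψ w t → proj₁ (⟦ extend ψ w ⟧ (proj₁ t)) G.≈ ⟦ ψ ⟧ t
    extend-torsion ψ w (x , t) = G.trans (G.∙-cong (⟦⟧-cong ψ (torsionPart-torsion t))
      (Gd.trans {CGd.lin (coordinates x) w} {CGd.lin (λ _ → 0ℤ) w} {Gd.ε} (CGd.lin-cong (coordinates-torsion t) w) (CGd.lin-0 w))) (G.identityʳ _)

    extend-basis : ∀ ψ w i → proj₁ (⟦ extend ψ w ⟧ (v i)) G.≈ proj₁ (w i)
    extend-basis ψ w i = G.trans (G.∙-cong (G.trans (⟦⟧-cong ψ {torsionPart (v i)} {AbelianGroup.ε (torsion Δ)} (torsionPart-basis i)) (ε-homo ψ))
      (Gd.trans {CGd.lin (coordinates (v i)) w} {CGd.lin (CΔ.δ i) w} {w i} (CGd.lin-cong (coordinates-basis i) w) (CGd.lin-δ w i))) (G.identityˡ _)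

    extend-restrict : ∀ φ x → proj₁ (⟦ extend (restrict φ) (⟦ φ ⟧ ∘ v) ⟧ x) G.≈ proj₁ (⟦ φ ⟧ x)
    extend-restrict φ x = begin
      proj₁ (⟦ φ ⟧ (x Δ.∙ L Δ.⁻¹)) G.∙ proj₁ (CGd.lin (coordinates x) (⟦ φ ⟧ ∘ v))
        ≈⟨ G.∙-cong G.refl (HGd.hom-lin φ (coordinates x) v) ⟨
      proj₁ (⟦ φ ⟧ (x Δ.∙ L Δ.⁻¹)) G.∙ proj₁ (⟦ φ ⟧ L)
        ≈⟨ homo φ _ _ ⟨
      proj₁ (⟦ φ ⟧ ((x Δ.∙ L Δ.⁻¹) Δ.∙ L))
        ≈⟨ ⟦⟧-cong φ (Algebra.Properties.AbelianGroup.//-rightDividesˡ Δ L x) ⟩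
      proj₁ (⟦ φ ⟧ x) ∎
      where
      open SetoidReasoning G.setoid
      L = CΔ.lin (coordinates x) v

    Hom-cardinality : ∀ {m N} → HasCardinality (Hom (torsion Δ) G) m → HasCardinality (G [ d ]) N →
                      HasCardinality (Hom Δ Gd) (m * N ^ s)
    Hom-cardinality cm cN = cardinality-transport
      {X = Hom Δ Gd} {Y = ×-setoid (Hom (torsion Δ) G) (≋-setoid (G [ d ]) s)}
      (mkInverse (λ φ → restrict φ , ⟦ φ ⟧ ∘ v) (uncurry extend)
        (λ p → (λ t → p (proj₁ t)) , (λ i → p (v i)))
        (λ { {ψ , w} {ψ′ , w′} (p , q) x → G.∙-cong (p (torsionPart x))
             (CGd.sum-cong-≋ {x = λ i → coordinates x i CGd.∙∙ w i} {y = λ i → coordinates x i CGd.∙∙ w′ i} (λ i → CGd.·-cong (coordinates x i) {w i} {w′ i} (q i))) })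
        (λ { (ψ , w) → extend-torsion ψ w , extend-basis ψ w })
        extend-restrict)
      (cardinality-× cm (cardinality-^ s cN))

-- Counting by indicators and fibres

private
  variable
    a p q : Level
    k l n : ℕ

module _ {a ℓ} (M : CommutativeMonoid a ℓ) where
  private module M = CommutativeMonoid M
  open Algebra.Properties.CommutativeMonoid.Sum M using (sum; sum-permute; sum-cong-≋)

  -- The bijection becomes a permutation of indices. When `X` and `Y` coincide, this is the
  -- invariance of a finite sum under a bijection of its range.
  sum-reindex : ∀ {a₁ ℓ₁ a₂ ℓ₂} {X : Setoid a₁ ℓ₁} {Y : Setoid a₂ ℓ₂} →
    (c : HasCardinality X k) (d : HasCardinality Y l) (σ : Inverse X Y)
    (F : Setoid.Carrier Y → M.Carrier) → (∀ {x y} → Setoid._≈_ Y x y → F x M.≈ F y) →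
    sum (F ∘ Inverse.from d) M.≈ sum (F ∘ Inverse.to σ ∘ Inverse.from c)
  sum-reindex {X = X} {Y} c d σ F F-cong = M.trans (sum-permute (F ∘ d.from) π)
    (sum-cong-≋ (λ i → F-cong (d.strictlyInverseʳ (σ.to (c.from i)))))
    where
    module c = Inverse c
    module d = Inverse d
    module σ = Inverse σ
    π = permutation (d.to ∘ σ.to ∘ c.from) (c.to ∘ σ.from ∘ d.from)
      (λ j → ≡.trans (d.to-cong (Setoid.trans Y (σ.to-cong (c.strictlyInverseʳ _)) (σ.strictlyInverseˡ _))) (d.strictlyInverseˡ j))
      (λ i → ≡.trans (c.to-cong (Setoid.trans X (σ.from-cong (d.strictlyInverseʳ _)) (σ.strictlyInverseʳ _))) (c.strictlyInverseˡ i))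

open Algebra.Properties.Semiring.Sum ℕ.+-*-semiring
  using (sum; sum-cong-≗; sum-replicate-zero; ∑-comm; *-distribˡ-sum; ∑-distrib-+)

indicator : {P : Set p} → Dec P → ℕ
indicator (yes _) = 1
indicator (no _)  = 0

count : {Q : Fin k → Set q} → (∀ i → Dec (Q i)) → ℕ
count Q? = sum (λ i → indicator (Q? i))

indicator-yes : {P : Set p} (P? : Dec P) → P → indicator P? ≡ 1
indicator-yes (yes _) _  = ≡.refl
indicator-yes (no ¬p) p  = contradiction p ¬p

indicator-no : {P : Set p} (P? : Dec P) → ¬ P → indicator P? ≡ 0
indicator-no (yes p) ¬p = contradiction p ¬p
indicator-no (no _)  _  = ≡.refl

indicator-⇔ : {P : Set p} {Q : Set q} (P? : Dec P) (Q? : Dec Q) → (P → Q) → (Q → P) → indicator P? ≡ indicator Q?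
indicator-⇔ P? (yes q) P→Q Q→P = indicator-yes P? (Q→P q)
indicator-⇔ P? (no ¬q) P→Q Q→P = indicator-no P? (¬q ∘ P→Q)

count-⇔ : {P : Fin k → Set p} {Q : Fin k → Set q} (P? : ∀ i → Dec (P i)) (Q? : ∀ i → Dec (Q i)) →
          (∀ i → P i → Q i) → (∀ i → Q i → P i) → count P? ≡ count Q?
count-⇔ P? Q? P→Q Q→P = sum-cong-≗ (λ i → indicator-⇔ (P? i) (Q? i) (P→Q i) (Q→P i))

count-none : {Q : Fin k → Set q} (Q? : ∀ i → Dec (Q i)) → (∀ i → ¬ Q i) → count Q? ≡ 0
count-none {k = k} Q? ¬Q = ≡.trans (sum-cong-≗ (λ i → indicator-no (Q? i) (¬Q i))) (sum-replicate-zero k)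

count-unique : {Q : Fin k → Set q} (Q? : ∀ i → Dec (Q i)) (j : Fin k) → Q j → (∀ i → Q i → i ≡ j) → count Q? ≡ 1
count-unique Q? zero    Qj unique = ≡.cong₂ _+_ (indicator-yes (Q? zero) Qj)
  (count-none (Q? ∘ suc) (λ i Qi → Fin.0≢1+n (≡.sym (unique (suc i) Qi))))
count-unique Q? (suc j) Qj unique = ≡.cong₂ _+_ (indicator-no (Q? zero) (λ Q0 → Fin.0≢1+n (unique zero Q0)))
  (count-unique (Q? ∘ suc) j Qj (λ i Qi → Fin.suc-injective (unique (suc i) Qi)))

count-all : {Q : Fin k → Set q} (Q? : ∀ i → Dec (Q i)) → (∀ i → Q i) → count Q? ≡ k
count-all {zero}  Q? Q = ≡.refl
count-all {suc k} Q? Q = ≡.cong₂ _+_ (indicator-yes (Q? zero) (Q zero)) (count-all (Q? ∘ suc) (Q ∘ suc))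

fibre-size : (Fin l → Fin k) → Fin k → ℕ
fibre-size f i = count (λ j → f j Fin.≟ i)

-- Double counting of the pairs (i, j) with f j = i: each j contributes to exactly one i.
sum-fibre-size : (f : Fin l → Fin k) → sum (fibre-size f) ≡ l
sum-fibre-size {l} {k} f = begin
  sum (fibre-size f)
    ≡⟨ ∑-comm {k} {l} (λ i j → indicator (f j Fin.≟ i)) ⟩
  sum (λ j → count (λ i → f j Fin.≟ i))
    ≡⟨ sum-cong-≗ (λ j → count-unique (λ i → f j Fin.≟ i) (f j) ≡.refl (λ i → ≡.sym)) ⟩
  sum {l} (λ j → 1)
    ≡⟨ count-all {k = l} (λ j → yes ≡.refl) (λ j → ≡.refl {x = j}) ⟩
  l ∎
  where open ≡.≡-Reasoning

count-injection : {Q : Fin k → Set q} (Q? : ∀ i → Dec (Q i)) (f : Fin l → Fin k) → Injective _≡_ _≡_ f →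
                  (∀ j → Q (f j)) → (∀ i → Q i → ∃[ j ] f j ≡ i) → l ≡ count Q?
count-injection {Q = Q} Q? f f-injective Qf preimage =
  ≡.trans (≡.sym (sum-fibre-size f)) (sum-cong-≗ (λ i → size i (Q? i)))
  where
  size : ∀ i (Qi? : Dec (Q i)) → fibre-size f i ≡ indicator Qi?
  size i (yes Qi) with j , ≡.refl ← preimage i Qi =
    count-unique (λ j′ → f j′ Fin.≟ i) j ≡.refl (λ j′ → f-injective)
  size i (no ¬Qi) = count-none (λ j → f j Fin.≟ i) (λ { j ≡.refl → ¬Qi (Qf j) })

-- Fibres outside `Q` are empty. Lagrange's theorem and the counts along exact sequences are
-- instances.
constant-fibres : {Q : Fin k → Set q} (Q? : ∀ i → Dec (Q i)) (f : Fin l → Fin k) (c : ℕ) →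
                  (∀ j → Q (f j)) → (∀ i → Q i → fibre-size f i ≡ c) → l ≡ c * count Q?
constant-fibres {Q = Q} Q? f c Qf fibre = ≡.trans (≡.sym (sum-fibre-size f))
  (≡.trans (sum-cong-≗ (λ i → size i (Q? i))) (≡.sym (*-distribˡ-sum c (λ i → indicator (Q? i)))))
  where
  size : ∀ i (Qi? : Dec (Q i)) → fibre-size f i ≡ c * indicator Qi?
  size i (yes Qi) = ≡.trans (fibre i Qi) (≡.sym (ℕ.*-identityʳ c))
  size i (no ¬Qi) = ≡.trans (count-none (λ j → f j Fin.≟ i) (λ { j ≡.refl → ¬Qi (Qf j) })) (≡.sym (ℕ.*-zeroʳ c))

from-injective : ∀ {a ℓ} {X : Setoid a ℓ} (c : HasCardinality X k) →
                 Injective _≡_ (Setoid._≈_ X) (Inverse.from c)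
from-injective c {i} {j} eq =
  ≡.trans (≡.sym (Inverse.strictlyInverseˡ c i)) (≡.trans (Inverse.to-cong c eq) (Inverse.strictlyInverseˡ c j))

module _ {a ℓ} {X : Setoid a ℓ} (c : HasCardinality X k) where
  private
    module X = Setoid X
    module c = Inverse c

  ≈-dec : ∀ x y → Dec (x X.≈ y)
  ≈-dec x y = map′ (λ eq → X.trans (X.sym (c.strictlyInverseʳ x)) (X.trans (c.from-cong eq) (c.strictlyInverseʳ y)))
    c.to-cong (c.to x Fin.≟ c.to y)

  ∃-dec : {Q : X.Carrier → Set q} → (∀ {x y} → x X.≈ y → Q x → Q y) → (∀ x → Dec (Q x)) → Dec (∃ Q)
  ∃-dec Q-resp Q? = map′ (λ (i , Qi) → c.from i , Qi)
    (λ (x , Qx) → c.to x , Q-resp (X.sym (c.strictlyInverseʳ x)) Qx) (Fin.any? (Q? ∘ c.from))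

  module _ {b ℓ′} {Y : Setoid b ℓ′} (d : HasCardinality Y l) where
    private
      module Y = Setoid Y
      module d = Inverse d

    subset-cardinality : (f : Y.Carrier → X.Carrier) → (∀ {y z} → y Y.≈ z → f y X.≈ f z) →
      (∀ {y z} → f y X.≈ f z → y Y.≈ z) → {Q : X.Carrier → Set q} (Q? : ∀ x → Dec (Q x)) →
      (∀ {x y} → x X.≈ y → Q x → Q y) → (∀ y → Q (f y)) → (∀ x → Q x → ∃[ y ] f y X.≈ x) →
      l ≡ count (Q? ∘ c.from)
    subset-cardinality f f-cong f-injective Q? Q-resp Qf preimage =
      count-injection (Q? ∘ c.from) (c.to ∘ f ∘ d.from)
      (λ {i} {j} eq → from-injective d (f-injective (X.trans (X.sym (c.strictlyInverseʳ _)) (X.trans (c.from-cong eq) (c.strictlyInverseʳ _)))))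
      (λ j → Q-resp (X.sym (c.strictlyInverseʳ _)) (Qf (d.from j)))
      (λ i Qi → let y , p = preimage (c.from i) Qi in d.to y ,
        ≡.trans (c.to-cong (X.trans (f-cong (d.strictlyInverseʳ y)) p)) (c.strictlyInverseˡ i))

module _ {a ℓ b ℓ′ e ℓ″} {X : Setoid a ℓ} {Y : Setoid b ℓ′} {K : Setoid e ℓ″} {m}
         (cX : HasCardinality X k) (cY : HasCardinality Y l) (cK : HasCardinality K m) where
  private
    module X = Setoid X
    module Y = Setoid Y
    module K = Setoid K
    module cX = Inverse cX
    module cY = Inverse cY

  -- A bijection from K onto the fibre over `x`. In the applications K is the kernel of a
  -- homomorphism and `param` translates it by one chosen point of the fibre.
  record Fibre (f : Y.Carrier → X.Carrier) (x : X.Carrier) : Set (ℓ ⊔ b ⊔ ℓ′ ⊔ e ⊔ ℓ″) where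
    field
      param     : K.Carrier → Y.Carrier
      cong      : ∀ {y z} → y K.≈ z → param y Y.≈ param z
      injective : ∀ {y z} → param y Y.≈ param z → y K.≈ z
      into      : ∀ y → f (param y) X.≈ x
      onto      : ∀ y → f y X.≈ x → ∃[ z ] param z Y.≈ y

  cardinality-by-fibres : (f : Y.Carrier → X.Carrier) → (∀ {y z} → y Y.≈ z → f y X.≈ f z) →
    {Q : X.Carrier → Set q} (Q? : ∀ x → Dec (Q x)) → (∀ {x y} → x X.≈ y → Q x → Q y) →
    (∀ y → Q (f y)) → (∀ x → Q x → Fibre f x) → l ≡ m * count (Q? ∘ cX.from)
  cardinality-by-fibres f f-cong Q? Q-resp Qf fibre =
    constant-fibres (Q? ∘ cX.from) (cX.to ∘ f ∘ cY.from) m (λ j → Q-resp (X.sym (cX.strictlyInverseʳ _)) (Qf (cY.from j))) size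
    where
    size : ∀ i → _ → fibre-size (cX.to ∘ f ∘ cY.from) i ≡ m
    size i Qi = ≡.sym (≡.trans
      (subset-cardinality cY cK F.param F.cong F.injective (λ y → ≈-dec cX (f y) (cX.from i))
        (λ y≈z p → X.trans (f-cong (Y.sym y≈z)) p) F.into F.onto)
      (count-⇔ (λ j → ≈-dec cX (f (cY.from j)) (cX.from i)) (λ j → cX.to (f (cY.from j)) Fin.≟ i)
        (λ j p → ≡.trans (cX.to-cong p) (cX.strictlyInverseˡ i))
        (λ { j ≡.refl → X.sym (cX.strictlyInverseʳ _) })))
      where module F = Fibre (fibre (cX.from i) Qi)

-- Coset representatives and Lagrange's theorem

-- The least element satisfying b, provided that b j holds; junk otherwise.
first : (Fin k → Bool) → Fin k → Fin k
first {suc k} b zero    = zero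
first {suc k} b (suc j) = if b zero then zero else suc (first (b ∘ suc) j)

first-true : (b : Fin k → Bool) (j : Fin k) → b j ≡ true → b (first b j) ≡ true
first-true b zero    bj = bj
first-true b (suc j) bj with b zero in eq
... | true  = eq
... | false = first-true (b ∘ suc) j bj

-- The starting index only guarantees that the search succeeds; the result depends on the predicate
-- alone. Hence all members of a coset receive the same representative.
first-cong : (b b′ : Fin k → Bool) (j j′ : Fin k) → b ≗ b′ → b j ≡ true → b′ j′ ≡ true → first b j ≡ first b′ j′
first-cong b b′ zero    zero     b≗b′ bj b′j′ = ≡.refl
first-cong b b′ zero    (suc j′) b≗b′ bj b′j′ rewrite ≡.trans (≡.sym (b≗b′ zero)) bj = ≡.refl
first-cong b b′ (suc j) zero     b≗b′ bj b′j′ rewrite ≡.trans (b≗b′ zero) b′j′ = ≡.refl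
first-cong b b′ (suc j) (suc j′) b≗b′ bj b′j′ rewrite b≗b′ zero with b′ zero
... | true  = ≡.refl
... | false = ≡.cong suc (first-cong (b ∘ suc) (b′ ∘ suc) j j′ (b≗b′ ∘ suc) bj b′j′)

module _ {c ℓ} (B : AbelianGroup c ℓ) (cB : HasCardinality (AbelianGroup.setoid B) k)
         {H : AbelianGroup.Carrier B → Set q} (isSubgroup : IsSubgroup B H) (H? : ∀ x → Dec (H x)) where
  open AbelianGroup B
  open Combinations B
  open IsSubgroup isSubgroup
  private module cB = Inverse cB

  private
    _~_ : Fin k → Fin k → Set q
    i ~ j = H (cB.from j ∙ cB.from i ⁻¹)

    ~-refl : ∀ {i} → i ~ i
    ~-refl = H-resp (sym (inverseʳ _)) H-ε

    ~-sym : ∀ {i j} → i ~ j → j ~ i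
    ~-sym h = H-resp (⁻¹-anti-homo‿- _ _) (H-⁻¹ h)
      where open Algebra.Properties.AbelianGroup B using (⁻¹-anti-homo‿-)

    ~-trans : ∀ {i j m} → i ~ j → j ~ m → i ~ m
    ~-trans h h′ = H-resp (trans (assoc _ _ _) (∙-congˡ (trans (sym (assoc _ _ _)) (trans (∙-congʳ (inverseˡ _)) (identityˡ _))))) (H-∙ h′ h)

    _~?_ : ∀ i j → Dec (i ~ j)
    i ~? j = H? (cB.from j ∙ cB.from i ⁻¹)

    does-true→ : ∀ {P : Set q} (P? : Dec P) → does P? ≡ true → P
    does-true→ (yes p) _ = p

    representative : Fin k → Fin k
    representative i = first (λ j → does (i ~? j)) i

    ~representative : ∀ i → i ~ representative i
    ~representative i = does-true→ (i ~? representative i) (first-true (λ j → does (i ~? j)) i (dec-true (i ~? i) ~-refl))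

    representative-cong : ∀ {i j} → i ~ j → representative i ≡ representative j
    representative-cong {i} {j} i~j = first-cong (λ m → does (i ~? m)) (λ m → does (j ~? m)) i j same (dec-true (i ~? i) ~-refl) (dec-true (j ~? j) ~-refl)
      where
      same : ∀ m → does (i ~? m) ≡ does (j ~? m)
      same m with j ~? m
      ... | yes j~m = dec-true (i ~? m) (~-trans i~j j~m)
      ... | no ¬j~m with i ~? m
      ... | yes i~m = contradiction (~-trans (~-sym i~j) i~m) ¬j~m
      ... | no _    = ≡.refl

  -- Lagrange's theorem: the cosets are the fibres of `representative` over its fixed points, and x
  -- ↦ i - x matches the coset of i with H.
  subgroup-order-∣ : count (H? ∘ cB.from) ∣ k
  subgroup-order-∣ = divides (count (λ i → representative i Fin.≟ i)) (≡.trans (constant-fibres (λ i → representative i Fin.≟ i) representative _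
      (λ j → ≡.sym (representative-cong (~representative j))) size) (ℕ.*-comm (count (H? ∘ cB.from)) _))
    where
    size : ∀ i → representative i ≡ i → fibre-size representative i ≡ count (H? ∘ cB.from)
    size i rep = ≡.trans
      (count-⇔ (λ j → representative j Fin.≟ i) (λ j → j ~? i)
        (λ j eq → ≡.subst (j ~_) eq (~representative j))
        (λ j j~i → ≡.trans (representative-cong j~i) rep))
      (≡.sym (sum-reindex (Semiring.+-commutativeMonoid ℕ.+-*-semiring) cB cB
        (mkInverse (λ x → cB.from i ∙ x ⁻¹) (λ x → cB.from i ∙ x ⁻¹) (∙-congˡ ∘ ⁻¹-cong) (∙-congˡ ∘ ⁻¹-cong) involutive involutive)
        (indicator ∘ H?) (λ {x} {y} x≈y → indicator-⇔ (H? x) (H? y) (H-resp x≈y) (H-resp (sym x≈y)))))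
      where
      involutive : ∀ x → cB.from i ∙ (cB.from i ∙ x ⁻¹) ⁻¹ ≈ x
      involutive x = trans (∙-congˡ (trans (sym (⁻¹-∙-comm _ _)) (∙-congˡ (⁻¹-involutive x)))) (trans (sym (assoc _ _ _)) (trans (∙-congʳ (inverseʳ _)) (identityˡ x)))

open Algebra.Properties.Semiring.Sum ℤ.+-*-semiring using ()
  renaming ( sum to ∑; sum-cong-≗ to ∑-cong; ∑-comm to ∑-swap; ∑-distrib-+ to ∑-+; sum-replicate-zero to ∑-zero
           ; *-distribˡ-sum to *-distribˡ-∑; *-distribʳ-sum to *-distribʳ-∑)

-- Sums over intervals of subsets

module _ {A : Set a} {P : A → Set p} (P? : ∀ x → Dec (P x)) where
  filterSum : (A → ℤ) → List A → ℤ
  filterSum f xs = foldr ℤ._+_ 0ℤ (List.map f (filter P? xs))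

  filterSum-cong : ∀ {f g} → (∀ x → P x → f x ≡ g x) → filterSum f ≗ filterSum g
  filterSum-cong f≡g []       = ≡.refl
  filterSum-cong f≡g (x ∷ xs) with P? x
  ... | yes px = ≡.cong₂ ℤ._+_ (f≡g x px) (filterSum-cong f≡g xs)
  ... | no _   = filterSum-cong f≡g xs

  filterSum-++ : ∀ f xs ys → filterSum f (xs List.++ ys) ≡ filterSum f xs ℤ.+ filterSum f ys
  filterSum-++ f []       ys = ≡.sym (ℤ.+-identityˡ _)
  filterSum-++ f (x ∷ xs) ys with P? x
  ... | yes _ = ≡.trans (≡.cong (λ s → f x ℤ.+ s) (filterSum-++ f xs ys)) (≡.sym (ℤ.+-assoc (f x) _ _))
  ... | no _  = filterSum-++ f xs ys

  filterSum-none : ∀ f xs → (∀ x → ¬ P x) → filterSum f xs ≡ 0ℤ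
  filterSum-none f []       ¬P = ≡.refl
  filterSum-none f (x ∷ xs) ¬P with P? x
  ... | yes px = contradiction px (¬P x)
  ... | no _   = filterSum-none f xs ¬P

  filterSum-map : ∀ {b} {B : Set b} {Q : B → Set q} (Q? : ∀ x → Dec (Q x)) (g : B → A) f →
                  (∀ x → P (g x) → Q x) → (∀ x → Q x → P (g x)) →
                  ∀ xs → filterSum f (List.map g xs) ≡ foldr ℤ._+_ 0ℤ (List.map (f ∘ g) (filter Q? xs))
  filterSum-map Q? g f P⇒Q Q⇒P []       = ≡.refl
  filterSum-map Q? g f P⇒Q Q⇒P (x ∷ xs) with P? (g x) | Q? x
  ... | yes _  | yes _  = ≡.cong (λ s → f (g x) ℤ.+ s) (filterSum-map Q? g f P⇒Q Q⇒P xs)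
  ... | no _   | no _   = filterSum-map Q? g f P⇒Q Q⇒P xs
  ... | yes px | no ¬qx = contradiction (P⇒Q x px) ¬qx
  ... | no ¬px | yes qx = contradiction (Q⇒P x qx) ¬px

  filterSum-*ˡ : ∀ c f xs → c ℤ.* filterSum f xs ≡ filterSum (λ x → c ℤ.* f x) xs
  filterSum-*ˡ c f []       = ℤ.*-zeroʳ c
  filterSum-*ˡ c f (x ∷ xs) with P? x
  ... | yes _ = ≡.trans (ℤ.*-distribˡ-+ c (f x) _) (≡.cong (λ s → c ℤ.* f x ℤ.+ s) (filterSum-*ˡ c f xs))
  ... | no _  = filterSum-*ˡ c f xs

  filterSum-∑ : ∀ {k} (f : A → Fin k → ℤ) xs → filterSum (λ x → ∑ (f x)) xs ≡ ∑ (λ i → filterSum (λ x → f x i) xs)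
  filterSum-∑ {k} f []       = ≡.sym (∑-zero k)
  filterSum-∑ f (x ∷ xs) with P? x
  ... | yes _ = ≡.trans (≡.cong (λ s → ∑ (f x) ℤ.+ s) (filterSum-∑ f xs)) (≡.sym (∑-+ (f x) _))
  ... | no _  = filterSum-∑ f xs

interval? : (S T : Subset n) → ∀ B → Dec (S ⊆ B × B ⊆ T)
interval? S T B = S ⊆? B ×-dec B ⊆? T

true⊈false : {S T : Subset n} → ¬ (true ∷ S ⊆ false ∷ T)
true⊈false S⊆T with S⊆T Vec.here
... | ()

module _ (S T : Subset n) where
  private
    split : ∀ {s t} (f : Subset (suc n) → ℤ) → ∑[ s ∷ S ⊆-⊆ t ∷ T ] f ≡
            filterSum (interval? (s ∷ S) (t ∷ T)) f (List.map (false ∷_) (subsets n)) ℤ.+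
            filterSum (interval? (s ∷ S) (t ∷ T)) f (List.map (true ∷_) (subsets n))
    split {s} {t} f = filterSum-++ (interval? (s ∷ S) (t ∷ T)) f (List.map (false ∷_) (subsets n)) _

    empty : ∀ {s t} b f → (∀ B → ¬ (s ∷ S ⊆ b ∷ B × b ∷ B ⊆ t ∷ T)) →
            filterSum (interval? (s ∷ S) (t ∷ T)) f (List.map (b ∷_) (subsets n)) ≡ 0ℤ
    empty {s} {t} b f none = ≡.trans
      (filterSum-map (interval? (s ∷ S) (t ∷ T)) {Q = λ B → s ∷ S ⊆ b ∷ B × b ∷ B ⊆ t ∷ T} (λ B → interval? (s ∷ S) (t ∷ T) (b ∷ B)) (b ∷_) f (λ B h → h) (λ B h → h) (subsets n))
      (filterSum-none (λ B → interval? (s ∷ S) (t ∷ T) (b ∷ B)) (f ∘ (b ∷_)) (subsets n) none)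

    full : ∀ {s t} b f → (∀ {B} → S ⊆ B → s ∷ S ⊆ b ∷ B) → (∀ {B} → B ⊆ T → b ∷ B ⊆ t ∷ T) →
           filterSum (interval? (s ∷ S) (t ∷ T)) f (List.map (b ∷_) (subsets n)) ≡ ∑[ S ⊆-⊆ T ] (f ∘ (b ∷_))
    full {s} {t} b f ⊆₁ ⊆₂ = filterSum-map (interval? (s ∷ S) (t ∷ T)) (interval? S T) (b ∷_) f
      (λ B (h₁ , h₂) → drop-∷-⊆ h₁ , drop-∷-⊆ h₂) (λ B (h₁ , h₂) → ⊆₁ h₁ , ⊆₂ h₂) (subsets n)

  interval-neither : ∀ f → ∑[ false ∷ S ⊆-⊆ false ∷ T ] f ≡ ∑[ S ⊆-⊆ T ] (f ∘ (false ∷_))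
  interval-neither f = ≡.trans (split f) (≡.trans (≡.cong₂ ℤ._+_ (full false f s⊆s s⊆s) (empty true f (λ B → true⊈false ∘ proj₂))) (ℤ.+-identityʳ _))

  interval-both : ∀ f → ∑[ true ∷ S ⊆-⊆ true ∷ T ] f ≡ ∑[ S ⊆-⊆ T ] (f ∘ (true ∷_))
  interval-both f = ≡.trans (split f) (≡.trans (≡.cong₂ ℤ._+_ (empty false f (λ B → true⊈false ∘ proj₁)) (full true f s⊆s s⊆s)) (ℤ.+-identityˡ _))

  interval-upper : ∀ f → ∑[ false ∷ S ⊆-⊆ true ∷ T ] f ≡ ∑[ S ⊆-⊆ T ] (f ∘ (false ∷_)) ℤ.+ ∑[ S ⊆-⊆ T ] (f ∘ (true ∷_))
  interval-upper f = ≡.trans (split f) (≡.cong₂ ℤ._+_ (full false f s⊆s out⊆) (full true f out⊆ s⊆s))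

∏ : (Fin n → ℤ) → ℤ
∏ {zero}  f = 1ℤ
∏ {suc n} f = f zero ℤ.* ∏ (f ∘ suc)

∏∈ : Subset n → (Fin n → ℤ) → ℤ
∏∈ []          z = 1ℤ
∏∈ (true  ∷ B) z = z zero ℤ.* ∏∈ B (z ∘ suc)
∏∈ (false ∷ B) z = ∏∈ B (z ∘ suc)

module InclusionExclusion (c e : ℤ) where

  -- The contribution of one index: in S it belongs to every B; in T ∖ S it is either taken, with
  -- weight c z, or left out, with weight e; outside T it never occurs.
  factor : Bool → Bool → ℤ → ℤ
  factor true  _     z = z
  factor false true  z = c ℤ.* z ℤ.+ e
  factor false false z = 1ℤ

  term : Subset n → Subset n → (Fin n → ℤ) → Subset n → ℤ
  term S T z B = c ℤ.^ (∣ B ∣ ∸ ∣ S ∣) ℤ.* e ℤ.^ (∣ T ∣ ∸ ∣ B ∣) ℤ.* ∏∈ B z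

  -- When the factors c z + e over T ∖ S are multiplied out, B records where c z was chosen.
  ∑-term : (S T : Subset n) (z : Fin n → ℤ) → S ⊆ T →
           ∑[ S ⊆-⊆ T ] term S T z ≡ ∏ (λ i → factor (lookup S i) (lookup T i) (z i))
  ∑-term []          []          z S⊆T = ≡.refl
  ∑-term (true  ∷ S) (false ∷ T) z S⊆T = ⊥-elim (true⊈false S⊆T)
  ∑-term (false ∷ S) (false ∷ T) z S⊆T = begin
    ∑[ false ∷ S ⊆-⊆ false ∷ T ] term (false ∷ S) (false ∷ T) z   ≡⟨ interval-neither S T (term (false ∷ S) (false ∷ T) z) ⟩
    ∑[ S ⊆-⊆ T ] term S T (z ∘ suc)                               ≡⟨ ∑-term S T (z ∘ suc) (drop-∷-⊆ S⊆T) ⟩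
    rest                                                          ≡⟨ ℤ.*-identityˡ rest ⟨
    1ℤ ℤ.* rest                                                   ∎
    where
    open ≡.≡-Reasoning
    rest = ∏ (λ i → factor (lookup S i) (lookup T i) (z (suc i)))
  ∑-term (true  ∷ S) (true  ∷ T) z S⊆T = begin
    ∑[ true ∷ S ⊆-⊆ true ∷ T ] term (true ∷ S) (true ∷ T) z
      ≡⟨ interval-both S T (term (true ∷ S) (true ∷ T) z) ⟩
    ∑[ S ⊆-⊆ T ] (λ B → c ℤ.^ (∣ B ∣ ∸ ∣ S ∣) ℤ.* e ℤ.^ (∣ T ∣ ∸ ∣ B ∣) ℤ.* (z zero ℤ.* ∏∈ B (z ∘ suc)))
      ≡⟨ filterSum-cong (interval? S T) (λ B _ → rearrange (c ℤ.^ (∣ B ∣ ∸ ∣ S ∣)) (e ℤ.^ (∣ T ∣ ∸ ∣ B ∣)) (z zero) _) (subsets _) ⟩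
    ∑[ S ⊆-⊆ T ] (λ B → z zero ℤ.* term S T (z ∘ suc) B)
      ≡⟨ filterSum-*ˡ (interval? S T) (z zero) (term S T (z ∘ suc)) (subsets _) ⟨
    z zero ℤ.* ∑[ S ⊆-⊆ T ] term S T (z ∘ suc)
      ≡⟨ ≡.cong (z zero ℤ.*_) (∑-term S T (z ∘ suc) (drop-∷-⊆ S⊆T)) ⟩
    z zero ℤ.* ∏ (λ i → factor (lookup S i) (lookup T i) (z (suc i))) ∎
    where
    open ≡.≡-Reasoning
    rearrange : ∀ x y z w → x ℤ.* y ℤ.* (z ℤ.* w) ≡ z ℤ.* (x ℤ.* y ℤ.* w)
    rearrange = ℤ.solve-∀
  ∑-term (false ∷ S) (true  ∷ T) z S⊆T = begin
    ∑[ false ∷ S ⊆-⊆ true ∷ T ] term (false ∷ S) (true ∷ T) z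
      ≡⟨ interval-upper S T (term (false ∷ S) (true ∷ T) z) ⟩
    ∑[ S ⊆-⊆ T ] (λ B → c ℤ.^ (∣ B ∣ ∸ ∣ S ∣) ℤ.* e ℤ.^ (suc ∣ T ∣ ∸ ∣ B ∣) ℤ.* ∏∈ B (z ∘ suc)) ℤ.+
    ∑[ S ⊆-⊆ T ] (λ B → c ℤ.^ (suc ∣ B ∣ ∸ ∣ S ∣) ℤ.* e ℤ.^ (∣ T ∣ ∸ ∣ B ∣) ℤ.* (z zero ℤ.* ∏∈ B (z ∘ suc)))
      ≡⟨ ≡.cong₂ ℤ._+_
           -- Truncated subtraction lets the successor out only because ∣B∣ ≤ ∣T∣ here and ∣S∣ ≤ ∣B∣
           -- in the second sum, so membership in the interval is used.
           (filterSum-cong (interval? S T) (λ B h → ≡.trans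
             (≡.cong (λ k → c ℤ.^ (∣ B ∣ ∸ ∣ S ∣) ℤ.* e ℤ.^ k ℤ.* ∏∈ B (z ∘ suc)) (ℕ.+-∸-assoc 1 (p⊆q⇒∣p∣≤∣q∣ (proj₂ h))))
             (rearrange₁ e (c ℤ.^ (∣ B ∣ ∸ ∣ S ∣)) (e ℤ.^ (∣ T ∣ ∸ ∣ B ∣)) (∏∈ B (z ∘ suc)))) (subsets _))
           (filterSum-cong (interval? S T) (λ B h → ≡.trans
             (≡.cong (λ k → c ℤ.^ k ℤ.* e ℤ.^ (∣ T ∣ ∸ ∣ B ∣) ℤ.* (z zero ℤ.* ∏∈ B (z ∘ suc))) (ℕ.+-∸-assoc 1 (p⊆q⇒∣p∣≤∣q∣ (proj₁ h))))
             (rearrange₂ c (z zero) (c ℤ.^ (∣ B ∣ ∸ ∣ S ∣)) (e ℤ.^ (∣ T ∣ ∸ ∣ B ∣)) (∏∈ B (z ∘ suc)))) (subsets _)) ⟩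
    ∑[ S ⊆-⊆ T ] (λ B → e ℤ.* term S T (z ∘ suc) B) ℤ.+ ∑[ S ⊆-⊆ T ] (λ B → (c ℤ.* z zero) ℤ.* term S T (z ∘ suc) B)
      ≡⟨ ≡.cong₂ ℤ._+_ (filterSum-*ˡ (interval? S T) e (term S T (z ∘ suc)) (subsets _))
                       (filterSum-*ˡ (interval? S T) (c ℤ.* z zero) (term S T (z ∘ suc)) (subsets _)) ⟨
    e ℤ.* total ℤ.+ (c ℤ.* z zero) ℤ.* total
      ≡⟨ collect e (c ℤ.* z zero) total ⟩
    (c ℤ.* z zero ℤ.+ e) ℤ.* total
      ≡⟨ ≡.cong ((c ℤ.* z zero ℤ.+ e) ℤ.*_) (∑-term S T (z ∘ suc) (drop-∷-⊆ S⊆T)) ⟩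
    (c ℤ.* z zero ℤ.+ e) ℤ.* ∏ (λ i → factor (lookup S i) (lookup T i) (z (suc i))) ∎
    where
    open ≡.≡-Reasoning
    total = ∑[ S ⊆-⊆ T ] term S T (z ∘ suc)
    rearrange₁ : ∀ e x y w → x ℤ.* (e ℤ.* y) ℤ.* w ≡ e ℤ.* (x ℤ.* y ℤ.* w)
    rearrange₁ = ℤ.solve-∀
    rearrange₂ : ∀ c z x y w → c ℤ.* x ℤ.* y ℤ.* (z ℤ.* w) ≡ (c ℤ.* z) ℤ.* (x ℤ.* y ℤ.* w)
    rearrange₂ = ℤ.solve-∀
    collect : ∀ e c t → e ℤ.* t ℤ.+ c ℤ.* t ≡ (c ℤ.+ e) ℤ.* t
    collect = ℤ.solve-∀

-- Positive semidefinite kernels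

∑-nonneg : (f : Fin n → ℤ) → (∀ i → 0ℤ ℤ.≤ f i) → 0ℤ ℤ.≤ ∑ f
∑-nonneg {zero}  f h = ℤ.≤-refl
∑-nonneg {suc n} f h = ℤ.+-mono-≤ (h zero) (∑-nonneg (f ∘ suc) (h ∘ suc))

*-nonneg : ∀ {i j} → 0ℤ ℤ.≤ i → 0ℤ ℤ.≤ j → 0ℤ ℤ.≤ i ℤ.* j
*-nonneg {+ i} {+ j} _ _ = ≡.subst (0ℤ ℤ.≤_) (ℤ.pos-* i j) (ℤ.+≤+ ℕ.z≤n)

square-nonneg : ∀ i → 0ℤ ℤ.≤ i ℤ.* i
square-nonneg (+ i)    = *-nonneg {+ i} {+ i} (ℤ.+≤+ ℕ.z≤n) (ℤ.+≤+ ℕ.z≤n)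
square-nonneg -[1+ i ] = ℤ.+≤+ ℕ.z≤n

*-cancel-nonneg : ∀ k .{{_ : NonZero k}} {i} → 0ℤ ℤ.≤ + k ℤ.* i → 0ℤ ℤ.≤ i
*-cancel-nonneg k@(suc _) {i} h = ℤ.*-cancelˡ-≤-pos 0ℤ i (+ k) (≡.subst (ℤ._≤ + k ℤ.* i) (≡.sym (ℤ.*-zeroʳ (+ k))) h)

form : (Fin n → Fin n → ℤ) → (Fin n → ℤ) → ℤ
form K x = ∑ (λ a → ∑ (λ b → x a ℤ.* x b ℤ.* K a b))

PositiveSemidefinite : (Fin n → Fin n → ℤ) → Set
PositiveSemidefinite K = ∀ x → 0ℤ ℤ.≤ form K x

constant-psd : PositiveSemidefinite {n} (λ _ _ → 1ℤ)
constant-psd x = ≡.subst (0ℤ ℤ.≤_) eq (square-nonneg (∑ x))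
  where
  open ≡.≡-Reasoning
  eq : ∑ x ℤ.* ∑ x ≡ form (λ _ _ → 1ℤ) x
  eq = begin
    ∑ x ℤ.* ∑ x                                    ≡⟨ *-distribʳ-∑ (∑ x) x ⟩
    ∑ (λ a → x a ℤ.* ∑ x)                          ≡⟨ ∑-cong (λ a → *-distribˡ-∑ (x a) x) ⟩
    ∑ (λ a → ∑ (λ b → x a ℤ.* x b))                ≡⟨ ∑-cong (λ a → ∑-cong (λ b → ≡.sym (ℤ.*-identityʳ (x a ℤ.* x b)))) ⟩
    form (λ _ _ → 1ℤ) x                            ∎

-- Up to a positive scalar, the kernel is a Gram matrix.
record Gram {n} (K : Fin n → Fin n → ℤ) : Set where
  field
    scale     : ℕ
    scale≢0   : NonZero scale
    {size}    : ℕ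
    vectors   : Fin size → Fin n → ℤ
    products  : ∀ a b → + scale ℤ.* K a b ≡ ∑ (λ h → vectors h a ℤ.* vectors h b)

module _ {K L : Fin n → Fin n → ℤ} where
  -- With scale · L a sum of rank-one kernels v(a) v(b), the form of L · K at x is, up to the scale,
  -- a sum of values of the form of K at the vectors x · v. Plain semidefiniteness of K suffices, so
  -- a product can be built one Gram factor at a time.
  schur-product : Gram L → PositiveSemidefinite K → PositiveSemidefinite (λ a b → L a b ℤ.* K a b)
  schur-product gram K-psd x = *-cancel-nonneg scale {{scale≢0}}
    (≡.subst (0ℤ ℤ.≤_) (≡.sym eq) (∑-nonneg (λ h → form K (y h)) (λ h → K-psd (λ a → x a ℤ.* vectors h a))))
    where
    open Gram gram
    open ≡.≡-Reasoning
    shuffle₁ : ∀ s u v l k → s ℤ.* (u ℤ.* v ℤ.* (l ℤ.* k)) ≡ (s ℤ.* l) ℤ.* (u ℤ.* v ℤ.* k)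
    shuffle₁ = ℤ.solve-∀
    shuffle₂ : ∀ c d u v k → (c ℤ.* d) ℤ.* (u ℤ.* v ℤ.* k) ≡ (u ℤ.* c) ℤ.* (v ℤ.* d) ℤ.* k
    shuffle₂ = ℤ.solve-∀
    y : Fin size → Fin n → ℤ
    y h a = x a ℤ.* vectors h a
    entry : ∀ a b → + scale ℤ.* (x a ℤ.* x b ℤ.* (L a b ℤ.* K a b)) ≡ ∑ (λ h → y h a ℤ.* y h b ℤ.* K a b)
    entry a b = begin
      + scale ℤ.* (x a ℤ.* x b ℤ.* (L a b ℤ.* K a b))
        ≡⟨ shuffle₁ (+ scale) (x a) (x b) (L a b) (K a b) ⟩
      (+ scale ℤ.* L a b) ℤ.* (x a ℤ.* x b ℤ.* K a b)
        ≡⟨ ≡.cong (ℤ._* (x a ℤ.* x b ℤ.* K a b)) (products a b) ⟩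
      ∑ (λ h → vectors h a ℤ.* vectors h b) ℤ.* (x a ℤ.* x b ℤ.* K a b)
        ≡⟨ *-distribʳ-∑ (x a ℤ.* x b ℤ.* K a b) (λ h → vectors h a ℤ.* vectors h b) ⟩
      ∑ (λ h → vectors h a ℤ.* vectors h b ℤ.* (x a ℤ.* x b ℤ.* K a b))
        ≡⟨ ∑-cong (λ h → shuffle₂ (vectors h a) (vectors h b) (x a) (x b) (K a b)) ⟩
      ∑ (λ h → y h a ℤ.* y h b ℤ.* K a b) ∎
    eq : + scale ℤ.* form (λ a b → L a b ℤ.* K a b) x ≡ ∑ (λ h → form K (y h))
    eq = begin
      + scale ℤ.* form (λ a b → L a b ℤ.* K a b) x
        ≡⟨ *-distribˡ-∑ (+ scale) (λ a → ∑ (λ b → x a ℤ.* x b ℤ.* (L a b ℤ.* K a b))) ⟩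
      ∑ (λ a → + scale ℤ.* ∑ (λ b → x a ℤ.* x b ℤ.* (L a b ℤ.* K a b)))
        ≡⟨ ∑-cong (λ a → *-distribˡ-∑ (+ scale) (λ b → x a ℤ.* x b ℤ.* (L a b ℤ.* K a b))) ⟩
      ∑ (λ a → ∑ (λ b → + scale ℤ.* (x a ℤ.* x b ℤ.* (L a b ℤ.* K a b))))
        ≡⟨ ∑-cong (λ a → ∑-cong (entry a)) ⟩
      ∑ (λ a → ∑ (λ b → ∑ (λ h → y h a ℤ.* y h b ℤ.* K a b)))
        ≡⟨ ∑-cong (λ a → ∑-swap (λ b h → y h a ℤ.* y h b ℤ.* K a b)) ⟩
      ∑ (λ a → ∑ (λ h → ∑ (λ b → y h a ℤ.* y h b ℤ.* K a b)))
        ≡⟨ ∑-swap (λ a h → ∑ (λ b → y h a ℤ.* y h b ℤ.* K a b)) ⟩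
      ∑ (λ h → form K (y h)) ∎

∏-psd : ∀ {m} (K : Fin m → Fin n → Fin n → ℤ) → (∀ i → Gram (K i)) → PositiveSemidefinite (λ a b → ∏ (λ i → K i a b))
∏-psd {m = zero}  K gram = constant-psd
∏-psd {m = suc m} K gram = schur-product (gram zero) (∏-psd (K ∘ suc) (gram ∘ suc))

-- Gram kernels of indicator functions

pos-sum : (f : Fin n → ℕ) → + sum f ≡ ∑ (λ i → + f i)
pos-sum {zero}  f = ≡.refl
pos-sum {suc n} f = ≡.cong (λ s → + f zero ℤ.+ s) (pos-sum (f ∘ suc))

⟦_⟧ᵢ : {P : Set p} → Dec P → ℤ
⟦ P? ⟧ᵢ = + indicator P?

module _ {N : ℕ} (e : Fin n → Fin N) where
  private
    d : Fin N → Fin n → ℤ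
    d h a = ⟦ e a Fin.≟ h ⟧ᵢ

    equal : Fin n → Fin n → ℤ
    equal a b = ⟦ e a Fin.≟ e b ⟧ᵢ

    ∑-d : ∀ a → ∑ (λ h → d h a) ≡ 1ℤ
    ∑-d a = ≡.trans (≡.sym (pos-sum (λ h → indicator (e a Fin.≟ h))))
      (≡.cong +_ (count-unique (λ h → e a Fin.≟ h) (e a) ≡.refl (λ h → ≡.sym)))

    ∑-dd : ∀ a b → ∑ (λ h → d h a ℤ.* d h b) ≡ equal a b
    ∑-dd a b = begin
      ∑ (λ h → d h a ℤ.* d h b)      ≡⟨ ∑-cong pointwise ⟩
      ∑ (λ h → equal a b ℤ.* d h b)  ≡⟨ *-distribˡ-∑ (equal a b) (λ h → d h b) ⟨
      equal a b ℤ.* ∑ (λ h → d h b)  ≡⟨ ≡.cong (equal a b ℤ.*_) (∑-d b) ⟩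
      equal a b ℤ.* 1ℤ               ≡⟨ ℤ.*-identityʳ (equal a b) ⟩
      equal a b                      ∎
      where
      open ≡.≡-Reasoning
      pointwise : ∀ h → d h a ℤ.* d h b ≡ equal a b ℤ.* d h b
      pointwise h with e b Fin.≟ h
      ... | yes ≡.refl = ≡.refl
      ... | no _       = ≡.trans (ℤ.*-zeroʳ (d h a)) (≡.sym (ℤ.*-zeroʳ (equal a b)))

  -- The vectors are the indicators of the fibres of `e`: two indices have equal values exactly when
  -- they share a fibre, and each lies in only one.
  equality-gram : Gram equal
  equality-gram = record
    { scale = 1 ; scale≢0 = _ ; vectors = d
    ; products = λ a b → ≡.trans (ℤ.*-identityˡ (equal a b)) (≡.sym (∑-dd a b)) }

  -- N [a = b] - 1 is, up to the factor N, its own convolution square.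
  centred-gram : NonZero N → Gram (λ a b → + N ℤ.* equal a b ℤ.+ -1ℤ)
  centred-gram N≢0 = record
    { scale = N ; scale≢0 = N≢0 ; vectors = λ h a → + N ℤ.* d h a ℤ.+ -1ℤ
    ; products = λ a b → ≡.sym (begin
        ∑ (λ h → (+ N ℤ.* d h a ℤ.+ -1ℤ) ℤ.* (+ N ℤ.* d h b ℤ.+ -1ℤ))
          ≡⟨ ∑-cong (λ h → expand (+ N) (d h a) (d h b)) ⟩
        ∑ (λ h → + N ℤ.* + N ℤ.* (d h a ℤ.* d h b) ℤ.+ ((ℤ.- + N) ℤ.* d h a ℤ.+ ((ℤ.- + N) ℤ.* d h b ℤ.+ 1ℤ)))
          ≡⟨ ∑-+ (λ h → + N ℤ.* + N ℤ.* (d h a ℤ.* d h b)) _ ⟩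
        ∑ (λ h → + N ℤ.* + N ℤ.* (d h a ℤ.* d h b)) ℤ.+ ∑ (λ h → (ℤ.- + N) ℤ.* d h a ℤ.+ ((ℤ.- + N) ℤ.* d h b ℤ.+ 1ℤ))
          ≡⟨ ≡.cong₂ ℤ._+_ (scaled (+ N ℤ.* + N) (λ h → d h a ℤ.* d h b) (∑-dd a b))
               (≡.trans (∑-+ (λ h → (ℤ.- + N) ℤ.* d h a) (λ h → (ℤ.- + N) ℤ.* d h b ℤ.+ 1ℤ))
                 (≡.cong₂ ℤ._+_ (scaled (ℤ.- + N) (λ h → d h a) (∑-d a))
                   (≡.trans (∑-+ (λ h → (ℤ.- + N) ℤ.* d h b) (λ _ → 1ℤ))
                     (≡.cong₂ ℤ._+_ (scaled (ℤ.- + N) (λ h → d h b) (∑-d b)) ∑-1)))) ⟩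
        + N ℤ.* + N ℤ.* equal a b ℤ.+ ((ℤ.- + N) ℤ.* 1ℤ ℤ.+ ((ℤ.- + N) ℤ.* 1ℤ ℤ.+ + N))
          ≡⟨ collect (+ N) (equal a b) ⟩
        + N ℤ.* (+ N ℤ.* equal a b ℤ.+ -1ℤ) ∎) }
    where
    open ≡.≡-Reasoning
    expand : ∀ N x y → (N ℤ.* x ℤ.+ -1ℤ) ℤ.* (N ℤ.* y ℤ.+ -1ℤ) ≡
             N ℤ.* N ℤ.* (x ℤ.* y) ℤ.+ ((ℤ.- N) ℤ.* x ℤ.+ ((ℤ.- N) ℤ.* y ℤ.+ 1ℤ))
    expand = ℤ.solve-∀
    collect : ∀ N e → N ℤ.* N ℤ.* e ℤ.+ ((ℤ.- N) ℤ.* 1ℤ ℤ.+ ((ℤ.- N) ℤ.* 1ℤ ℤ.+ N)) ≡ N ℤ.* (N ℤ.* e ℤ.+ -1ℤ)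
    collect = ℤ.solve-∀
    scaled : ∀ c (f : Fin N → ℤ) {v} → ∑ f ≡ v → ∑ (λ h → c ℤ.* f h) ≡ c ℤ.* v
    scaled c f eq = ≡.trans (≡.sym (*-distribˡ-∑ c f)) (≡.cong (c ℤ.*_) eq)
    ∑-1 : ∑ {N} (λ _ → 1ℤ) ≡ + N
    ∑-1 = ≡.trans (≡.sym (pos-sum {N} (λ _ → 1))) (≡.cong +_ (count-all {k = N} (λ h → yes ≡.refl) (λ h → ≡.refl {x = h})))

  constant-gram : Gram {n} (λ _ _ → 1ℤ)
  constant-gram = record { scale = 1 ; scale≢0 = _ ; size = 1 ; vectors = λ _ _ → 1ℤ ; products = λ _ _ → ≡.refl }

  open InclusionExclusion (+ N) -1ℤ

  factor-gram : NonZero N → ∀ s t → Gram (λ a b → factor s t (equal a b))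
  factor-gram N≢0 true  t     = equality-gram
  factor-gram N≢0 false true  = centred-gram N≢0
  factor-gram N≢0 false false = constant-gram

-- Products over indices, and induction along subsets

∏-cong : {f g : Fin n → ℤ} → (∀ i → f i ≡ g i) → ∏ f ≡ ∏ g
∏-cong {zero}  eq = ≡.refl
∏-cong {suc n} eq = ≡.cong₂ ℤ._*_ (eq zero) (∏-cong (eq ∘ suc))

∏-nonneg : (f : Fin n → ℤ) → (∀ i → 0ℤ ℤ.≤ f i) → 0ℤ ℤ.≤ ∏ f
∏-nonneg {zero}  f h = ℤ.+≤+ ℕ.z≤n
∏-nonneg {suc n} f h = *-nonneg (h zero) (∏-nonneg (f ∘ suc) (h ∘ suc))

indicator-∏∈ : (B : Subset n) {Q : Fin n → Set q} (Q? : ∀ i → Dec (Q i)) (all? : Dec (∀ i → i ∈ B → Q i)) →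
               ⟦ all? ⟧ᵢ ≡ ∏∈ B (λ i → ⟦ Q? i ⟧ᵢ)
indicator-∏∈ [] Q? all? = ≡.cong +_ (indicator-yes all? (λ i ()))
indicator-∏∈ (false ∷ B) Q? all? = ≡.trans
  (≡.cong +_ (indicator-⇔ all? tail? (λ { h i i∈B → h (suc i) (there i∈B) }) (λ { h _ (there i∈B) → h _ i∈B })))
  (indicator-∏∈ B (Q? ∘ suc) tail?)
  where tail? = map′ (λ h i i∈B → h (suc i) (there i∈B)) (λ { h _ (there i∈B) → h _ i∈B }) all?
indicator-∏∈ (true ∷ B) {Q} Q? all? with Q? zero
... | no ¬q = ≡.cong +_ (indicator-no all? (λ h → ¬q (h zero here)))
... | yes q = ≡.trans
  (≡.trans (≡.cong +_ (indicator-⇔ all? tail? (λ { h i i∈B → h (suc i) (there i∈B) }) (λ { h _ here → q ; h _ (there i∈B) → h _ i∈B })))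
    (indicator-∏∈ B (Q? ∘ suc) tail?)) (≡.sym (ℤ.*-identityˡ _))
  where tail? = map′ (λ h i i∈B → h (suc i) (there i∈B)) (λ { h _ here → q ; h _ (there i∈B) → h _ i∈B }) all?

-- Climbs from S to T one element at a time; meant for statements about rank, which is controlled at
-- each such step.
chain-induction : (P : Subset n → Set p) (S T : Subset n) → S ⊆ T → P S →
  (∀ B α → S ⊆ B → B ⊆ T → α ∈ T → α ∉ B → P B → P (B ∪ ⁅ α ⁆)) → P T
chain-induction P [] [] S⊆T PS step = PS
chain-induction P (true ∷ S) (false ∷ T) S⊆T PS step = ⊥-elim (true⊈false S⊆T)
chain-induction P (true ∷ S) (true ∷ T) S⊆T PS step =
  chain-induction (P ∘ (true ∷_)) S T (drop-∷-⊆ S⊆T) PS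
    (λ B α S⊆B B⊆T α∈T α∉B → step (true ∷ B) (suc α) (s⊆s S⊆B) (s⊆s B⊆T) (there α∈T) (λ { (there h) → α∉B h }))
chain-induction P (false ∷ S) (false ∷ T) S⊆T PS step =
  chain-induction (P ∘ (false ∷_)) S T (drop-∷-⊆ S⊆T) PS
    (λ B α S⊆B B⊆T α∈T α∉B → step (false ∷ B) (suc α) (s⊆s S⊆B) (s⊆s B⊆T) (there α∈T) (λ { (there h) → α∉B h }))
chain-induction P (false ∷ S) (true ∷ T) S⊆T PS step =
  -- Index 0 is added before any index of the tail, so every later set contains it.
  chain-induction (P ∘ (true ∷_)) S T (drop-∷-⊆ S⊆T)
    (≡.subst (P ∘ (true ∷_)) (∪-identityʳ S) (step (false ∷ S) zero ⊆-refl S⊆T here (λ ()) PS))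
    (λ B α S⊆B B⊆T α∈T α∉B → step (true ∷ B) (suc α) (out⊆ S⊆B) (s⊆s B⊆T) (there α∈T) (λ { (there h) → α∉B h }))

-- Quotients of Γ by generated subgroups

-- The operations of Γ and of its quotients agree, but the library indexes them by the whole structure.
module Quotient {c ℓ} (Γ : AbelianGroup c ℓ) {I : Set} (v : I → AbelianGroup.Carrier Γ) where
  open AbelianGroup Γ
  open Combinations Γ
  private
    module CQ = Combinations (quotient Γ v)

  ×-quotient : ∀ k x → k CQ.×ₙ x ≡ k ×ₙ x
  ×-quotient zero    x = ≡.refl
  ×-quotient (suc k) x = ≡.cong (x ∙_) (×-quotient k x)

  lin-quotient : ∀ {n} (z : Vector ℤ n) w → CQ.lin z w ≡ lin z w
  lin-quotient {zero}  z w = ≡.refl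
  lin-quotient {suc n} z w = ≡.cong₂ _∙_ (·-quotient (z zero)) (lin-quotient (z ∘ suc) (w ∘ suc))
    where
    ·-quotient : ∀ i → i CQ.∙∙ w zero ≡ i ∙∙ w zero
    ·-quotient (+ k)    = ×-quotient k (w zero)
    ·-quotient -[1+ k ] = ≡.cong _⁻¹ (×-quotient (suc k) (w zero))

  ≈⇒≈/ : ∀ {x y} → x ≈ y → Generated Γ v (x ∙ y ⁻¹)
  ≈⇒≈/ x≈y = resp (sym (x≈y⇒x∙y⁻¹≈ε x≈y)) unit

  ∙ε⁻¹ : ∀ {x} → x ∙ ε ⁻¹ ≈ x
  ∙ε⁻¹ = trans (∙-congˡ ε⁻¹≈ε) (identityʳ _)

  torsion⇒saturation : ∀ {x} → IsTorsion (quotient Γ v) x → Saturation (generated-isSubgroup v) x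
  torsion⇒saturation {x} (k , k≢0 , g) = k , k≢0 , resp (trans ∙ε⁻¹ (reflexive (×-quotient k x))) g

  saturation⇒torsion : ∀ {x} → Saturation (generated-isSubgroup v) x → IsTorsion (quotient Γ v) x
  saturation⇒torsion {x} (k , k≢0 , g) = k , k≢0 , resp (sym (trans ∙ε⁻¹ (reflexive (×-quotient k x)))) g

  open Splitting (quotient Γ v) using (Split)

  -- A basis of the free part of Γ/⟨v⟩ lifts to Γ unchanged, so every splitting computes the same
  -- number, the rank of Γ, as r + s.
  split-rank : ∀ {r} → IsRank Γ (Generated Γ v) r → (split : Split) → IsRank Γ (Rank.Everything Γ) (r + Split.s split)
  split-rank rank split = Rank.rank-additive Γ (generated-isSubgroup v) rank w
    (λ z h → independent z (resp (sym (trans ∙ε⁻¹ (reflexive (lin-quotient z w)))) h))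
    (λ x → let z , h = spanning x in z , torsion⇒saturation
      (e , e≢0 , ≡.subst (λ y → Generated Γ v ((e CQ.×ₙ (x ∙ y ⁻¹)) ∙ ε ⁻¹)) (lin-quotient z w) h))
    where open Split split renaming (v to w; k to e; k≢0 to e≢0)

  finitelyGenerated-quotient : IsFinitelyGenerated Γ → IsFinitelyGenerated (quotient Γ v)
  finitelyGenerated-quotient (n , g , generates) = n , g , λ x → coarsen (generates x)
    where
    coarsen : ∀ {x} → Generated Γ g x → Generated (quotient Γ v) g x
    coarsen (gen i)    = gen i
    coarsen unit       = unit
    coarsen (mul a b)  = mul (coarsen a) (coarsen b)
    coarsen (inv a)    = inv (coarsen a)
    coarsen (resp e a) = resp (≈⇒≈/ e) (coarsen a)

-- The groups P_B of homomorphisms into a finite group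

HomGroup : ∀ {c₁ ℓ₁ c₂ ℓ₂} → AbelianGroup c₁ ℓ₁ → AbelianGroup c₂ ℓ₂ → AbelianGroup (c₁ ⊔ ℓ₁ ⊔ c₂ ⊔ ℓ₂) (c₁ ⊔ ℓ₂)
HomGroup H G = record
  { Carrier = Setoid.Carrier (Hom H G)
  ; _≈_ = Setoid._≈_ (Hom H G)
  ; _∙_ = λ φ ψ → mkHom (λ x → ⟦ φ ⟧ x ∙ ⟦ ψ ⟧ x) (λ p → ∙-cong (⟦⟧-cong φ p) (⟦⟧-cong ψ p))
      (λ x y → trans (∙-cong (homo φ x y) (homo ψ x y)) (interchange _ _ _ _))
  ; ε = mkHom (λ _ → ε) (λ _ → refl) (λ _ _ → sym (identityʳ ε))
  ; _⁻¹ = λ φ → mkHom (λ x → ⟦ φ ⟧ x ⁻¹) (λ p → ⁻¹-cong (⟦⟧-cong φ p))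
      (λ x y → trans (⁻¹-cong (homo φ x y)) (sym (⁻¹-∙-comm _ _)))
  ; isAbelianGroup = record
    { isGroup = record
      { isMonoid = record
        { isSemigroup = record
          { isMagma = record
            { isEquivalence = Setoid.isEquivalence (Hom H G)
            ; ∙-cong = λ p q x → ∙-cong (p x) (q x)
            }
          ; assoc = λ φ ψ χ x → assoc _ _ _
          }
        ; identity = (λ φ x → identityˡ _) , (λ φ x → identityʳ _)
        }
      ; inverse = (λ φ x → inverseˡ _) , (λ φ x → inverseʳ _)
      ; ⁻¹-cong = λ p x → ⁻¹-cong (p x)
      }
    ; comm = λ φ ψ x → comm _ _
    }
  }
  where
  open AbelianGroup G
  open Combinations G using (interchange; ⁻¹-∙-comm)
  open Homomorphisms H G using (mkHom)
  open GroupHomomorphism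

module QuotientHoms {c₁ ℓ₁ c₂ ℓ₂} (Γ : AbelianGroup c₁ ℓ₁) {n} (A : Vector (AbelianGroup.Carrier Γ) n)
                    (D : AbelianGroup c₂ ℓ₂) {N} (cD : HasCardinality (AbelianGroup.setoid D) N)
                    (h : Subset n → ℕ) (cHom : ∀ B → HasCardinality (Hom (quotient Γ (_↾_ Γ A B)) D) (h B)) where
  private
    module Γ = AbelianGroup Γ
    module D = AbelianGroup D
    module CΓ = Combinations Γ
    module CD = Combinations D
  open GroupHomomorphism
  open AbelianGroup using (setoid)

  Q : Subset n → AbelianGroup _ _
  Q B = quotient Γ (_↾_ Γ A B)

  P : Subset n → AbelianGroup _ _
  P B = HomGroup (Q B) D

  Generated-mono : ∀ {S B} → S ⊆ B → ∀ {x} → Generated Γ (_↾_ Γ A S) x → Generated Γ (_↾_ Γ A B) x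
  Generated-mono S⊆B = CΓ.generated⊆ (CΓ.generated-isSubgroup (_↾_ Γ A _)) (λ (i , i∈S) → gen (i , S⊆B i∈S))

  -- Composition with the projection Γ/⟨S⟩ → Γ/⟨B⟩. The quotients share the carrier of Γ, so only
  -- the congruence proof changes.
  inflate : ∀ {S B} → S ⊆ B → AbelianGroup.Carrier (P B) → AbelianGroup.Carrier (P S)
  inflate {S} {B} S⊆B φ = Homomorphisms.mkHom (Q S) D ⟦ φ ⟧ (⟦⟧-cong φ ∘ Generated-mono {S} {B} S⊆B) (homo φ)

  Kills : ∀ {S} → AbelianGroup.Carrier (P S) → Subset n → Set _
  Kills φ B = ∀ i → i ∈ B → ⟦ φ ⟧ (A i) D.≈ D.ε

  kills? : ∀ {S} (φ : AbelianGroup.Carrier (P S)) B → Dec (Kills φ B)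
  kills? φ B = Fin.all? (λ i → i ∈? B →-dec ≈-dec cD (⟦ φ ⟧ (A i)) D.ε)

  Kills-resp : ∀ {S B} {φ ψ : AbelianGroup.Carrier (P S)} → AbelianGroup._≈_ (P S) φ ψ → Kills φ B → Kills ψ B
  Kills-resp φ≈ψ kills i i∈B = D.trans (D.sym (φ≈ψ (A i))) (kills i i∈B)

  kills-own : ∀ {B} (φ : AbelianGroup.Carrier (P B)) → Kills φ B
  kills-own {B} φ i i∈B = D.trans (⟦⟧-cong φ (resp (Γ.sym (Quotient.∙ε⁻¹ Γ (_↾_ Γ A B))) (gen (i , i∈B)))) (ε-homo φ)

  kernel-isSubgroup : ∀ {S} (φ : AbelianGroup.Carrier (P S)) → IsSubgroup Γ (λ x → ⟦ φ ⟧ x D.≈ D.ε)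
  kernel-isSubgroup {S} φ = record
    { H-resp = λ x≈y p → D.trans (⟦⟧-cong φ (Quotient.≈⇒≈/ Γ (_↾_ Γ A S) (Γ.sym x≈y))) p
    ; H-ε = ε-homo φ
    ; H-∙ = λ p q → D.trans (homo φ _ _) (D.trans (D.∙-cong p q) (D.identityʳ D.ε))
    ; H-⁻¹ = λ p → D.trans (⁻¹-homo φ _) (D.trans (D.⁻¹-cong p) CD.ε⁻¹≈ε)
    }

  -- The kernel of φ is a subgroup containing the generators of ⟨B⟩, so φ respects the equality of
  -- Γ/⟨B⟩.
  factor-through : ∀ {S B} (φ : AbelianGroup.Carrier (P S)) → Kills φ B → AbelianGroup.Carrier (P B)
  factor-through {S} {B} φ kills = Homomorphisms.mkHom (Q B) D ⟦ φ ⟧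
    (λ {x} {y} g → CD.x∙y⁻¹≈ε⇒x≈y _ _ (D.trans (D.sym (Homomorphisms.hom-∙⁻¹ (Q S) D φ x y))
      (CΓ.generated⊆ (kernel-isSubgroup φ) (λ (i , i∈B) → kills i i∈B) g)))
    (homo φ)

  cP : ∀ B → HasCardinality (setoid (P B)) (h B)
  cP = cHom

  h-count : ∀ {S B} → S ⊆ B → h B ≡ count (λ j → kills? (Inverse.from (cP S) j) B)
  h-count {S} {B} S⊆B = subset-cardinality (cP S) (cP B) (inflate S⊆B) (λ p → p) (λ p → p)
    (λ φ → kills? φ B) (λ {φ} {ψ} → Kills-resp {S} {B} {φ} {ψ}) kills-own (λ φ kills → factor-through φ kills , λ x → D.refl)

  module _ (S : Subset n) (α : Fin n) where
    private
      module PS = AbelianGroup (P S)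
      Sα = S ∪ ⁅ α ⁆

      S⊆Sα : S ⊆ Sα
      S⊆Sα = p⊆p∪q ⁅ α ⁆

      eval : PS.Carrier → D.Carrier
      eval φ = ⟦ φ ⟧ (A α)

      InImage : D.Carrier → Set _
      InImage g = ∃[ φ ] eval φ D.≈ g

      image? : ∀ g → Dec (InImage g)
      image? g = ∃-dec (cP S) (λ φ≈ψ p → D.trans (D.sym (φ≈ψ (A α))) p) (λ φ → ≈-dec cD (eval φ) g)

      image-isSubgroup : IsSubgroup D InImage
      image-isSubgroup = record
        { H-resp = λ { x≈y (φ , p) → φ , D.trans p x≈y }
        ; H-ε = PS.ε , D.refl
        ; H-∙ = λ { (φ , p) (ψ , q) → φ PS.∙ ψ , D.∙-cong p q }
        ; H-⁻¹ = λ { (φ , p) → φ PS.⁻¹ , D.⁻¹-cong p }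
        }

      -- The translate by φ₀ of the kernel of evaluation, and that kernel is P Sα.
      fibre : ∀ g → InImage g → Fibre cD (cP S) (cP Sα) eval g
      fibre g (φ₀ , p) = record
        { param     = λ ψ → inflate S⊆Sα ψ PS.∙ φ₀
        ; cong      = λ q x → D.∙-congʳ (q x)
        ; injective = λ q x → ∙-cancelʳ _ _ _ (q x)
        ; into      = λ ψ → D.trans (D.∙-cong (kills-own ψ α (q⊆p∪q S ⁅ α ⁆ (x∈⁅x⁆ α))) p) (D.identityˡ g)
        ; onto      = λ φ q → factor-through (φ PS.∙ φ₀ PS.⁻¹) (kills φ q) , λ x → //-rightDividesˡ _ _
        }
        where
        open Algebra.Properties.AbelianGroup D using (∙-cancelʳ; //-rightDividesˡ)
        kills : ∀ φ → eval φ D.≈ g → Kills (φ PS.∙ φ₀ PS.⁻¹) Sα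
        kills φ q i i∈ with x∈p∪q⁻ S ⁅ α ⁆ i∈
        ... | inj₁ i∈S = kills-own (φ PS.∙ φ₀ PS.⁻¹) i i∈S
        ... | inj₂ i∈α with ≡.refl ← x∈⁅y⁆⇒x≡y α i∈α = D.trans (D.∙-cong q (D.⁻¹-cong p)) (D.inverseʳ g)

    -- The index is the order of the group of values at A α.
    h-adjoin : ∃[ i ] i ∣ N × h S ≡ h Sα * i
    h-adjoin = count (image? ∘ Inverse.from cD) , subgroup-order-∣ D cD image-isSubgroup image? ,
      cardinality-by-fibres cD (cP S) (cP Sα) eval (λ p → p (A α)) image? (IsSubgroup.H-resp image-isSubgroup) (λ φ → φ , D.refl) fibre

  module _ (S T B C : Subset n) (S⊆B : S ⊆ B) (S⊆C : S ⊆ C) (B⊆T : B ⊆ T) (C⊆T : C ⊆ T)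
           (T⊆B∪C : ∀ {i} → i ∈ T → ¬ i ∈ B → i ∈ C) where
    private
      module PS = AbelianGroup (P S)
      module PB = AbelianGroup (P B)
      module PC = AbelianGroup (P C)
      PB×PC = ×-setoid (setoid (P B)) (setoid (P C))
      cPB×PC = cardinality-× (cP B) (cP C)

      -- Here B and C stand for the former S ⊔ B and S ⊔ C. The sequence 0 → P T → P B × P C → P S,
      -- with τ ↦ (τ, -τ) followed by `add`, is exact.
      add : PB.Carrier × PC.Carrier → PS.Carrier
      add (β , γ) = inflate S⊆B β PS.∙ inflate S⊆C γ

      Decomposes : PS.Carrier → Set _
      Decomposes φ = ∃[ βγ ] add βγ PS.≈ φ

      decomposes? : ∀ φ → Dec (Decomposes φ)
      decomposes? φ = ∃-dec cPB×PC
        (λ { (p , q) eq x → D.trans (D.sym (D.∙-cong (p x) (q x))) (eq x) }) (λ βγ → ≈-dec (cP S) (add βγ) φ)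

      fibre : ∀ φ → Decomposes φ → Fibre (cP S) cPB×PC (cP T) add φ
      fibre φ ((β₀ , γ₀) , eq) = record
        { param     = λ τ → (inflate B⊆T τ PB.∙ β₀) , (inflate C⊆T τ PC.⁻¹ PC.∙ γ₀)
        ; cong      = λ p → (λ x → D.∙-congʳ (p x)) , (λ x → D.∙-congʳ (D.⁻¹-cong (p x)))
        ; injective = λ (p , _) x → ∙-cancelʳ _ _ _ (p x)
        ; into      = λ τ x → D.trans (CD.interchange _ _ _ _) (D.trans (D.∙-congʳ (D.inverseʳ _)) (D.trans (D.identityˡ _) (eq x)))
        ; onto      = λ (β , γ) eq′ → let τ = difference β γ eq′ in
            τ , (λ x → //-rightDividesˡ _ _) ,
            (λ x → D.trans (D.∙-congʳ (D.⁻¹-cong (equal β γ eq′ x))) (D.trans (D.∙-congʳ (⁻¹-anti-homo‿- _ _)) (//-rightDividesˡ _ _)))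
        }
        where
        open Algebra.Properties.AbelianGroup D using (∙-cancelʳ; //-rightDividesˡ; ⁻¹-anti-homo‿-)
        module _ (β : PB.Carrier) (γ : PC.Carrier) (eq′ : add (β , γ) PS.≈ φ) where
          equal : ∀ x → ⟦ β ⟧ x D.∙ ⟦ β₀ ⟧ x D.⁻¹ D.≈ ⟦ γ₀ ⟧ x D.∙ ⟦ γ ⟧ x D.⁻¹
          equal x = begin
            b D.∙ b₀ D.⁻¹
              ≈⟨ D.∙-congʳ (//-rightDividesʳ c b) ⟨
            ((b D.∙ c) D.∙ c D.⁻¹) D.∙ b₀ D.⁻¹
              ≈⟨ D.∙-congʳ (D.∙-congʳ (D.trans (eq′ x) (D.sym (eq x)))) ⟩
            ((b₀ D.∙ c₀) D.∙ c D.⁻¹) D.∙ b₀ D.⁻¹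
              ≈⟨ D.∙-congʳ (D.assoc _ _ _) ⟩
            (b₀ D.∙ (c₀ D.∙ c D.⁻¹)) D.∙ b₀ D.⁻¹
              ≈⟨ xyx⁻¹≈y _ _ ⟩
            c₀ D.∙ c D.⁻¹ ∎
            where
            open import Relation.Binary.Reasoning.Setoid D.setoid
            open Algebra.Properties.AbelianGroup D using (//-rightDividesʳ; xyx⁻¹≈y)
            b = ⟦ β ⟧ x
            b₀ = ⟦ β₀ ⟧ x
            c = ⟦ γ ⟧ x
            c₀ = ⟦ γ₀ ⟧ x
          -- By `equal`, β - β₀ is also γ₀ - γ, so it kills both B and C, and these cover T.
          difference : AbelianGroup.Carrier (P T)
          difference = factor-through (β PB.∙ β₀ PB.⁻¹) kills
            where
            kills : Kills (β PB.∙ β₀ PB.⁻¹) T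
            kills i i∈T with i ∈? B
            ... | yes i∈B = kills-own (β PB.∙ β₀ PB.⁻¹) i i∈B
            ... | no i∉B  = D.trans (equal (A i)) (kills-own (γ₀ PC.∙ γ PC.⁻¹) i (T⊆B∪C i∈T i∉B))

    -- Finiteness makes decomposability decidable, so surjectivity of `add` up to double negation is
    -- enough.
    h-decompose : (∀ φ → ¬ ¬ Decomposes φ) → h S * h T ≡ h B * h C
    h-decompose decomposes = ≡.sym (≡.trans
      (cardinality-by-fibres (cP S) cPB×PC (cP T) add (λ (p , q) x → D.∙-cong (p x) (q x)) decomposes?
        (λ φ≈ψ (βγ , eq) → βγ , λ x → D.trans (eq x) (φ≈ψ x)) (λ βγ → βγ , λ x → D.refl) fibre)
      (≡.trans (≡.cong (h T *_) (count-all (decomposes? ∘ Inverse.from (cP S)) (λ i → decidable-stable (decomposes? (Inverse.from (cP S) i)) (decomposes (Inverse.from (cP S) i)))))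
        (ℕ.*-comm (h T) (h S))))

  private
    P⊥ = P ⊥
    module P⊥ = AbelianGroup P⊥
    φ_ = Inverse.from (cP ⊥)

  value : P⊥.Carrier → Fin n → ℤ
  value φ i = ⟦ ≈-dec cD (⟦ φ ⟧ (A i)) D.ε ⟧ᵢ

  value-cong : ∀ {φ ψ} → φ P⊥.≈ ψ → ∀ i → value φ i ≡ value ψ i
  value-cong {φ} {ψ} φ≈ψ i = ≡.cong +_ (indicator-⇔ (≈-dec cD (⟦ φ ⟧ (A i)) D.ε) (≈-dec cD (⟦ ψ ⟧ (A i)) D.ε)
    (D.trans (D.sym (φ≈ψ (A i)))) (D.trans (φ≈ψ (A i))))

  values : Fin (h ⊥) → Fin n → ℤ
  values j = value (φ_ j)

  h-sum : ∀ B → + h B ≡ ∑ (λ j → ∏∈ B (values j))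
  h-sum B = begin
    + h B                                        ≡⟨ ≡.cong +_ (h-count (⊆-min B)) ⟩
    + count (λ j → kills? (φ_ j) B)              ≡⟨ pos-sum (λ j → indicator (kills? (φ_ j) B)) ⟩
    ∑ (λ j → ⟦ kills? (φ_ j) B ⟧ᵢ)               ≡⟨ ∑-cong (λ j → indicator-∏∈ B (λ i → ≈-dec cD (⟦ φ_ j ⟧ (A i)) D.ε) (kills? (φ_ j) B)) ⟩
    ∑ (λ j → ∏∈ B (values j))                    ∎
    where open ≡.≡-Reasoning

  ∑-complement-nonneg : ∀ S T → let open InclusionExclusion -1ℤ 1ℤ in
    0ℤ ℤ.≤ ∑ (λ j → ∏ (λ i → factor (lookup S i) (lookup T i) (values j i)))
  ∑-complement-nonneg S T = ∑-nonneg (λ j → ∏ (λ i → factor (lookup S i) (lookup T i) (values j i)))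
    (λ j → ∏-nonneg (λ i → factor (lookup S i) (lookup T i) (values j i))
      (λ i → factor-nonneg (lookup S i) (lookup T i) (≈-dec cD (⟦ φ_ j ⟧ (A i)) D.ε)))
    where
    open InclusionExclusion -1ℤ 1ℤ
    factor-nonneg : ∀ s t {p} {P : Set p} (P? : Dec P) → 0ℤ ℤ.≤ factor s t ⟦ P? ⟧ᵢ
    factor-nonneg true  t     P?      = ℤ.+≤+ ℕ.z≤n
    factor-nonneg false true  (yes _) = ℤ.+≤+ ℕ.z≤n
    factor-nonneg false true  (no _)  = ℤ.+≤+ ℕ.z≤n
    factor-nonneg false false P?      = ℤ.+≤+ ℕ.z≤n

  module _ (N≢0 : NonZero N) (S T : Subset n) where
    open InclusionExclusion (+ N) -1ℤ
    private
      F : P⊥.Carrier → ℤ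
      F φ = ∏ (λ i → factor (lookup S i) (lookup T i) (value φ i))

      F-cong : ∀ {φ ψ} → φ P⊥.≈ ψ → F φ ≡ F ψ
      F-cong {φ} {ψ} φ≈ψ = ∏-cong (λ i → ≡.cong (factor (lookup S i) (lookup T i)) (value-cong {φ} {ψ} φ≈ψ i))

      e : Fin n → Fin (h ⊥) → Fin N
      e i j = Inverse.to cD (⟦ φ_ j ⟧ (A i))

      K : Fin (h ⊥) → Fin (h ⊥) → ℤ
      K a b = ∏ (λ i → factor (lookup S i) (lookup T i) ⟦ e i a Fin.≟ e i b ⟧ᵢ)

      K-psd : PositiveSemidefinite K
      K-psd = ∏-psd (λ i a b → factor (lookup S i) (lookup T i) ⟦ e i a Fin.≟ e i b ⟧ᵢ)
        (λ i → factor-gram (e i) N≢0 (lookup S i) (lookup T i))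

      -- Two homomorphisms agree at A i exactly when their difference vanishes there. This
      -- identifies the product of Gram kernels with (φ, ψ) ↦ F (φ - ψ).
      K-difference : ∀ a b → K a b ≡ F (φ_ a P⊥.∙ φ_ b P⊥.⁻¹)
      K-difference a b = ∏-cong (λ i → ≡.cong (factor (lookup S i) (lookup T i)) (≡.cong +_
        (indicator-⇔ (e i a Fin.≟ e i b) (≈-dec cD (⟦ φ_ a ⟧ (A i) D.∙ ⟦ φ_ b ⟧ (A i) D.⁻¹) D.ε)
          (λ eq → CD.x≈y⇒x∙y⁻¹≈ε (D.trans (D.sym (Inverse.strictlyInverseʳ cD _)) (D.trans (Inverse.from-cong cD eq) (Inverse.strictlyInverseʳ cD _))))
          (λ eq → Inverse.to-cong cD (CD.x∙y⁻¹≈ε⇒x≈y _ _ eq)))))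

      -- ψ ↦ φ - ψ is an involution of P ⊥, so all rows of K have the same sum.
      translate : ∀ a → ∑ (λ b → F (φ_ a P⊥.∙ φ_ b P⊥.⁻¹)) ≡ ∑ (F ∘ φ_)
      translate a = ≡.sym (sum-reindex (Semiring.+-commutativeMonoid ℤ.+-*-semiring) (cP ⊥) (cP ⊥)
        (mkInverse reflect reflect (λ {φ} {ψ} → reflect-cong {φ} {ψ}) (λ {φ} {ψ} → reflect-cong {φ} {ψ}) involutive involutive)
        F (λ {φ} {ψ} → F-cong {φ} {ψ}))
        where
        reflect : P⊥.Carrier → P⊥.Carrier
        reflect φ = φ_ a P⊥.∙ φ P⊥.⁻¹
        reflect-cong : ∀ {φ ψ} → φ P⊥.≈ ψ → reflect φ P⊥.≈ reflect ψ
        reflect-cong p x = D.∙-congˡ (D.⁻¹-cong (p x))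
        involutive : ∀ φ → reflect (reflect φ) P⊥.≈ φ
        involutive φ x = D.trans (D.∙-congˡ (D.trans (D.sym (CD.⁻¹-∙-comm _ _)) (D.∙-congˡ (CD.⁻¹-involutive _))))
          (D.trans (D.sym (D.assoc _ _ _)) (D.trans (D.∙-congʳ (D.inverseʳ _)) (D.identityˡ _)))

      form-value : form K (λ _ → 1ℤ) ≡ + h ⊥ ℤ.* ∑ (F ∘ φ_)
      form-value = begin
        form K (λ _ → 1ℤ)
          ≡⟨ ∑-cong (λ a → ∑-cong (λ b → ≡.trans (ℤ.*-identityˡ (K a b)) (K-difference a b))) ⟩
        ∑ (λ a → ∑ (λ b → F (φ_ a P⊥.∙ φ_ b P⊥.⁻¹)))
          ≡⟨ ∑-cong translate ⟩
        ∑ {h ⊥} (λ a → ∑ (F ∘ φ_))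
          ≡⟨ ∑-cong {h ⊥} (λ a → ≡.sym (ℤ.*-identityˡ (∑ (F ∘ φ_)))) ⟩
        ∑ {h ⊥} (λ a → 1ℤ ℤ.* ∑ (F ∘ φ_))
          ≡⟨ *-distribʳ-∑ {h ⊥} (∑ (F ∘ φ_)) (λ a → 1ℤ) ⟨
        ∑ {h ⊥} (λ a → 1ℤ) ℤ.* ∑ (F ∘ φ_)
          ≡⟨ ≡.cong (ℤ._* ∑ (F ∘ φ_)) (≡.trans (≡.sym (pos-sum {h ⊥} (λ _ → 1)))
               (≡.cong +_ (count-all {k = h ⊥} (λ j → yes ≡.refl) (λ j → ≡.refl {x = j})))) ⟩
        + h ⊥ ℤ.* ∑ (F ∘ φ_) ∎
        where open ≡.≡-Reasoning

    -- The product is a positive definite function F on the finite group P ⊥, and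
    -- ∑ F is, up to the order of P ⊥, the value at (1,…,1) of the form F(φ - ψ).
    ∑-factor-nonneg : 0ℤ ℤ.≤ ∑ (λ j → ∏ (λ i → factor (lookup S i) (lookup T i) (values j i)))
    ∑-factor-nonneg = *-cancel-nonneg (h ⊥) {{Fin.nonZeroIndex (Inverse.to (cP ⊥) P⊥.ε)}} (≡.subst (0ℤ ℤ.≤_) form-value (K-psd (λ _ → 1ℤ)))

-- Extension of homomorphisms into a divisible group

¬¬-least : ∀ {p} {P : ℕ → Set p} {n} → P n → ¬ ¬ (∃[ m ] P m × (∀ {k} → k ℕ.< m → ¬ P k))
¬¬-least {P = P} {n} Pn ¬least = <-rec (λ n → ¬ P n) (λ n below Pn → ¬least (n , Pn , below)) n Pn

module PartialHoms {c₁ ℓ₁ c₂ ℓ₂} (Γ : AbelianGroup c₁ ℓ₁) (G : AbelianGroup c₂ ℓ₂) where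
  private
    module Γ = AbelianGroup Γ
    module G = AbelianGroup G
    module CΓ = Combinations Γ
    module CG = Combinations G

  Γ×G : AbelianGroup _ _
  Γ×G = DirectProduct.abelianGroup Γ G

  private
    module C× = Combinations Γ×G
    module × = AbelianGroup Γ×G

    proj₁-· : ∀ i (a : ×.Carrier) → proj₁ (i C×.∙∙ a) Γ.≈ i CΓ.∙∙ proj₁ a
    proj₁-· = Homomorphisms.hom-· Γ×G Γ (Homomorphisms.mkHom Γ×G Γ proj₁ proj₁ (λ _ _ → Γ.refl))

    proj₂-· : ∀ i (a : ×.Carrier) → proj₂ (i C×.∙∙ a) G.≈ i CG.∙∙ proj₂ a
    proj₂-· = Homomorphisms.hom-· Γ×G G (Homomorphisms.mkHom Γ×G G proj₂ proj₂ (λ _ _ → G.refl))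

  -- A homomorphism from a subgroup of Γ to G, given by its graph: membership in the domain need not
  -- be decidable, and no values have to be chosen. For a subgroup of Γ × G, single-valuedness over
  -- 0 implies it everywhere.
  record PartialHom p : Set (c₁ ⊔ ℓ₁ ⊔ c₂ ⊔ ℓ₂ ⊔ Level.suc p) where
    field
      graph      : Pred ×.Carrier p
      isSubgroup : IsSubgroup Γ×G graph
      functional : ∀ {y} → graph (Γ.ε , y) → y G.≈ G.ε
    open IsSubgroup isSubgroup public

    single-valued : ∀ {x x′ y y′} → x Γ.≈ x′ → graph (x , y) → graph (x′ , y′) → y G.≈ y′
    single-valued x≈x′ xy x′y′ = CG.x∙y⁻¹≈ε⇒x≈y _ _
      (functional (H-resp (CΓ.x≈y⇒x∙y⁻¹≈ε x≈x′ , G.refl) (H-∙ xy (H-⁻¹ x′y′))))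

  open PartialHom using (graph)

  module _ {p} (Φ : PartialHom p) where
    open PartialHom Φ renaming (graph to φ)

    -- c generates the ideal of all j with j a in the domain of φ (possibly c = 0), and φ (c a) = c b.
    adjoin : ∀ a b c → φ (c C×.∙∙ (a , b)) → (∀ j {y} → φ (j CΓ.∙∙ a , y) → ∃[ q ] j ≡ q ℤ.* c) → PartialHom p
    adjoin a b c c[ab] multiple = record
      { graph      = C×.Adjoin isSubgroup (a , b)
      ; isSubgroup = C×.Adjoin-isSubgroup isSubgroup (a , b)
      ; functional = λ { {y} (j , h) → functional (cancel j y h (in-graph j y h)) }
      }
      where
      in-graph : ∀ j y → φ ((Γ.ε , y) ×.∙ (j C×.∙∙ (a , b)) ×.⁻¹) → φ (j C×.∙∙ (a , b))
      in-graph j y h with q , j≡qc ← multiple j (H-resp (Γ.trans (Γ.⁻¹-cong (Γ.identityˡ _)) (Γ.trans (CΓ.⁻¹-involutive _) (proj₁-· j (a , b))) , G.refl) (H-⁻¹ h)) =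
        H-resp (×.trans (×.sym (C×.*-· q c (a , b))) (C×.·-congˡ (a , b) (≡.sym j≡qc))) (C×.H-· isSubgroup q c[ab])
      cancel : ∀ j y → φ ((Γ.ε , y) ×.∙ (j C×.∙∙ (a , b)) ×.⁻¹) → φ (j C×.∙∙ (a , b)) → φ (Γ.ε , y)
      cancel j y h h′ = H-resp (Algebra.Properties.AbelianGroup.//-rightDividesˡ Γ×G (j C×.∙∙ (a , b)) (Γ.ε , y)) (H-∙ h h′)

  _⊑_ : ∀ {p} → PartialHom p → PartialHom p → Set _
  Φ ⊑ Ψ = ∀ {xy} → graph Φ xy → graph Ψ xy

  -- The integers j with j a in the domain form an ideal. If it is zero, a may be sent to 0.
  -- Otherwise its least positive element c generates it, and a is sent to some b with c b equal to
  -- the prescribed value at c a. The case distinction and the minimum exist only up to double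
  -- negation.
  extend-one : ∀ {p} → IsDivisible G → (Φ : PartialHom p) → ∀ a → ¬ ¬ (∃[ Ψ ] Φ ⊑ Ψ × ∃[ b ] graph Ψ (a , b))
  extend-one divisible Φ a ¬ext = ¬¬-excluded-middle {A = ∃[ c ] Multiple c} λ
    { (no ∄c) → ¬ext (result (adjoin Φ a G.ε 0ℤ H-ε (λ j h → 0ℤ , trivial ∄c j h)) G.ε (C×.⊆Adjoin isSubgroup) (C×.∈Adjoin isSubgroup (a , G.ε)))
    ; (yes (_ , Mc)) → ¬¬-least {P = Multiple} Mc (λ (c , (c≢0 , y₀ , h) , minimal) →
        let b , cb≈y₀ = divisible c {{c≢0}} y₀ in
        ¬ext (result (adjoin Φ a b (+ c) (H-resp (Γ.sym (proj₁-· (+ c) (a , b)) , G.trans (G.sym cb≈y₀) (G.sym (proj₂-· (+ c) (a , b)))) h)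
               (multiple c c≢0 h minimal)) b (C×.⊆Adjoin isSubgroup) (C×.∈Adjoin isSubgroup (a , b)))) }
    where
    open PartialHom Φ renaming (graph to φ)
    Multiple : ℕ → Set _
    Multiple c = NonZero c × ∃[ y ] φ (c CΓ.×ₙ a , y)
    result : ∀ Ψ b → Φ ⊑ Ψ → graph Ψ (a , b) → ∃[ Ψ ] Φ ⊑ Ψ × ∃[ b ] graph Ψ (a , b)
    result Ψ b Φ⊑Ψ ab = Ψ , Φ⊑Ψ , b , ab
    trivial : ¬ ∃ Multiple → ∀ j {y} → φ (j CΓ.∙∙ a , y) → j ≡ 0ℤ ℤ.* 0ℤ
    trivial ∄c (+ zero)  h = ≡.refl
    trivial ∄c (+ suc k) h = ⊥-elim (∄c (suc k , _ , _ , h))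
    trivial ∄c -[1+ k ]  h = ⊥-elim (∄c (suc k , _ , _ , H-resp (CΓ.⁻¹-involutive _ , G.refl) (H-⁻¹ h)))
    -- The remainder of j modulo c again multiplies a into the domain and is smaller than c, so
    -- minimality makes it zero.
    multiple : ∀ c (c≢0 : NonZero c) {y₀} → φ (c CΓ.×ₙ a , y₀) → (∀ {k} → k ℕ.< c → ¬ Multiple k) →
               ∀ j {y} → φ (j CΓ.∙∙ a , y) → ∃[ q ] j ≡ q ℤ.* + c
    multiple c c≢0 {y₀} h minimal j {y} h′ = quot , ≡.trans (ℤ.a≡a%n+[a/n]*n j (+ c))
      (≡.trans (≡.cong (λ r → + r ℤ.+ (j ℤ./ + c) ℤ.* + c) (remainder≡0 (j ℤ.% + c) (ℤ.n%d<d j (+ c)) in-domain)) (ℤ.+-identityˡ _))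
      where
      instance _ = c≢0
      remainder≡0 : ∀ r → r ℕ.< c → (∃[ y ] φ (r CΓ.×ₙ a , y)) → r ≡ 0
      remainder≡0 zero    r<c in-dom = ≡.refl
      remainder≡0 (suc r) r<c in-dom = ⊥-elim (minimal r<c (_ , in-dom))
      quot = j ℤ./ + c
      r = j ℤ.% + c
      in-domain : ∃[ y ] φ (r CΓ.×ₙ a , y)
      in-domain = _ , H-resp (eq , G.refl) (H-∙ h′ (H-⁻¹ (C×.H-· isSubgroup quot h)))
        where
        open import Relation.Binary.Reasoning.Setoid Γ.setoid
        open Algebra.Properties.AbelianGroup Γ using (//-rightDividesʳ)
        eq : (j CΓ.∙∙ a) Γ.∙ proj₁ (quot C×.∙∙ (c CΓ.×ₙ a , y₀)) Γ.⁻¹ Γ.≈ r CΓ.×ₙ a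
        eq = begin
          (j CΓ.∙∙ a) Γ.∙ proj₁ (quot C×.∙∙ (c CΓ.×ₙ a , y₀)) Γ.⁻¹
            ≈⟨ Γ.∙-cong (Γ.trans (CΓ.·-congˡ a (ℤ.a≡a%n+[a/n]*n j (+ c))) (CΓ.+-· (+ r) (quot ℤ.* + c) a))
                 (Γ.⁻¹-cong (Γ.trans (proj₁-· quot (c CΓ.×ₙ a , y₀)) (Γ.sym (CΓ.*-· quot (+ c) a)))) ⟩
          (r CΓ.×ₙ a Γ.∙ (quot ℤ.* + c) CΓ.∙∙ a) Γ.∙ ((quot ℤ.* + c) CΓ.∙∙ a) Γ.⁻¹
            ≈⟨ //-rightDividesʳ _ _ ⟩
          r CΓ.×ₙ a ∎

  extend-all : ∀ {p k} → IsDivisible G → (Φ : PartialHom p) → (g : Vector Γ.Carrier k) →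
               ¬ ¬ (∃[ Ψ ] Φ ⊑ Ψ × (∀ i → ∃[ b ] graph Ψ (g i , b)))
  extend-all {k = zero}  divisible Φ g ¬ext = ¬ext (Φ , (λ h → h) , λ ())
  extend-all {k = suc k} divisible Φ g ¬ext = extend-one divisible Φ (g zero) λ (Ψ , Φ⊑Ψ , b , gb) →
    extend-all divisible Ψ (g ∘ suc) λ (Ω , Ψ⊑Ω , h) →
      ¬ext (Ω , (λ e → Ψ⊑Ω (Φ⊑Ψ e)) , λ { zero → b , Ψ⊑Ω gb ; (suc i) → h i })

  domain-isSubgroup : ∀ {p} (Φ : PartialHom p) → IsSubgroup Γ (λ x → ∃[ y ] graph Φ (x , y))
  domain-isSubgroup Φ = record
    { H-resp = λ { x≈x′ (y , h) → y , H-resp (x≈x′ , G.refl) h }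
    ; H-ε = G.ε , H-ε
    ; H-∙ = λ { (y , h) (y′ , h′) → y G.∙ y′ , H-∙ h h′ }
    ; H-⁻¹ = λ { (y , h) → y G.⁻¹ , H-⁻¹ h }
    }
    where open PartialHom Φ

  -- Divisible groups are injective. As Γ is finitely generated, finitely many one-element
  -- extensions reach all of it, and no choice principle is involved.
  divisible⇒injective : ∀ {p} → IsDivisible G → IsFinitelyGenerated Γ → (Φ : PartialHom p) →
    ¬ ¬ (Σ (GroupHomomorphism Γ.rawGroup G.rawGroup) λ ψ → ∀ {x y} → graph Φ (x , y) → GroupHomomorphism.⟦_⟧ ψ x G.≈ y)
  divisible⇒injective divisible (k , g , generates) Φ ¬ext = extend-all divisible Φ g λ (Ψ , Φ⊑Ψ , dom) →
    let open PartialHom Ψ using (single-valued; H-∙)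
        value : ∀ x → ∃[ y ] graph Ψ (x , y)
        value x = CΓ.generated⊆ (domain-isSubgroup Ψ) dom (generates x)
    in ¬ext (Homomorphisms.mkHom Γ G (λ x → proj₁ (value x))
         (λ {x} {y} x≈y → single-valued x≈y (proj₂ (value x)) (proj₂ (value y)))
         (λ x y → single-valued Γ.refl (proj₂ (value (x Γ.∙ y))) (H-∙ (proj₂ (value x)) (proj₂ (value y))))
       , λ {x} h → single-valued Γ.refl (proj₂ (value x)) (Φ⊑Ψ h))

-- Ranks of the subgroups generated by sublists

module AdjoinRank {c ℓ} (Γ : AbelianGroup c ℓ) where
  open AbelianGroup Γ
  open Combinations Γ
  open Rank Γ

  -- If a were not torsion modulo H, putting it in front of r independent elements of H would give r
  -- + 1 independent ones.
  torsion-of-equal-rank : ∀ {p r} {H : Pred Carrier p} (isSubgroup : IsSubgroup Γ H) → IsRank Γ H r →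
    ∀ {a} → RankBound (Adjoin isSubgroup a) r → ¬ ¬ Saturation isSubgroup a
  torsion-of-equal-rank {r = r} {H} isSubgroup ((u , u∈H , u-ind) , _) {a} bound ¬torsion =
    ℕ.1+n≰n (bound (a ∷ᵥ u) (λ { zero → ∈Adjoin isSubgroup a ; (suc i) → ⊆Adjoin isSubgroup (u∈H i) }) ind)
    where
    open IsSubgroup isSubgroup
    ind : LinearlyIndependent Γ (a ∷ᵥ u)
    ind z z≈ε = λ { zero → z₀≡0 ; (suc i) → u-ind (z ∘ suc) (trans (sym (trans (∙-congʳ (·-congˡ a z₀≡0)) (identityˡ _))) z≈ε) i }
      where
      z₀a∈H : H (z zero ∙∙ a)
      z₀a∈H = H-resp (sym (Algebra.Properties.AbelianGroup.inverseˡ-unique Γ _ _ z≈ε)) (H-⁻¹ (H-lin isSubgroup (z ∘ suc) u u∈H))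
      ∣z₀∣a∈H : ∀ i → H (i ∙∙ a) → H (ℤ.∣ i ∣ ×ₙ a)
      ∣z₀∣a∈H (+ k)    h = h
      ∣z₀∣a∈H -[1+ k ] h = H-resp (⁻¹-involutive _) (H-⁻¹ h)
      z₀≡0 : z zero ≡ 0ℤ
      z₀≡0 = decidable-stable (z zero ℤ.≟ 0ℤ) (λ z₀≢0 →
        ¬torsion (ℤ.∣ z zero ∣ , ℕ.≢-nonZero (z₀≢0 ∘ ℤ.∣i∣≡0⇒i≡0) , ∣z₀∣a∈H (z zero) z₀a∈H))

  module _ {n} (A : Vector Carrier n) where
    ⟨_⟩ : Subset n → Pred Carrier _
    ⟨ S ⟩ = Generated Γ (_↾_ Γ A S)

    ⟨⟩-isSubgroup : ∀ S → IsSubgroup Γ ⟨ S ⟩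
    ⟨⟩-isSubgroup S = generated-isSubgroup (_↾_ Γ A S)

    ⟨⟩-mono : ∀ {S T} → S ⊆ T → ∀ {x} → ⟨ S ⟩ x → ⟨ T ⟩ x
    ⟨⟩-mono {T = T} S⊆T = generated⊆ (⟨⟩-isSubgroup T) (λ (i , i∈S) → gen (i , S⊆T i∈S))

    ⟨∪⟩⊆Adjoin : ∀ {S α x} → ⟨ S ∪ ⁅ α ⁆ ⟩ x → Adjoin (⟨⟩-isSubgroup S) (A α) x
    ⟨∪⟩⊆Adjoin {S} {α} = generated⊆ (Adjoin-isSubgroup (⟨⟩-isSubgroup S) (A α)) (λ (i , i∈) → generator i (x∈p∪q⁻ S ⁅ α ⁆ i∈))
      where
      generator : ∀ i → _ → Adjoin (⟨⟩-isSubgroup S) (A α) (A i)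
      generator i (inj₁ i∈S) = ⊆Adjoin (⟨⟩-isSubgroup S) (gen (i , i∈S))
      generator i (inj₂ i∈α) with ≡.refl ← x∈⁅y⁆⇒x≡y α i∈α = ∈Adjoin (⟨⟩-isSubgroup S) (A α)

    Adjoin⊆ : ∀ {S T α x} → S ⊆ T → α ∈ T → Adjoin (⟨⟩-isSubgroup S) (A α) x → ⟨ T ⟩ x
    Adjoin⊆ {S} {T} {α} S⊆T α∈T (j , h) = resp (Algebra.Properties.AbelianGroup.//-rightDividesˡ Γ (j ∙∙ A α) _)
      (mul (⟨⟩-mono S⊆T h) (H-· (⟨⟩-isSubgroup T) j (gen (α , α∈T))))

    module _ {r : Subset n → ℕ} (rank : IsRankFunction Γ A r) where
      r-mono : ∀ {S T} → S ⊆ T → r S ℕ.≤ r T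
      r-mono {S} {T} S⊆T = rank-mono {H = ⟨ S ⟩} {K = ⟨ T ⟩} (⟨⟩-mono S⊆T) (rank S) (rank T)

      r-adjoin≤ : ∀ S α → r (S ∪ ⁅ α ⁆) ℕ.≤ suc (r S)
      r-adjoin≤ S α = let (u , u∈ , u-ind) , _ = rank (S ∪ ⁅ α ⁆) in
        rankBound-Adjoin (⟨⟩-isSubgroup S) (proj₂ (rank S)) (A α) u (λ i → ⟨∪⟩⊆Adjoin (u∈ i)) u-ind

      r≡⇒torsion : ∀ {S T α} → S ⊆ T → α ∈ T → r T ≡ r S → ¬ ¬ Saturation (⟨⟩-isSubgroup S) (A α)
      r≡⇒torsion {S} {T} {α} S⊆T α∈T rT≡rS = torsion-of-equal-rank (⟨⟩-isSubgroup S) (rank S)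
        (λ {k} w w∈ w-ind → ≡.subst (k ℕ.≤_) rT≡rS (proj₂ (rank T) w (λ i → Adjoin⊆ S⊆T α∈T (w∈ i)) w-ind))

      torsion⇒r≤ : ∀ {S α} → Saturation (⟨⟩-isSubgroup S) (A α) → r (S ∪ ⁅ α ⁆) ℕ.≤ r S
      torsion⇒r≤ {S} {α} t = let (u , u∈ , u-ind) , _ = rank (S ∪ ⁅ α ⁆) in
        rankBound-Saturation (⟨⟩-isSubgroup S) (proj₂ (rank S)) u (λ i → generated⊆ (Saturation-isSubgroup (⟨⟩-isSubgroup S)) generator (u∈ i)) u-ind
        where
        generator : ∀ (i : ∃ (_∈ (S ∪ ⁅ α ⁆))) → Saturation (⟨⟩-isSubgroup S) (A (proj₁ i))
        generator (i , i∈) with x∈p∪q⁻ S ⁅ α ⁆ i∈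
        ... | inj₁ i∈S = ⊆Saturation (⟨⟩-isSubgroup S) (gen (i , i∈S))
        ... | inj₂ i∈α with ≡.refl ← x∈⁅y⁆⇒x≡y α i∈α = t

      -- Write x = s + j α with s in ⟨S⟩. Then j α lies in the saturation of ⟨S⟩; if j were nonzero,
      -- so would α, and the rank could not grow.
      saturated-in-adjoin : ∀ {S α x} → r S ℕ.< r (S ∪ ⁅ α ⁆) → ⟨ S ∪ ⁅ α ⁆ ⟩ x → Saturation (⟨⟩-isSubgroup S) x → ⟨ S ⟩ x
      saturated-in-adjoin {S} {α} {x} r< x∈ x-sat with j , h ← ⟨∪⟩⊆Adjoin x∈ =
        resp (trans (∙-congˡ (trans (⁻¹-cong (·-congˡ (A α) j≡0)) ε⁻¹≈ε)) (identityʳ x)) h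
        where
        module Sat = IsSubgroup (Saturation-isSubgroup (⟨⟩-isSubgroup S))
        jα-sat : Saturation (⟨⟩-isSubgroup S) (j ∙∙ A α)
        jα-sat = Sat.H-resp (trans (∙-congˡ (⁻¹-anti-homo‿- x _)) (trans (comm _ _) (//-rightDividesˡ x _))) (Sat.H-∙ x-sat (Sat.H-⁻¹ (⊆Saturation (⟨⟩-isSubgroup S) h)))
          where open Algebra.Properties.AbelianGroup Γ using (⁻¹-anti-homo‿-; //-rightDividesˡ)
        α-sat : ∀ j → j ≢ 0ℤ → Saturation (⟨⟩-isSubgroup S) (j ∙∙ A α) → Saturation (⟨⟩-isSubgroup S) (A α)
        α-sat (+ zero)     j≢0 _ = contradiction ≡.refl j≢0
        α-sat (+ suc m)    j≢0 (k , k≢0 , h) = k * suc m , ℕ.m*n≢0 k (suc m) {{k≢0}} , resp (×-assocˡ (A α) k (suc m)) h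
        α-sat -[1+ m ]     j≢0 t = α-sat (+ suc m) (λ ()) (Sat.H-resp (⁻¹-involutive _) (Sat.H-⁻¹ t))
        j≡0 : j ≡ 0ℤ
        j≡0 = decidable-stable (j ℤ.≟ 0ℤ) (λ j≢0 → ℕ.<⇒≱ r< (torsion⇒r≤ (α-sat j j≢0 jα-sat)))

-- Choices over all sublists, and alternating sums

¬¬-subsets : ∀ {p} {P : Subset n → Set p} → (∀ B → ¬ ¬ P B) → ¬ ¬ (∀ B → P B)
¬¬-subsets {zero}  h ¬all = h [] (λ p → ¬all (λ { [] → p }))
¬¬-subsets {suc n} h ¬all = ¬¬-subsets (h ∘ (false ∷_)) λ p → ¬¬-subsets (h ∘ (true ∷_)) λ q →
  ¬all (λ { (false ∷ B) → p B ; (true ∷ B) → q B })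

-- A single d must serve all quotients, so that all the groups P_B have the same target G[d].
common-multiple : (k : Subset n → ℕ) → (∀ B → NonZero (k B)) → ∃[ d ] NonZero d × (∀ B → k B ∣ d)
common-multiple {zero}  k k≢0 = k [] , k≢0 [] , λ { [] → divides 1 (≡.sym (ℕ.*-identityˡ _)) }
common-multiple {suc n} k k≢0
  with d , d≢0 , d∣ ← common-multiple (k ∘ (false ∷_)) (k≢0 ∘ (false ∷_))
     | e , e≢0 , e∣ ← common-multiple (k ∘ (true ∷_)) (k≢0 ∘ (true ∷_)) =
  d * e , ℕ.m*n≢0 d e {{d≢0}} {{e≢0}} ,
  λ { (false ∷ B) → ∣-trans (d∣ B) (m∣m*n e) ; (true ∷ B) → ∣-trans (e∣ B) (n∣m*n d) }

∣T∣≡∣S∣+∣T─S∣ : (S T : Subset n) → S ⊆ T → ∣ T ∣ ≡ ∣ S ∣ + ∣ T ─ S ∣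
∣T∣≡∣S∣+∣T─S∣ []          []          S⊆T = ≡.refl
∣T∣≡∣S∣+∣T─S∣ (true  ∷ S) (false ∷ T) S⊆T = ⊥-elim (true⊈false S⊆T)
∣T∣≡∣S∣+∣T─S∣ (true  ∷ S) (true  ∷ T) S⊆T = ≡.cong suc (∣T∣≡∣S∣+∣T─S∣ S T (drop-∷-⊆ S⊆T))
∣T∣≡∣S∣+∣T─S∣ (false ∷ S) (false ∷ T) S⊆T = ∣T∣≡∣S∣+∣T─S∣ S T (drop-∷-⊆ S⊆T)
∣T∣≡∣S∣+∣T─S∣ (false ∷ S) (true  ∷ T) S⊆T = ≡.trans (≡.cong suc (∣T∣≡∣S∣+∣T─S∣ S T (drop-∷-⊆ S⊆T))) (≡.sym (ℕ.+-suc ∣ S ∣ _))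

pos-^ : ∀ a k → + (a ^ k) ≡ (+ a) ℤ.^ k
pos-^ a zero    = ≡.refl
pos-^ a (suc k) = ≡.trans (ℤ.pos-* a (a ^ k)) (≡.cong (+ a ℤ.*_) (pos-^ a k))

1-^ : ∀ k → 1ℤ ℤ.^ k ≡ 1ℤ
1-^ = ℤ.^-zeroˡ

module _ (c e : ℤ) {S T : Subset n} (S⊆T : S ⊆ T) {p : ℕ} (z : Fin p → Fin n → ℤ) (h : Subset n → ℕ)
         (h-sum : ∀ B → + h B ≡ ∑ (λ j → ∏∈ B (z j))) where
  open InclusionExclusion c e

  -- The sums over B and over φ are exchanged, and for each φ the sum over B collapses to a product.
  -- W and V absorb the powers of N that separate m from h.
  interval-nonneg : ∀ W V .{{_ : NonZero W}} (f : Subset n → ℤ) →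
    (∀ B → S ⊆ B → B ⊆ T → + W ℤ.* f B ≡ + V ℤ.* (c ℤ.^ (∣ B ∣ ∸ ∣ S ∣) ℤ.* e ℤ.^ (∣ T ∣ ∸ ∣ B ∣) ℤ.* + h B)) →
    0ℤ ℤ.≤ ∑ (λ j → ∏ (λ i → factor (lookup S i) (lookup T i) (z j i))) →
    0ℤ ℤ.≤ ∑[ S ⊆-⊆ T ] f
  interval-nonneg W V f f≡ nonneg = *-cancel-nonneg W (≡.subst (0ℤ ℤ.≤_) (≡.sym eq) (*-nonneg {+ V} (ℤ.+≤+ ℕ.z≤n) nonneg))
    where
    open ≡.≡-Reasoning
    weight : Subset n → ℤ
    weight B = c ℤ.^ (∣ B ∣ ∸ ∣ S ∣) ℤ.* e ℤ.^ (∣ T ∣ ∸ ∣ B ∣)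
    eq : + W ℤ.* ∑[ S ⊆-⊆ T ] f ≡ + V ℤ.* ∑ (λ j → ∏ (λ i → factor (lookup S i) (lookup T i) (z j i)))
    eq = begin
      + W ℤ.* ∑[ S ⊆-⊆ T ] f
        ≡⟨ filterSum-*ˡ (interval? S T) (+ W) f (subsets n) ⟩
      ∑[ S ⊆-⊆ T ] (λ B → + W ℤ.* f B)
        ≡⟨ filterSum-cong (interval? S T) (λ B (S⊆B , B⊆T) → ≡.trans (f≡ B S⊆B B⊆T) (≡.cong (+ V ℤ.*_)
             (≡.trans (≡.cong (weight B ℤ.*_) (h-sum B)) (*-distribˡ-∑ (weight B) (λ j → ∏∈ B (z j)))))) (subsets n) ⟩
      ∑[ S ⊆-⊆ T ] (λ B → + V ℤ.* ∑ (λ j → term S T (z j) B))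
        ≡⟨ filterSum-*ˡ (interval? S T) (+ V) (λ B → ∑ (λ j → term S T (z j) B)) (subsets n) ⟨
      + V ℤ.* ∑[ S ⊆-⊆ T ] (λ B → ∑ (λ j → term S T (z j) B))
        ≡⟨ ≡.cong (+ V ℤ.*_) (filterSum-∑ (interval? S T) (λ B j → term S T (z j) B) (subsets n)) ⟩
      + V ℤ.* ∑ (λ j → ∑[ S ⊆-⊆ T ] term S T (z j))
        ≡⟨ ≡.cong (+ V ℤ.*_) (∑-cong (λ j → ∑-term S T (z j) S⊆T)) ⟩
      + V ℤ.* ∑ (λ j → ∏ (λ i → factor (lookup S i) (lookup T i) (z j i))) ∎

-- The five statements, given a splitting of every quotient

module Multiplicities {c₁ ℓ₁ c₂ ℓ₂} (Γ : AbelianGroup c₁ ℓ₁) (G : AbelianGroup c₂ ℓ₂)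
            (fg : IsFinitelyGenerated Γ) (twf : IsTorsionWiseFinite G)
            {n} (A : Vector (AbelianGroup.Carrier Γ) n)
            (r : Subset n → ℕ) (rank : IsRankFunction Γ A r)
            (m : Subset n → ℕ) (mult : IsMultiplicity Γ G A m)
            (split : ∀ B → Splitting.Split (quotient Γ (_↾_ Γ A B))) where
  private
    module Γ = AbelianGroup Γ
    module G = AbelianGroup G
    module CΓ = Combinations Γ
    module CG = Combinations G
    module Split B = Splitting.Split (split B)

    exponent = common-multiple Split.k Split.k≢0
    d = proj₁ exponent
    k∣d = proj₂ (proj₂ exponent)

    finite = twf d {{proj₁ (proj₂ exponent)}}
    N = proj₁ finite
    cN = proj₂ finite

    D = torsionSubgroup G d
    module D = AbelianGroup D

    h : Subset n → ℕ
    h B = m B * N ^ Split.s B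

    module SH B = SplitHom (quotient Γ (_↾_ Γ A B)) G (split B) d (k∣d B)

    open QuotientHoms Γ A D cN h (λ B → SH.Hom-cardinality B (mult B) cN)
    open AdjoinRank Γ

    instance
      N≢0 : NonZero N
      N≢0 = Fin.nonZeroIndex (Inverse.to cN D.ε)

    R : ℕ
    R = r ⊥ + Split.s ⊥

    -- Both sides are the rank of Γ, computed from two different quotients.
    r+s≡R : ∀ B → r B + Split.s B ≡ R
    r+s≡R B = ℕ.≤-antisym (≤ B ⊥) (≤ ⊥ B)
      where
      ≤ : ∀ B C → r B + Split.s B ℕ.≤ r C + Split.s C
      ≤ B C = Rank.rank-mono Γ {H = Rank.Everything Γ} {K = Rank.Everything Γ} (λ x → x)
        (Quotient.split-rank Γ (_↾_ Γ A B) (rank B) (split B)) (Quotient.split-rank Γ (_↾_ Γ A C) (rank C) (split C))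

    instance
      N^R≢0 : NonZero (N ^ R)
      N^R≢0 = ℕ.m^n≢0 N R

    m-count : ∀ B → m B * N ^ R ≡ h B * N ^ r B
    m-count B = begin
      m B * N ^ R                          ≡⟨ ≡.cong (λ k → m B * N ^ k) (r+s≡R B) ⟨
      m B * N ^ (r B + Split.s B)          ≡⟨ ≡.cong (m B *_) (ℕ.^-distribˡ-+-* N (r B) (Split.s B)) ⟩
      m B * (N ^ r B * N ^ Split.s B)      ≡⟨ rearrange (m B) (N ^ r B) (N ^ Split.s B) ⟩
      h B * N ^ r B                        ∎
      where
      open ≡.≡-Reasoning
      rearrange : ∀ x y z → x * (y * z) ≡ x * z * y
      rearrange = ℕ.solve-∀

  dependent-divides : ∀ S α → r (S ∪ ⁅ α ⁆) ≡ r S → m (S ∪ ⁅ α ⁆) ∣ m S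
  dependent-divides S α rSα≡rS = from-index (h-adjoin S α)
    where
    open ≡.≡-Reasoning
    Sα = S ∪ ⁅ α ⁆
    rearrange : ∀ x y z → x * y * z ≡ y * (x * z)
    rearrange = ℕ.solve-∀
    from-index : ∃[ i ] i ∣ N × h S ≡ h Sα * i → m Sα ∣ m S
    from-index (i , _ , hS≡) =
      -- The ranks agree, so the powers of N cancel and the index i is itself the quotient.
      divides i (ℕ.*-cancelʳ-≡ (m S) (i * m Sα) (N ^ R) (begin
        m S * N ^ R              ≡⟨ m-count S ⟩
        h S * N ^ r S            ≡⟨ ≡.cong₂ (λ x k → x * N ^ k) hS≡ (≡.sym rSα≡rS) ⟩
        h Sα * i * N ^ r Sα      ≡⟨ rearrange (h Sα) i (N ^ r Sα) ⟩
        i * (h Sα * N ^ r Sα)    ≡⟨ ≡.cong (i *_) (m-count Sα) ⟨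
        i * (m Sα * N ^ R)       ≡⟨ ℕ.*-assoc i (m Sα) (N ^ R) ⟨
        i * m Sα * N ^ R         ∎))

  independent-divides : ∀ S α → r (S ∪ ⁅ α ⁆) ≡ r S + 1 → m S ∣ m (S ∪ ⁅ α ⁆)
  independent-divides S α rSα≡rS+1 = from-index (h-adjoin S α)
    where
    open ≡.≡-Reasoning
    Sα = S ∪ ⁅ α ⁆
    rearrange : ∀ x q i z → x * (q * i * z) ≡ q * (x * i * z)
    rearrange = ℕ.solve-∀
    from-index : ∃[ i ] i ∣ N × h S ≡ h Sα * i → m S ∣ m Sα
    from-index (i , divides q N≡qi , hS≡) =
      -- The rank grows by one, which brings in a factor N = q i; the index i is absorbed by `hS≡`,
      -- and q remains.
      divides q (ℕ.*-cancelʳ-≡ (m Sα) (q * m S) (N ^ R) (begin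
        m Sα * N ^ R                ≡⟨ m-count Sα ⟩
        h Sα * N ^ r Sα             ≡⟨ ≡.cong (λ k → h Sα * N ^ k) (≡.trans rSα≡rS+1 (ℕ.+-comm (r S) 1)) ⟩
        h Sα * (N * N ^ r S)        ≡⟨ ≡.cong (λ x → h Sα * (x * N ^ r S)) N≡qi ⟩
        h Sα * (q * i * N ^ r S)    ≡⟨ rearrange (h Sα) q i (N ^ r S) ⟩
        q * (h Sα * i * N ^ r S)    ≡⟨ ≡.cong (λ x → q * (x * N ^ r S)) hS≡ ⟨
        q * (h S * N ^ r S)         ≡⟨ ≡.cong (q *_) (m-count S) ⟨
        q * (m S * N ^ R)           ≡⟨ ℕ.*-assoc q (m S) (N ^ R) ⟨
        q * m S * N ^ R             ∎))

  -- Monotonicity squeezes r B between r S and r T, so m and h are proportional on the whole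
  -- interval with one constant.
  dependent-alternating-sum : ∀ S T → S ⊆ T → r S ≡ r T →
    ∑[ S ⊆-⊆ T ] (λ B → -1ℤ ℤ.^ (∣ B ∣ ∸ ∣ S ∣) ℤ.* + m B) ℤ.≥ 0ℤ
  dependent-alternating-sum S T S⊆T rS≡rT = interval-nonneg -1ℤ 1ℤ S⊆T values h h-sum (N ^ R) (N ^ r S)
    (λ B → -1ℤ ℤ.^ (∣ B ∣ ∸ ∣ S ∣) ℤ.* + m B) weights
    (∑-complement-nonneg S T)
    where
    weights : ∀ B → S ⊆ B → B ⊆ T → + (N ^ R) ℤ.* (-1ℤ ℤ.^ (∣ B ∣ ∸ ∣ S ∣) ℤ.* + m B) ≡
              + (N ^ r S) ℤ.* (-1ℤ ℤ.^ (∣ B ∣ ∸ ∣ S ∣) ℤ.* 1ℤ ℤ.^ (∣ T ∣ ∸ ∣ B ∣) ℤ.* + h B)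
    weights B S⊆B B⊆T = begin
      + (N ^ R) ℤ.* (σ ℤ.* + m B)
        ≡⟨ rearrange₁ (+ (N ^ R)) σ (+ m B) ⟩
      σ ℤ.* (+ m B ℤ.* + (N ^ R))
        ≡⟨ ≡.cong (σ ℤ.*_) (≡.trans (≡.sym (ℤ.pos-* (m B) (N ^ R))) (≡.trans (≡.cong +_ (m-count B)) (ℤ.pos-* (h B) (N ^ r B)))) ⟩
      σ ℤ.* (+ h B ℤ.* + (N ^ r B))
        ≡⟨ ≡.cong (λ k → σ ℤ.* (+ h B ℤ.* + (N ^ k))) rB≡rS ⟩
      σ ℤ.* (+ h B ℤ.* + (N ^ r S))
        ≡⟨ rearrange₂ σ (+ h B) (+ (N ^ r S)) ⟩
      + (N ^ r S) ℤ.* (σ ℤ.* 1ℤ ℤ.* + h B)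
        ≡⟨ ≡.cong (λ x → + (N ^ r S) ℤ.* (σ ℤ.* x ℤ.* + h B)) (1-^ (∣ T ∣ ∸ ∣ B ∣)) ⟨
      + (N ^ r S) ℤ.* (σ ℤ.* 1ℤ ℤ.^ (∣ T ∣ ∸ ∣ B ∣) ℤ.* + h B) ∎
      where
      open ≡.≡-Reasoning
      σ = -1ℤ ℤ.^ (∣ B ∣ ∸ ∣ S ∣)
      rB≡rS : r B ≡ r S
      rB≡rS = ℕ.≤-antisym (≡.subst (r B ℕ.≤_) (≡.sym rS≡rT) (r-mono A rank B⊆T)) (r-mono A rank S⊆B)
      rearrange₁ : ∀ x s m → x ℤ.* (s ℤ.* m) ≡ s ℤ.* (m ℤ.* x)
      rearrange₁ = ℤ.solve-∀
      rearrange₂ : ∀ s h x → s ℤ.* (h ℤ.* x) ≡ x ℤ.* (s ℤ.* 1ℤ ℤ.* h)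
      rearrange₂ = ℤ.solve-∀

  private
    -- Each added element raises the rank by at most one. The bound is written with sums to avoid
    -- truncated subtraction.
    r-growth : ∀ S T → S ⊆ T → r T + ∣ S ∣ ℕ.≤ r S + ∣ T ∣
    r-growth S T S⊆T = chain-induction (λ B → r B + ∣ S ∣ ℕ.≤ r S + ∣ B ∣) S T S⊆T ℕ.≤-refl step
      where
      open ℕ.≤-Reasoning
      step : ∀ B α → S ⊆ B → B ⊆ T → α ∈ T → α ∉ B → r B + ∣ S ∣ ℕ.≤ r S + ∣ B ∣ → r (B ∪ ⁅ α ⁆) + ∣ S ∣ ℕ.≤ r S + ∣ B ∪ ⁅ α ⁆ ∣
      step B α _ _ _ α∉B bound = begin
        r (B ∪ ⁅ α ⁆) + ∣ S ∣      ≤⟨ ℕ.+-monoˡ-≤ ∣ S ∣ (r-adjoin≤ A rank B α) ⟩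
        suc (r B + ∣ S ∣)          ≤⟨ ℕ.s≤s bound ⟩
        suc (r S + ∣ B ∣)          ≡⟨ ℕ.+-suc (r S) ∣ B ∣ ⟨
        r S + suc ∣ B ∣            ≤⟨ ℕ.+-monoʳ-≤ (r S) (p⊂q⇒∣p∣<∣q∣ (p⊆p∪q ⁅ α ⁆ , α , q⊆p∪q B ⁅ α ⁆ (x∈⁅x⁆ α) , α∉B)) ⟩
        r S + ∣ B ∪ ⁅ α ⁆ ∣        ∎

    -- The growth from S to T is maximal, and the growth from S to B and from B to T is bounded by
    -- the numbers of added elements; hence both bounds are attained.
    independent-rank : ∀ {S T} → S ⊆ T → r T ≡ r S + ∣ T ─ S ∣ → ∀ {B} → S ⊆ B → B ⊆ T → r B ≡ r S + (∣ B ∣ ∸ ∣ S ∣)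
    independent-rank {S} {T} S⊆T rT≡ {B} S⊆B B⊆T = ℕ.+-cancelʳ-≡ ∣ S ∣ (r B) (r S + (∣ B ∣ ∸ ∣ S ∣)) (begin
      r B + ∣ S ∣                          ≡⟨ ℕ.≤-antisym (r-growth S B S⊆B) lower ⟩
      r S + ∣ B ∣                          ≡⟨ ≡.cong (λ x → r S + x) (ℕ.m∸n+n≡m (p⊆q⇒∣p∣≤∣q∣ S⊆B)) ⟨
      r S + (∣ B ∣ ∸ ∣ S ∣ + ∣ S ∣)        ≡⟨ ℕ.+-assoc (r S) _ ∣ S ∣ ⟨
      r S + (∣ B ∣ ∸ ∣ S ∣) + ∣ S ∣        ∎)
      where
      open ≡.≡-Reasoning
      lower : r S + ∣ B ∣ ℕ.≤ r B + ∣ S ∣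
      lower = ℕ.+-cancelˡ-≤ ∣ T ∣ (r S + ∣ B ∣) (r B + ∣ S ∣) (≡.subst₂ ℕ._≤_
        (begin
          r T + ∣ B ∣ + ∣ S ∣                     ≡⟨ ≡.cong (λ x → x + ∣ B ∣ + ∣ S ∣) rT≡ ⟩
          r S + ∣ T ─ S ∣ + ∣ B ∣ + ∣ S ∣         ≡⟨ shuffle₁ (r S) (∣ T ─ S ∣) (∣ B ∣) (∣ S ∣) ⟩
          ∣ S ∣ + ∣ T ─ S ∣ + (r S + ∣ B ∣)       ≡⟨ ≡.cong (_+ (r S + ∣ B ∣)) (∣T∣≡∣S∣+∣T─S∣ S T S⊆T) ⟨
          ∣ T ∣ + (r S + ∣ B ∣)                   ∎)
        (shuffle₂ (r B) (∣ T ∣) (∣ S ∣))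
        (ℕ.+-monoˡ-≤ ∣ S ∣ (r-growth B T B⊆T)))
        where
        shuffle₁ : ∀ a b c d → a + b + c + d ≡ d + b + (a + c)
        shuffle₁ = ℕ.solve-∀
        shuffle₂ : ∀ a b c → a + b + c ≡ b + (a + c)
        shuffle₂ = ℕ.solve-∀

  -- Now r B - r S is the number of elements added, so passing from m to h costs one factor N per
  -- element of B ∖ S. This is the origin of the weight N in N [φ(αᵢ) = 0] - 1.
  independent-alternating-sum : ∀ S T → S ⊆ T → r T ≡ r S + ∣ T ─ S ∣ →
    ∑[ S ⊆-⊆ T ] (λ B → -1ℤ ℤ.^ (∣ T ∣ ∸ ∣ B ∣) ℤ.* + m B) ℤ.≥ 0ℤ
  independent-alternating-sum S T S⊆T rT≡ = interval-nonneg (+ N) -1ℤ S⊆T values h h-sum (N ^ R) (N ^ r S)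
    (λ B → -1ℤ ℤ.^ (∣ T ∣ ∸ ∣ B ∣) ℤ.* + m B) weights (∑-factor-nonneg N≢0 S T)
    where
    weights : ∀ B → S ⊆ B → B ⊆ T → + (N ^ R) ℤ.* (-1ℤ ℤ.^ (∣ T ∣ ∸ ∣ B ∣) ℤ.* + m B) ≡
              + (N ^ r S) ℤ.* ((+ N) ℤ.^ (∣ B ∣ ∸ ∣ S ∣) ℤ.* -1ℤ ℤ.^ (∣ T ∣ ∸ ∣ B ∣) ℤ.* + h B)
    weights B S⊆B B⊆T = begin
      + (N ^ R) ℤ.* (σ ℤ.* + m B)
        ≡⟨ rearrange₁ (+ (N ^ R)) σ (+ m B) ⟩
      σ ℤ.* (+ m B ℤ.* + (N ^ R))
        ≡⟨ ≡.cong (σ ℤ.*_) (≡.trans (≡.sym (ℤ.pos-* (m B) (N ^ R))) (≡.trans (≡.cong +_ (m-count B)) (ℤ.pos-* (h B) (N ^ r B)))) ⟩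
      σ ℤ.* (+ h B ℤ.* + (N ^ r B))
        ≡⟨ ≡.cong (λ x → σ ℤ.* (+ h B ℤ.* x)) N^rB ⟩
      σ ℤ.* (+ h B ℤ.* (+ (N ^ r S) ℤ.* (+ N) ℤ.^ (∣ B ∣ ∸ ∣ S ∣)))
        ≡⟨ rearrange₂ σ (+ h B) (+ (N ^ r S)) _ ⟩
      + (N ^ r S) ℤ.* ((+ N) ℤ.^ (∣ B ∣ ∸ ∣ S ∣) ℤ.* σ ℤ.* + h B) ∎
      where
      open ≡.≡-Reasoning
      σ = -1ℤ ℤ.^ (∣ T ∣ ∸ ∣ B ∣)
      N^rB : + (N ^ r B) ≡ + (N ^ r S) ℤ.* (+ N) ℤ.^ (∣ B ∣ ∸ ∣ S ∣)
      N^rB = begin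
        + (N ^ r B)                                  ≡⟨ ≡.cong (λ k → + (N ^ k)) (independent-rank S⊆T rT≡ S⊆B B⊆T) ⟩
        + (N ^ (r S + (∣ B ∣ ∸ ∣ S ∣)))              ≡⟨ ≡.cong +_ (ℕ.^-distribˡ-+-* N (r S) (∣ B ∣ ∸ ∣ S ∣)) ⟩
        + (N ^ r S * N ^ (∣ B ∣ ∸ ∣ S ∣))            ≡⟨ ℤ.pos-* (N ^ r S) _ ⟩
        + (N ^ r S) ℤ.* + (N ^ (∣ B ∣ ∸ ∣ S ∣))      ≡⟨ ≡.cong (+ (N ^ r S) ℤ.*_) (pos-^ N (∣ B ∣ ∸ ∣ S ∣)) ⟩
        + (N ^ r S) ℤ.* (+ N) ℤ.^ (∣ B ∣ ∸ ∣ S ∣)    ∎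
      rearrange₁ : ∀ x s m → x ℤ.* (s ℤ.* m) ≡ s ℤ.* (m ℤ.* x)
      rearrange₁ = ℤ.solve-∀
      rearrange₂ : ∀ s h x y → s ℤ.* (h ℤ.* (x ℤ.* y)) ≡ x ℤ.* (y ℤ.* s ℤ.* h)
      rearrange₂ = ℤ.solve-∀

  module _ (divisible : IsDivisible G) (S T B C : Subset n) (S⊆T : S ⊆ T) (T≡S∪B∪C : T ≡ S ∪ B ∪ C)
           (B∩C-empty : Empty (B ∩ C)) (ranks : ∀ R → S ⊆ R → R ⊆ T → r R ≡ r S + ∣ R ∩ B ∣) where
    private
      SB = S ∪ B
      SC = S ∪ C
      open GroupHomomorphism
      module PS = AbelianGroup (P S)

      S⊆SB : S ⊆ SB
      S⊆SB = p⊆p∪q B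

      S⊆SC : S ⊆ SC
      S⊆SC = p⊆p∪q C

      ⊆T : ∀ {i} → i ∈ S ∪ B ∪ C → i ∈ T
      ⊆T = ≡.subst (_ ∈_) (≡.sym T≡S∪B∪C)

      SB⊆T : SB ⊆ T
      SB⊆T i∈ with x∈p∪q⁻ S B i∈
      ... | inj₁ i∈S = S⊆T i∈S
      ... | inj₂ i∈B = ⊆T (q⊆p∪q S (B ∪ C) (p⊆p∪q C i∈B))

      SC⊆T : SC ⊆ T
      SC⊆T i∈ with x∈p∪q⁻ S C i∈
      ... | inj₁ i∈S = S⊆T i∈S
      ... | inj₂ i∈C = ⊆T (q⊆p∪q S (B ∪ C) (q⊆p∪q B C i∈C))

      T⊆SB∪SC : ∀ {i} → i ∈ T → ¬ i ∈ SB → i ∈ SC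
      T⊆SB∪SC {i} i∈T i∉SB with x∈p∪q⁻ S (B ∪ C) (≡.subst (i ∈_) T≡S∪B∪C i∈T)
      ... | inj₁ i∈S = S⊆SC i∈S
      ... | inj₂ i∈B∪C with x∈p∪q⁻ B C i∈B∪C
      ... | inj₁ i∈B = contradiction (q⊆p∪q S B i∈B) i∉SB
      ... | inj₂ i∈C = q⊆p∪q S C i∈C

      -- On the interval from S to T the rank depends only on the intersection with B, and T and SB
      -- meet B in the same set; likewise SC and S.
      rT≡rSB : r T ≡ r SB
      rT≡rSB = ≡.trans (ranks T S⊆T ⊆-refl) (≡.trans (≡.cong (λ p → r S + ∣ p ∣) (⊆-antisym
        (λ i∈ → let _ , i∈B = x∈p∩q⁻ T B i∈ in x∈p∩q⁺ (q⊆p∪q S B i∈B , i∈B))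
        (λ i∈ → let i∈SB , i∈B = x∈p∩q⁻ SB B i∈ in x∈p∩q⁺ (SB⊆T i∈SB , i∈B))))
        (≡.sym (ranks SB S⊆SB SB⊆T)))

      rSC≡rS : r SC ≡ r S
      rSC≡rS = ≡.trans (ranks SC S⊆SC SC⊆T) (≡.trans (≡.cong (λ p → r S + ∣ p ∣) (⊆-antisym SC∩B⊆
        (λ i∈ → let i∈S , i∈B = x∈p∩q⁻ S B i∈ in x∈p∩q⁺ (S⊆SC i∈S , i∈B))))
        (≡.sym (ranks S ⊆-refl S⊆T)))
        where
        SC∩B⊆ : SC ∩ B ⊆ S ∩ B
        SC∩B⊆ i∈ with i∈SC , i∈B ← x∈p∩q⁻ SC B i∈ with x∈p∪q⁻ S C i∈SC
        ... | inj₁ i∈S = x∈p∩q⁺ (i∈S , i∈B)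
        ... | inj₂ i∈C = ⊥-elim (B∩C-empty (_ , x∈p∩q⁺ (i∈B , i∈C)))

      Sat : Subset n → Γ.Carrier → Set _
      Sat S = CΓ.Saturation (⟨⟩-isSubgroup A S)

      Sat-mono : ∀ {S T} → S ⊆ T → ∀ {x} → Sat S x → Sat T x
      Sat-mono S⊆T (k , k≢0 , g) = k , k≢0 , ⟨⟩-mono A S⊆T g

      -- Every element of B raises the rank, so adding it creates no new element inside the
      -- saturation of ⟨S⟩. This makes the gluing well defined: on the overlap, which is ⟨S⟩, φ
      -- vanishes too.
      saturated : ∀ x → ⟨ A ⟩ SB x → Sat S x → ⟨ A ⟩ S x
      saturated = chain-induction (λ B′ → ∀ x → ⟨ A ⟩ B′ x → Sat S x → ⟨ A ⟩ S x) S SB S⊆SB (λ x x∈ _ → x∈)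
        λ B′ α S⊆B′ B′⊆SB α∈SB α∉B′ ih x x∈ x-sat →
          ih x (saturated-in-adjoin A rank (grows B′ α S⊆B′ B′⊆SB α∈SB α∉B′) x∈ (Sat-mono S⊆B′ x-sat)) x-sat
        where
        grows : ∀ B′ α → S ⊆ B′ → B′ ⊆ SB → α ∈ SB → α ∉ B′ → r B′ ℕ.< r (B′ ∪ ⁅ α ⁆)
        grows B′ α S⊆B′ B′⊆SB α∈SB α∉B′ = ≡.subst₂ ℕ._<_
          (≡.sym (ranks B′ S⊆B′ (SB⊆T ∘ B′⊆SB)))
          (≡.sym (ranks (B′ ∪ ⁅ α ⁆) (p⊆p∪q ⁅ α ⁆ ∘ S⊆B′) B′α⊆T))
          (ℕ.+-monoʳ-< (r S) (p⊂q⇒∣p∣<∣q∣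
            ( (λ i∈ → let i∈B′ , i∈B = x∈p∩q⁻ B′ B i∈ in x∈p∩q⁺ (p⊆p∪q ⁅ α ⁆ i∈B′ , i∈B))
            , α , x∈p∩q⁺ (q⊆p∪q B′ ⁅ α ⁆ (x∈⁅x⁆ α) , α∈B) , (λ α∈ → α∉B′ (proj₁ (x∈p∩q⁻ B′ B α∈))))))
          where
          α∈B : α ∈ B
          α∈B = [ (λ α∈S → contradiction (S⊆B′ α∈S) α∉B′) , (λ α∈B → α∈B) ]′ (x∈p∪q⁻ S B α∈SB)
          B′α⊆T : B′ ∪ ⁅ α ⁆ ⊆ T
          B′α⊆T i∈ with x∈p∪q⁻ B′ ⁅ α ⁆ i∈
          ... | inj₁ i∈B′ = SB⊆T (B′⊆SB i∈B′)
          ... | inj₂ i∈α with ≡.refl ← x∈⁅y⁆⇒x≡y α i∈α = SB⊆T α∈SB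

      module _ (φ : PS.Carrier) where
        open PartialHoms Γ G
        private
          module Sat = IsSubgroup (CΓ.Saturation-isSubgroup (⟨⟩-isSubgroup A S))

          -- φ on the saturation of ⟨S⟩ and 0 on ⟨S ∪ B⟩.
          glued : PartialHom (c₁ ⊔ ℓ₁ ⊔ ℓ₂)
          glued = record
            { graph = λ (x , y) → ∃[ t ] Sat S t × ⟨ A ⟩ SB (x Γ.∙ t Γ.⁻¹) × proj₁ (⟦ φ ⟧ t) G.≈ y
            ; isSubgroup = record
              { H-resp = λ (x≈x′ , y≈y′) (t , t-sat , g , eq) → t , t-sat , resp (Γ.∙-congʳ x≈x′) g , G.trans eq y≈y′
              ; H-ε = Γ.ε , Sat.H-ε , resp (Γ.sym (Γ.inverseʳ Γ.ε)) unit , ε-homo φ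
              ; H-∙ = λ (t , t-sat , g , eq) (t′ , t′-sat , g′ , eq′) → t Γ.∙ t′ , Sat.H-∙ t-sat t′-sat ,
                  resp (Γ.trans (CΓ.interchange _ _ _ _) (Γ.∙-congˡ (CΓ.⁻¹-∙-comm t t′))) (mul g g′) ,
                  G.trans (homo φ t t′) (G.∙-cong eq eq′)
              ; H-⁻¹ = λ (t , t-sat , g , eq) → t Γ.⁻¹ , Sat.H-⁻¹ t-sat ,
                  resp (Γ.sym (CΓ.⁻¹-∙-comm _ _)) (inv g) , G.trans (⁻¹-homo φ t) (G.⁻¹-cong eq)
              }
            ; functional = λ (t , t-sat , g , eq) → G.trans (G.sym eq)
                (G.trans (⟦⟧-cong φ (resp (Γ.sym (Quotient.∙ε⁻¹ Γ (_↾_ Γ A S)))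
                   (saturated t (resp (Γ.trans (Γ.⁻¹-cong (Γ.identityˡ _)) (CΓ.⁻¹-involutive t)) (inv g)) t-sat))) (ε-homo φ))
            }

        decomposition : ¬ ¬ (Σ (AbelianGroup.Carrier (P SB)) λ β → Σ (AbelianGroup.Carrier (P SC)) λ γ →
                         ∀ x → ⟦ β ⟧ x D.∙ ⟦ γ ⟧ x D.≈ ⟦ φ ⟧ x)
        decomposition ¬dec = divisible⇒injective divisible fg glued λ (ψ , ψ-extends) → ¬dec (result ψ ψ-extends)
          where
          module _ (ψ : GroupHomomorphism Γ.rawGroup G.rawGroup) (ψ-extends : ∀ {x y} → PartialHom.graph glued (x , y) → ⟦ ψ ⟧ x G.≈ y) where
            ψ-on-SB : ∀ {x} → ⟨ A ⟩ SB x → ⟦ ψ ⟧ x G.≈ G.ε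
            ψ-on-SB g = ψ-extends (Γ.ε , Sat.H-ε , resp (Γ.sym (Quotient.∙ε⁻¹ Γ (_↾_ Γ A S))) g , ε-homo φ)

            ψ-on-Sat : ∀ {t} → Sat S t → ⟦ ψ ⟧ t G.≈ proj₁ (⟦ φ ⟧ t)
            ψ-on-Sat {t} t-sat = ψ-extends (t , t-sat , resp (Γ.sym (Γ.inverseʳ t)) unit , G.refl)

            -- ψ has values in G, not in G[d]. Only what it induces on the torsion of Γ/⟨SB⟩ is
            -- kept, where d forces the values into G[d].
            ψₜ : GroupHomomorphism (AbelianGroup.rawGroup (torsion (Q SB))) G.rawGroup
            ψₜ = Homomorphisms.mkHom (torsion (Q SB)) G (λ t → ⟦ ψ ⟧ (proj₁ t))
              (λ {s} {t} g → CG.x∙y⁻¹≈ε⇒x≈y _ _ (G.trans (G.sym (Homomorphisms.hom-∙⁻¹ Γ G ψ (proj₁ s) (proj₁ t))) (ψ-on-SB g)))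
              (λ s t → homo ψ (proj₁ s) (proj₁ t))

            -- Agreement with φ is only required on torsion; 0 on the free part is an arbitrary
            -- choice.
            β : AbelianGroup.Carrier (P SB)
            β = SH.extend SB ψₜ (λ _ → D.ε)

            φ-β : PS.Carrier
            φ-β = φ PS.∙ inflate S⊆SB β PS.⁻¹

            -- For i ∈ C the rank does not grow, so A i lies in the saturation of ⟨S⟩, where β
            -- agrees with φ by way of ψ. The saturation is known only up to double negation, which
            -- decidable equality in D removes.
            kills : Kills φ-β SC
            kills i i∈SC with x∈p∪q⁻ S C i∈SC
            ... | inj₁ i∈S = kills-own φ-β i i∈S
            ... | inj₂ i∈C = decidable-stable (≈-dec cN (⟦ φ-β ⟧ (A i)) D.ε) λ ¬eq →
              r≡⇒torsion A rank S⊆SC i∈SC rSC≡rS λ i-sat → ¬eq (CG.x≈y⇒x∙y⁻¹≈ε (G.sym (G.trans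
                (SH.extend-torsion SB ψₜ (λ _ → D.ε) (A i , Quotient.saturation⇒torsion Γ (_↾_ Γ A SB) (Sat-mono S⊆SB i-sat)))
                (ψ-on-Sat i-sat))))

            result : Σ (AbelianGroup.Carrier (P SB)) λ β → Σ (AbelianGroup.Carrier (P SC)) λ γ → ∀ x → ⟦ β ⟧ x D.∙ ⟦ γ ⟧ x D.≈ ⟦ φ ⟧ x
            result = β , factor-through φ-β kills , λ x → G.trans (G.comm _ _) (Algebra.Properties.AbelianGroup.//-rightDividesˡ G _ _)

    molecule-product : m S * m T ≡ m SB * m SC
    molecule-product = ℕ.*-cancelʳ-≡ (m S * m T) (m SB * m SC) (N ^ R * N ^ R) {{ℕ.m*n≢0 (N ^ R) (N ^ R)}} (begin
      m S * m T * (N ^ R * N ^ R)                  ≡⟨ regroup (m S) (m T) (N ^ R) (N ^ R) ⟩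
      m S * N ^ R * (m T * N ^ R)                  ≡⟨ ≡.cong₂ _*_ (m-count S) (m-count T) ⟩
      h S * N ^ r S * (h T * N ^ r T)              ≡⟨ regroup (h S) (h T) (N ^ r S) (N ^ r T) ⟨
      -- The powers of N on the two sides match because r S = r SC and r T = r SB.
      h S * h T * (N ^ r S * N ^ r T)              ≡⟨ ≡.cong₂ _*_ hS*hT (≡.trans (≡.cong₂ (λ a b → N ^ a * N ^ b) (≡.sym rSC≡rS) rT≡rSB) (ℕ.*-comm (N ^ r SC) (N ^ r SB))) ⟩
      h SB * h SC * (N ^ r SB * N ^ r SC)          ≡⟨ regroup (h SB) (h SC) (N ^ r SB) (N ^ r SC) ⟩
      h SB * N ^ r SB * (h SC * N ^ r SC)          ≡⟨ ≡.cong₂ _*_ (m-count SB) (m-count SC) ⟨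
      m SB * N ^ R * (m SC * N ^ R)                ≡⟨ regroup (m SB) (m SC) (N ^ R) (N ^ R) ⟨
      m SB * m SC * (N ^ R * N ^ R)                ∎)
      where
      open ≡.≡-Reasoning
      regroup : ∀ a b x y → a * b * (x * y) ≡ a * x * (b * y)
      regroup = ℕ.solve-∀
      hS*hT : h S * h T ≡ h SB * h SC
      hS*hT = h-decompose S T SB SC S⊆SB S⊆SC SB⊆T SC⊆T T⊆SB∪SC
        (λ φ ¬dec → decomposition φ (λ (β , γ , eq) → ¬dec ((β , γ) , eq)))

mainTheorem17 : ∀ {c₁ ℓ₁ c₂ ℓ₂} (Γ : AbelianGroup c₁ ℓ₁) (G : AbelianGroup c₂ ℓ₂) →
    IsFinitelyGenerated Γ → IsTorsionWiseFinite G →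
    ∀ {n} (A : Vector (AbelianGroup.Carrier Γ) n) →
    (r : Subset n → ℕ) → IsRankFunction Γ A r →
    (m : Subset n → ℕ) → IsMultiplicity Γ G A m →
    (∀ S (α : Fin n) → r (S ∪ ⁅ α ⁆) ≡ r S → m (S ∪ ⁅ α ⁆) ∣ m S)
    × (∀ S (α : Fin n) → r (S ∪ ⁅ α ⁆) ≡ r S + 1 → m S ∣ m (S ∪ ⁅ α ⁆))
    × (∀ S T → S ⊆ T → r S ≡ r T →
    ∑[ S ⊆-⊆ T ] (λ B → -1ℤ ℤ.^ (∣ B ∣ ∸ ∣ S ∣) ℤ.* + m B) ℤ.≥ 0ℤ)
    × (∀ S T → S ⊆ T → r T ≡ r S + ∣ T ─ S ∣ →
    ∑[ S ⊆-⊆ T ] (λ B → -1ℤ ℤ.^ (∣ T ∣ ∸ ∣ B ∣) ℤ.* + m B) ℤ.≥ 0ℤ)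
    × (IsDivisible G →
    ∀ S T B C → S ⊆ T → T ≡ S ∪ B ∪ C →
    Empty (S ∩ B) → Empty (S ∩ C) → Empty (B ∩ C) →
    (∀ R → S ⊆ R → R ⊆ T → r R ≡ r S + ∣ R ∩ B ∣) →
    m S * m T ≡ m (S ∪ B) * m (S ∪ C))
mainTheorem17 Γ G fg twf A r rank m mult =
    (λ S α eq → stable (m (S ∪ ⁅ α ⁆) ∣? m S) λ sp → M.dependent-divides sp S α eq)
  , (λ S α eq → stable (m S ∣? m (S ∪ ⁅ α ⁆)) λ sp → M.independent-divides sp S α eq)
  , (λ S T S⊆T eq → stable (0ℤ ℤ.≤? _) λ sp → M.dependent-alternating-sum sp S T S⊆T eq)
  , (λ S T S⊆T eq → stable (0ℤ ℤ.≤? _) λ sp → M.independent-alternating-sum sp S T S⊆T eq)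
  , (λ divisible S T B C S⊆T T≡ _ _ B∩C-empty ranks → stable (m S * m T ℕ.≟ m (S ∪ B) * m (S ∪ C)) λ sp →
       M.molecule-product sp divisible S T B C S⊆T T≡ B∩C-empty ranks)
  where
  module M = Multiplicities Γ G fg twf A r rank m mult
  Splits = ∀ B → Splitting.Split (quotient Γ (_↾_ Γ A B))
  -- Each quotient splits only up to double negation. There are finitely many sublists, so these
  -- double negations combine into one, which the decidability of the conclusion then removes.
  stable : ∀ {P : Set} → Dec P → (Splits → P) → P
  stable P? proof = decidable-stable P? λ ¬P →
    ¬¬-subsets (λ B → Splitting.finitelyGenerated⇒¬¬split (quotient Γ (_↾_ Γ A B)) (Quotient.finitelyGenerated-quotient Γ (_↾_ Γ A B) fg))
      (λ sp → ¬P (proof sp))
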